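{- Let $x$ be a complex number with $|x|<1$, let $E(x)=\prod_{n=1}^{\infty}(1-x^{n})$, and let $I_0,I_1,I_2$ be the components of type $0,1,2$ mod $3$ of the power series $E(x)E(x^{2})$. Then $$I_{2}I_{0}=-2I_{1}^{2}\qquad\text{and}\qquad I_{1}=-x\,E(x^{9})E(x^{18}).$$
   Context: A power series of the form $\sum_{n\ge 0}b(n)x^{3n+r}$ with $0\le r<3$ is said to be of type $r$ mod $3$. Write $E(x)E(x^2)=\prod_{n=1}^{\infty}(1-x^{n})(1-x^{2n})=\sum_{j\ge 0}c_j x^{j}$ for $|x|<1$. For $k\in\{0,1,2\}$, $I_k=I_k(x)=\sum_{j\equiv k\,(\mathrm{mod}\,3)}c_jx^{j}$, so that $E(x)E(x^2)=I_0+I_1+I_2$ with $I_k$ of type $k$ mod $3$. -}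

module Defs where

open import Algebra.Bundles using (CommutativeMonoid)
open import Data.Bool using (if_then_else_)
open import Data.Integer as ℤ using (ℤ; 0ℤ; 1ℤ)
open import Data.Nat as ℕ using (ℕ; zero; suc; _≡ᵇ_; _⊔_; _%_)
import Data.Nat.Properties as ℕ
open import Data.Product using (∃-syntax; _×_; _,_; proj₁; proj₂)
open import Data.Rational as ℚ using (ℚ; 0ℚ; 1ℚ; ½; Positive; NonZero; 1/_)
import Data.Rational.Properties as ℚ
open import Relation.Binary.PropositionalEquality
  using (_≡_; sym; trans; cong; cong₂; subst; module ≡-Reasoning)

Eventually : (ℕ → Set) → Set
Eventually P = ∃[ N ] (∀ n → N ℕ.≤ n → P n)

IsCauchy : (ℕ → ℚ) → Set
IsCauchy s = ∀ ε → 0ℚ ℚ.< ε →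
  ∃[ N ] (∀ m n → N ℕ.≤ m → N ℕ.≤ n → ℚ.∣ s m ℚ.- s n ∣ ℚ.< ε)

record ℝ : Set where
  constructor mkℝ
  field
    seq    : ℕ → ℚ
    cauchy : IsCauchy seq

open ℝ public

infix 4 _≈ℝ_ _<ℝ_

_≈ℝ_ : ℝ → ℝ → Set
a ≈ℝ b = ∀ ε → 0ℚ ℚ.< ε → Eventually λ n → ℚ.∣ seq a n ℚ.- seq b n ∣ ℚ.< ε

_<ℝ_ : ℝ → ℝ → Set
a <ℝ b = ∃[ δ ] (0ℚ ℚ.< δ × Eventually λ n → seq a n ℚ.+ δ ℚ.≤ seq b n)

private
  EventuallyBounded : (ℕ → ℚ) → Set
  EventuallyBounded s = ∃[ B ] (Positive B × Eventually λ n → ℚ.∣ s n ∣ ℚ.≤ B)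

  abstract
    +-difference : ∀ p q r s → (p ℚ.+ q) ℚ.- (r ℚ.+ s) ≡ (p ℚ.- r) ℚ.+ (q ℚ.- s)
    +-difference p q r s = begin
      (p ℚ.+ q) ℚ.- (r ℚ.+ s)          ≡⟨ cong (p ℚ.+ q ℚ.+_) (ℚ.neg-distrib-+ r s) ⟩
      (p ℚ.+ q) ℚ.+ (ℚ.- r ℚ.+ ℚ.- s)  ≡⟨ medial p q (ℚ.- r) (ℚ.- s) ⟩
      (p ℚ.- r) ℚ.+ (q ℚ.- s)          ∎
      where
      open ≡-Reasoning
      open import Algebra.Properties.CommutativeSemigroup
        (CommutativeMonoid.commutativeSemigroup ℚ.+-0-commutativeMonoid)
        renaming (interchange to medial)

    add-subtract : ∀ p q → p ≡ (p ℚ.- q) ℚ.+ q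
    add-subtract p q = sym (begin
      (p ℚ.- q) ℚ.+ q      ≡⟨ ℚ.+-assoc p (ℚ.- q) q ⟩
      p ℚ.+ (ℚ.- q ℚ.+ q)  ≡⟨ cong (p ℚ.+_) (ℚ.+-inverseˡ q) ⟩
      p ℚ.+ 0ℚ             ≡⟨ ℚ.+-identityʳ p ⟩
      p                    ∎)
      where open ≡-Reasoning

    telescope : ∀ p q r → (p ℚ.- q) ℚ.+ (q ℚ.- r) ≡ p ℚ.- r
    telescope p q r = begin
      (p ℚ.- q) ℚ.+ (q ℚ.- r)      ≡⟨ ℚ.+-assoc (p ℚ.- q) q (ℚ.- r) ⟨
      (p ℚ.- q) ℚ.+ q ℚ.+ (ℚ.- r)  ≡⟨ cong (ℚ._- r) (add-subtract p q) ⟨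
      p ℚ.- r                      ∎
      where open ≡-Reasoning

    *-distribˡ-- : ∀ p q r → p ℚ.* (q ℚ.- r) ≡ p ℚ.* q ℚ.- p ℚ.* r
    *-distribˡ-- p q r = trans (ℚ.*-distribˡ-+ p q (ℚ.- r))
      (cong (p ℚ.* q ℚ.+_) (sym (ℚ.neg-distribʳ-* p r)))

    *-difference : ∀ p q r s →
      p ℚ.* q ℚ.- r ℚ.* s ≡ p ℚ.* (q ℚ.- s) ℚ.+ s ℚ.* (p ℚ.- r)
    *-difference p q r s = sym (begin
      p ℚ.* (q ℚ.- s) ℚ.+ s ℚ.* (p ℚ.- r)
        ≡⟨ cong₂ ℚ._+_ (*-distribˡ-- p q s) (*-distribˡ-- s p r) ⟩
      (p ℚ.* q ℚ.- p ℚ.* s) ℚ.+ (s ℚ.* p ℚ.- s ℚ.* r)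
        ≡⟨ cong (p ℚ.* q ℚ.- p ℚ.* s ℚ.+_) (cong₂ ℚ._-_ (ℚ.*-comm s p) (ℚ.*-comm s r)) ⟩
      (p ℚ.* q ℚ.- p ℚ.* s) ℚ.+ (p ℚ.* s ℚ.- r ℚ.* s)
        ≡⟨ telescope (p ℚ.* q) (p ℚ.* s) (r ℚ.* s) ⟩
      p ℚ.* q ℚ.- r ℚ.* s ∎)
      where open ≡-Reasoning

    half-pos : ∀ {ε} → 0ℚ ℚ.< ε → 0ℚ ℚ.< ε ℚ.* ½
    half-pos {ε} 0<ε =
      subst (ℚ._< ε ℚ.* ½) (ℚ.*-zeroˡ ½) (ℚ.*-monoˡ-<-pos ½ 0<ε)

    halves : ∀ ε → ε ℚ.* ½ ℚ.+ ε ℚ.* ½ ≡ ε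
    halves ε = trans (sym (ℚ.*-distribˡ-+ ε ½ ½)) (ℚ.*-identityʳ ε)

    const-cauchy : ∀ q → IsCauchy (λ _ → q)
    const-cauchy q ε 0<ε = 0 , λ _ _ _ _ →
      subst (ℚ._< ε) (sym (cong ℚ.∣_∣ (ℚ.+-inverseʳ q))) 0<ε

    +-cauchy : ∀ s t → IsCauchy s → IsCauchy t → IsCauchy (λ n → s n ℚ.+ t n)
    +-cauchy s t cs ct ε 0<ε
      with cs (ε ℚ.* ½) (half-pos 0<ε) | ct (ε ℚ.* ½) (half-pos 0<ε)
    ... | M , hM | N , hN = M ⊔ N , λ m n m≥ n≥ → begin-strict
      ℚ.∣ (s m ℚ.+ t m) ℚ.- (s n ℚ.+ t n) ∣
        ≡⟨ cong ℚ.∣_∣ (+-difference (s m) (t m) (s n) (t n)) ⟩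
      ℚ.∣ (s m ℚ.- s n) ℚ.+ (t m ℚ.- t n) ∣
        ≤⟨ ℚ.∣p+q∣≤∣p∣+∣q∣ (s m ℚ.- s n) (t m ℚ.- t n) ⟩
      ℚ.∣ s m ℚ.- s n ∣ ℚ.+ ℚ.∣ t m ℚ.- t n ∣
        <⟨ ℚ.+-mono-< (hM m n (ℕ.≤-trans (ℕ.m≤m⊔n M N) m≥) (ℕ.≤-trans (ℕ.m≤m⊔n M N) n≥))
                      (hN m n (ℕ.≤-trans (ℕ.m≤n⊔m M N) m≥) (ℕ.≤-trans (ℕ.m≤n⊔m M N) n≥)) ⟩
      ε ℚ.* ½ ℚ.+ ε ℚ.* ½
        ≡⟨ halves ε ⟩
      ε ∎
      where open ℚ.≤-Reasoning

    neg-cauchy : ∀ s → IsCauchy s → IsCauchy (λ n → ℚ.- s n)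
    neg-cauchy s cs ε 0<ε with cs ε 0<ε
    ... | N , h = N , λ m n m≥ n≥ → subst (ℚ._< ε)
      (trans (sym (ℚ.∣-p∣≡∣p∣ (s m ℚ.- s n)))
        (cong ℚ.∣_∣ (ℚ.neg-distrib-+ (s m) (ℚ.- s n))))
      (h m n m≥ n≥)

    cauchy⇒bounded : ∀ s → IsCauchy s → EventuallyBounded s
    cauchy⇒bounded s cs with cs 1ℚ (ℚ.positive⁻¹ 1ℚ)
    ... | N , h = 1ℚ ℚ.+ ℚ.∣ s N ∣
      , ℚ.pos+nonNeg⇒pos 1ℚ ℚ.∣ s N ∣ {{ℚ.∣-∣-nonNeg (s N)}}
      , N , λ n n≥ → begin
        ℚ.∣ s n ∣
          ≡⟨ cong ℚ.∣_∣ (add-subtract (s n) (s N)) ⟩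
        ℚ.∣ (s n ℚ.- s N) ℚ.+ s N ∣
          ≤⟨ ℚ.∣p+q∣≤∣p∣+∣q∣ (s n ℚ.- s N) (s N) ⟩
        ℚ.∣ s n ℚ.- s N ∣ ℚ.+ ℚ.∣ s N ∣
          ≤⟨ ℚ.+-monoˡ-≤ ℚ.∣ s N ∣ (ℚ.<⇒≤ (h n N n≥ ℕ.≤-refl)) ⟩
        1ℚ ℚ.+ ℚ.∣ s N ∣ ∎
      where open ℚ.≤-Reasoning

    scaled : ∀ s → IsCauchy s → ∀ B → Positive B → ∀ ε → 0ℚ ℚ.< ε →
      ∃[ N ] (∀ m n → N ℕ.≤ m → N ℕ.≤ n → B ℚ.* ℚ.∣ s m ℚ.- s n ∣ ℚ.< ε)
    scaled s cs B B>0 ε 0<ε = proj₁ step , λ m n m≥ n≥ →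
        subst (B ℚ.* ℚ.∣ s m ℚ.- s n ∣ ℚ.<_) B*δ≡ε
          (ℚ.*-monoʳ-<-pos B {{B>0}} (proj₂ step m n m≥ n≥))
      where
      instance
        B≢0 : NonZero B
        B≢0 = ℚ.pos⇒nonZero B {{B>0}}
      B*δ≡ε : B ℚ.* (1/ B ℚ.* ε) ≡ ε
      B*δ≡ε = trans (sym (ℚ.*-assoc B (1/ B) ε))
        (trans (cong (ℚ._* ε) (ℚ.*-inverseʳ B)) (ℚ.*-identityˡ ε))
      step : ∃[ N ] (∀ m n → N ℕ.≤ m → N ℕ.≤ n → ℚ.∣ s m ℚ.- s n ∣ ℚ.< 1/ B ℚ.* ε)
      step = cs (1/ B ℚ.* ε) (ℚ.positive⁻¹ (1/ B ℚ.* ε)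
        {{ℚ.pos*pos⇒pos (1/ B) {{ℚ.1/pos⇒pos B {{B>0}}}} ε {{ℚ.positive 0<ε}}}})

    *-cauchy : ∀ s t → IsCauchy s → IsCauchy t → IsCauchy (λ n → s n ℚ.* t n)
    *-cauchy s t cs ct ε 0<ε with cauchy⇒bounded s cs | cauchy⇒bounded t ct
    ... | A , A>0 , Nₛ , hₛ | B , B>0 , Nₜ , hₜ
      with scaled t ct A A>0 (ε ℚ.* ½) (half-pos 0<ε)
         | scaled s cs B B>0 (ε ℚ.* ½) (half-pos 0<ε)
    ... | M , hM | N , hN = (Nₛ ⊔ Nₜ) ⊔ (M ⊔ N) , λ m n m≥ n≥ → begin-strict
      ℚ.∣ s m ℚ.* t m ℚ.- s n ℚ.* t n ∣
        ≡⟨ cong ℚ.∣_∣ (*-difference (s m) (t m) (s n) (t n)) ⟩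
      ℚ.∣ s m ℚ.* (t m ℚ.- t n) ℚ.+ t n ℚ.* (s m ℚ.- s n) ∣
        ≤⟨ ℚ.∣p+q∣≤∣p∣+∣q∣ (s m ℚ.* (t m ℚ.- t n)) (t n ℚ.* (s m ℚ.- s n)) ⟩
      ℚ.∣ s m ℚ.* (t m ℚ.- t n) ∣ ℚ.+ ℚ.∣ t n ℚ.* (s m ℚ.- s n) ∣
        ≡⟨ cong₂ ℚ._+_ (ℚ.∣p*q∣≡∣p∣*∣q∣ (s m) (t m ℚ.- t n))
                       (ℚ.∣p*q∣≡∣p∣*∣q∣ (t n) (s m ℚ.- s n)) ⟩
      ℚ.∣ s m ∣ ℚ.* ℚ.∣ t m ℚ.- t n ∣ ℚ.+ ℚ.∣ t n ∣ ℚ.* ℚ.∣ s m ℚ.- s n ∣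
        ≤⟨ ℚ.+-mono-≤
             (ℚ.*-monoʳ-≤-nonNeg ℚ.∣ t m ℚ.- t n ∣ {{ℚ.∣-∣-nonNeg (t m ℚ.- t n)}}
               (hₛ m (ℕ.≤-trans (ℕ.m≤m⊔n Nₛ Nₜ) (ℕ.≤-trans (ℕ.m≤m⊔n (Nₛ ⊔ Nₜ) (M ⊔ N)) m≥))))
             (ℚ.*-monoʳ-≤-nonNeg ℚ.∣ s m ℚ.- s n ∣ {{ℚ.∣-∣-nonNeg (s m ℚ.- s n)}}
               (hₜ n (ℕ.≤-trans (ℕ.m≤n⊔m Nₛ Nₜ) (ℕ.≤-trans (ℕ.m≤m⊔n (Nₛ ⊔ Nₜ) (M ⊔ N)) n≥)))) ⟩
      A ℚ.* ℚ.∣ t m ℚ.- t n ∣ ℚ.+ B ℚ.* ℚ.∣ s m ℚ.- s n ∣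
        <⟨ ℚ.+-mono-<
             (hM m n (ℕ.≤-trans (ℕ.m≤m⊔n M N) (ℕ.≤-trans (ℕ.m≤n⊔m (Nₛ ⊔ Nₜ) (M ⊔ N)) m≥))
                     (ℕ.≤-trans (ℕ.m≤m⊔n M N) (ℕ.≤-trans (ℕ.m≤n⊔m (Nₛ ⊔ Nₜ) (M ⊔ N)) n≥)))
             (hN m n (ℕ.≤-trans (ℕ.m≤n⊔m M N) (ℕ.≤-trans (ℕ.m≤n⊔m (Nₛ ⊔ Nₜ) (M ⊔ N)) m≥))
                     (ℕ.≤-trans (ℕ.m≤n⊔m M N) (ℕ.≤-trans (ℕ.m≤n⊔m (Nₛ ⊔ Nₜ) (M ⊔ N)) n≥))) ⟩
      ε ℚ.* ½ ℚ.+ ε ℚ.* ½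
        ≡⟨ halves ε ⟩
      ε ∎
      where open ℚ.≤-Reasoning

fromℚ : ℚ → ℝ
fromℚ q = mkℝ (λ _ → q) (const-cauchy q)

infixl 6 _+ℝ_
infixl 7 _*ℝ_
infix  8 -ℝ_

_+ℝ_ : ℝ → ℝ → ℝ
a +ℝ b = mkℝ (λ n → seq a n ℚ.+ seq b n) (+-cauchy (seq a) (seq b) (cauchy a) (cauchy b))

_*ℝ_ : ℝ → ℝ → ℝ
a *ℝ b = mkℝ (λ n → seq a n ℚ.* seq b n) (*-cauchy (seq a) (seq b) (cauchy a) (cauchy b))

-ℝ_ : ℝ → ℝ
-ℝ a = mkℝ (λ n → ℚ.- seq a n) (neg-cauchy (seq a) (cauchy a))

record ℂ : Set where
  constructor _+i_
  field
    re im : ℝ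

open ℂ public

infix 4 _≈_
_≈_ : ℂ → ℂ → Set
z ≈ w = re z ≈ℝ re w × im z ≈ℝ im w

fromℤ : ℤ → ℂ
fromℤ k = fromℚ (k ℚ./ 1) +i fromℚ 0ℚ

0ℂ 1ℂ 2ℂ : ℂ
0ℂ = fromℤ 0ℤ
1ℂ = fromℤ 1ℤ
2ℂ = fromℤ (ℤ.+ 2)

infixl 6 _+_ _-_
infixl 7 _*_
infix  8 -_
infixr 9 _^_

_+_ : ℂ → ℂ → ℂ
z + w = (re z +ℝ re w) +i (im z +ℝ im w)

_*_ : ℂ → ℂ → ℂ
z * w = (re z *ℝ re w +ℝ -ℝ (im z *ℝ im w)) +i (re z *ℝ im w +ℝ im z *ℝ re w)

-_ : ℂ → ℂ
- z = (-ℝ re z) +i (-ℝ im z)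

_-_ : ℂ → ℂ → ℂ
z - w = z + - w

_^_ : ℂ → ℕ → ℂ
z ^ zero  = 1ℂ
z ^ suc n = z * z ^ n

-- |z| < r, written without the square root as r > 0 and (Re z)² + (Im z)² < r².
∣_∣<_ : ℂ → ℚ → Set
∣ z ∣< r = 0ℚ ℚ.< r × (re z *ℝ re z +ℝ im z *ℝ im z) <ℝ fromℚ (r ℚ.* r)

infix 4 _⟶_
_⟶_ : (ℕ → ℂ) → ℂ → Set
s ⟶ L = ∀ ε → 0ℚ ℚ.< ε → Eventually λ n → ∣ s n - L ∣< ε

-- fold _∙_ e f n = ((e ∙ f 0) ∙ f 1) ∙ … ∙ f (n ∸ 1)
fold : {A : Set} → (A → A → A) → A → (ℕ → A) → ℕ → A
fold _∙_ e f zero    = e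
fold _∙_ e f (suc n) = fold _∙_ e f n ∙ f n

HasSum : (ℕ → ℂ) → ℂ → Set
HasSum a L = fold _+_ 0ℂ a ⟶ L

HasProduct : (ℕ → ℂ) → ℂ → Set
HasProduct a L = fold _*_ 1ℂ a ⟶ L

-- e = E(x) = ∏_{n ≥ 1} (1 - xⁿ); the product index here starts at 0, hence suc n.
IsE : ℂ → ℂ → Set
IsE x e = HasProduct (λ n → 1ℂ - x ^ suc n) e

PowerSeries : Set
PowerSeries = ℕ → ℤ

X^_ : ℕ → PowerSeries
(X^ n) j = if j ≡ᵇ n then 1ℤ else 0ℤ

infixl 6 _⊖_
infixl 7 _⊛_

_⊖_ : PowerSeries → PowerSeries → PowerSeries
(f ⊖ g) j = f j ℤ.- g j

_⊛_ : PowerSeries → PowerSeries → PowerSeries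
(f ⊛ g) j = fold ℤ._+_ 0ℤ (λ i → f i ℤ.* g (j ℕ.∸ i)) (suc j)

EE²-partial : ℕ → PowerSeries
EE²-partial = fold _⊛_ (X^ 0) λ n →
  (X^ 0 ⊖ X^ (suc n)) ⊛ (X^ 0 ⊖ X^ (2 ℕ.* suc n))

-- The coefficient of xʲ in E(x)E(x²) = ∏_{n ≥ 1} (1 - xⁿ)(1 - x²ⁿ).  The factors
-- with n > j are ≡ 1 modulo xʲ⁺¹, so the product over 1 ≤ n ≤ j already has it.
c : ℕ → ℤ
c j = EE²-partial j j

-- v is the value at x of the component of type k mod 3 (k < 3) of Σ cⱼ xʲ.
IsI : ℕ → ℂ → ℂ → Set
IsI k x v = HasSum (λ j → if j % 3 ≡ᵇ k then fromℤ (c j) * x ^ j else 0ℂ) v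

{-# OPTIONS --safe #-}

-- Write φ = Σ (-1)ˢ x^(s²) and ψ = Σ x^(t(t+1)/2) over all integers s and t, so that Gauss's
-- product formulas give 2 E(x)E(x²) = φ ψ.  Sort s and t by their residues i and j modulo 3
-- into φ = S₀ + 2 S₁ and ψ = 2 T₀ + T₁ (the classes 1 and 2 of s agree under s ↦ -s, the
-- classes 0 and 2 of t under t ↦ -1 - t).  Comparing exponents modulo 3,
--   2 I₀ = 2 S₀T₀,   2 I₁ = S₀T₁ + 4 S₁T₀,   2 I₂ = 2 S₁T₁.
-- The key cancellation is S₀T₁ + 2 S₁T₀ = 0: its terms are the (s, t) for which 1 + √-2 divides
-- (2t + 1) + 2s√-2, an element of norm 8 (s² + t(t+1)/2) + 1, and replacing one factor 1 + √-2
-- by its conjugate keeps the norm and reverses the parity of s.  Hence I₁ = S₁T₀, so that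
-- I₂I₀ = S₀T₁ S₁T₀ = -2 I₁², and 2 I₁ = -S₀T₁ = -x φ(x⁹) ψ(x⁹) = -2x E(x⁹)E(x¹⁸).
--
-- Gauss's formulas come from Shanks's finite identities, read modulo xᵐ.  All limits are taken
-- along rational approximations of x: with |x| ≤ r² for some r < 1 and Σ |fⱼ| rʲ bounded, the
-- error of truncating a series, a Cauchy product or an infinite product at n is O(rⁿ).
module Submission where

open import Defs hiding (_+_; _*_; _-_; -_; _^_; _≈_)
open import Algebra.Bundles using (CommutativeRing)
open import Algebra.Structures using (IsCommutativeRing)
open import Algebra.Solver.Ring.AlmostCommutativeRing
  using (fromCommutativeRing; _-Raw-AlmostCommutative⟶_)
import Algebra.Solver.Ring
open import Data.Bool as Bool using (true; false; if_then_else_)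
open import Data.Integer as ℤ using (ℤ; 0ℤ; 1ℤ; +_; -[1+_])
import Data.Integer.Properties as ℤ
import Data.Integer.Tactic.RingSolver as ℤ-Solver
open import Data.Nat as ℕ using (ℕ; zero; suc; z≤n; s≤s; _≡ᵇ_; _%_)
import Data.Nat.DivMod as ℕ
import Data.Nat.Properties as ℕ
import Data.Nat.Tactic.RingSolver as ℕ-Solver
open import Data.Product using (∃-syntax; _×_; _,_; proj₁; proj₂)
open import Data.Rational as ℚ using (ℚ; 0ℚ; 1ℚ; ½)
import Data.Rational.Properties as ℚ
import Data.Rational.Unnormalised as ℚᵘ
import Data.Rational.Unnormalised.Properties as ℚᵘ
open import Data.Integer.Divisibility.Signed using (_∣_; divides; _∣?_)
open import Data.List using (List; []; _∷_; _++_; map; filter; foldr; cartesianProduct)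
open import Data.List.Membership.Propositional using (_∈_)
open import Data.List.Membership.Propositional.Properties
  using (∈-map⁺; ∈-map⁻; ∈-filter⁺; ∈-filter⁻; ∈-cartesianProduct⁺)
open import Data.List.Membership.Propositional.Properties.WithK using (unique∧set⇒bag)
open import Data.List.Relation.Binary.BagAndSetEquality using (∼bag⇒↭)
open import Data.List.Relation.Binary.Permutation.Propositional as ↭ using (_↭_)
open import Data.List.Relation.Unary.All as All using (All; []; _∷_)
import Data.List.Relation.Unary.All.Properties as All
open import Data.List.Relation.Unary.Any using (here; there)
open import Data.List.Relation.Unary.AllPairs using ([]; _∷_)
open import Data.List.Relation.Unary.Unique.Propositional using (Unique)
open import Data.List.Relation.Unary.Unique.Propositional.Properties
  using (filter⁺; cartesianProduct⁺)
open import Data.Maybe using (Maybe; just; nothing)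
open import Data.Sum using (inj₁; inj₂)
open import Function using (mk⇔)
open import Relation.Nullary using (Dec; yes; no; ¬_; contradiction)
open import Relation.Nullary.Decidable using (¬?; from-no; dec⇒maybe)
open import Tactic.RingSolver using (solve-∀)
import Tactic.RingSolver.Core.AlmostCommutativeRing as Solver
open import Level using (0ℓ)
open import Relation.Binary using (IsEquivalence)
open import Relation.Binary.PropositionalEquality
  using (_≡_; _≢_; refl; sym; trans; cong; cong₂; subst; subst₂; module ≡-Reasoning)

-- Formal power series

fold-front : {A : Set} (_∙_ : A → A → A) (e : A) →
  (∀ x y z → (x ∙ y) ∙ z ≡ x ∙ (y ∙ z)) → (∀ x → e ∙ x ≡ x) → (∀ x → x ∙ e ≡ x) →
  ∀ f n → fold _∙_ e f (suc n) ≡ f 0 ∙ fold _∙_ e (λ i → f (suc i)) n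
fold-front _∙_ e assoc idˡ idʳ f zero    = trans (idˡ (f 0)) (sym (idʳ (f 0)))
fold-front _∙_ e assoc idˡ idʳ f (suc n) = trans
  (cong (_∙ f (suc n)) (fold-front _∙_ e assoc idˡ idʳ f n))
  (assoc (f 0) (fold _∙_ e (λ i → f (suc i)) n) (f (suc n)))

tail : PowerSeries → PowerSeries
tail f j = f (suc j)

𝟘 : PowerSeries
𝟘 _ = 0ℤ

infixl 6 _⊕_
infixl 7 _·_
infix  8 ⊝_

_⊕_ : PowerSeries → PowerSeries → PowerSeries
(f ⊕ g) j = f j ℤ.+ g j

⊝_ : PowerSeries → PowerSeries
(⊝ f) j = ℤ.- f j

_·_ : ℤ → PowerSeries → PowerSeries
(k · f) j = k ℤ.* f j

⊛-zero : ∀ f g → (f ⊛ g) 0 ≡ f 0 ℤ.* g 0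
⊛-zero f g = ℤ.+-identityˡ (f 0 ℤ.* g 0)

⊛-suc : ∀ f g j → (f ⊛ g) (suc j) ≡ f 0 ℤ.* g (suc j) ℤ.+ (tail f ⊛ g) j
⊛-suc f g j = fold-front ℤ._+_ 0ℤ ℤ.+-assoc ℤ.+-identityˡ ℤ.+-identityʳ
  (λ i → f i ℤ.* g (suc j ℕ.∸ i)) (suc j)

⊛-cong-≤ : ∀ j {f f′ g g′} → (∀ i → i ℕ.≤ j → f i ≡ f′ i) → (∀ i → i ℕ.≤ j → g i ≡ g′ i) →
  (f ⊛ g) j ≡ (f′ ⊛ g′) j
⊛-cong-≤ zero {f} {f′} {g} {g′} p q = trans (⊛-zero f g)
  (trans (cong₂ ℤ._*_ (p 0 z≤n) (q 0 z≤n)) (sym (⊛-zero f′ g′)))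
⊛-cong-≤ (suc j) {f} {f′} {g} {g′} p q = trans (⊛-suc f g j)
  (trans (cong₂ ℤ._+_ (cong₂ ℤ._*_ (p 0 z≤n) (q (suc j) ℕ.≤-refl))
      (⊛-cong-≤ j (λ i i≤j → p (suc i) (s≤s i≤j)) (λ i i≤j → q i (ℕ.m≤n⇒m≤1+n i≤j))))
    (sym (⊛-suc f′ g′ j)))

⊛-distribʳ : ∀ j f g h → ((f ⊕ g) ⊛ h) j ≡ ((f ⊛ h) ⊕ (g ⊛ h)) j
⊛-distribʳ zero f g h = trans (⊛-zero (f ⊕ g) h) (trans (ℤ.*-distribʳ-+ (h 0) (f 0) (g 0))
  (sym (cong₂ ℤ._+_ (⊛-zero f h) (⊛-zero g h))))
⊛-distribʳ (suc j) f g h = trans (⊛-suc (f ⊕ g) h j)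
  (trans (cong (λ w → (f 0 ℤ.+ g 0) ℤ.* h (suc j) ℤ.+ w) (⊛-distribʳ j (tail f) (tail g) h))
  (trans (regroup (f 0) (g 0) (h (suc j)) _ _) (sym (cong₂ ℤ._+_ (⊛-suc f h j) (⊛-suc g h j)))))
  where
  regroup : ∀ a b c x y → (a ℤ.+ b) ℤ.* c ℤ.+ (x ℤ.+ y) ≡ (a ℤ.* c ℤ.+ x) ℤ.+ (b ℤ.* c ℤ.+ y)
  regroup = ℤ-Solver.solve-∀

·-⊛ : ∀ j k f g → ((k · f) ⊛ g) j ≡ k ℤ.* (f ⊛ g) j
·-⊛ zero k f g = trans (⊛-zero (k · f) g)
  (trans (ℤ.*-assoc k (f 0) (g 0)) (cong (k ℤ.*_) (sym (⊛-zero f g))))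
·-⊛ (suc j) k f g = trans (⊛-suc (k · f) g j)
  (trans (cong (λ w → k ℤ.* f 0 ℤ.* g (suc j) ℤ.+ w) (·-⊛ j k (tail f) g))
  (trans (factor k (f 0) (g (suc j)) _) (cong (k ℤ.*_) (sym (⊛-suc f g j)))))
  where
  factor : ∀ k a b x → k ℤ.* a ℤ.* b ℤ.+ k ℤ.* x ≡ k ℤ.* (a ℤ.* b ℤ.+ x)
  factor = ℤ-Solver.solve-∀

⊛-assoc : ∀ j f g h → ((f ⊛ g) ⊛ h) j ≡ (f ⊛ (g ⊛ h)) j
⊛-assoc zero f g h = trans (⊛-zero (f ⊛ g) h) (trans (cong (ℤ._* h 0) (⊛-zero f g))
  (trans (ℤ.*-assoc (f 0) (g 0) (h 0))
  (trans (cong (f 0 ℤ.*_) (sym (⊛-zero g h))) (sym (⊛-zero f (g ⊛ h))))))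
⊛-assoc (suc j) f g h = begin
  ((f ⊛ g) ⊛ h) (suc j)
    ≡⟨ ⊛-suc (f ⊛ g) h j ⟩
  (f ⊛ g) 0 ℤ.* h (suc j) ℤ.+ (tail (f ⊛ g) ⊛ h) j
    ≡⟨ cong₂ ℤ._+_ (cong (ℤ._* h (suc j)) (⊛-zero f g))
         (⊛-cong-≤ j {g = h} (λ i _ → ⊛-suc f g i) (λ _ _ → refl)) ⟩
  f 0 ℤ.* g 0 ℤ.* h (suc j) ℤ.+ ((f 0 · tail g ⊕ (tail f ⊛ g)) ⊛ h) j
    ≡⟨ cong (λ w → f 0 ℤ.* g 0 ℤ.* h (suc j) ℤ.+ w) (trans (⊛-distribʳ j (f 0 · tail g) (tail f ⊛ g) h)
         (cong₂ ℤ._+_ (·-⊛ j (f 0) (tail g) h) (⊛-assoc j (tail f) g h))) ⟩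
  f 0 ℤ.* g 0 ℤ.* h (suc j) ℤ.+ (f 0 ℤ.* (tail g ⊛ h) j ℤ.+ (tail f ⊛ (g ⊛ h)) j)
    ≡⟨ regroup (f 0) (g 0) (h (suc j)) _ _ ⟩
  f 0 ℤ.* (g 0 ℤ.* h (suc j) ℤ.+ (tail g ⊛ h) j) ℤ.+ (tail f ⊛ (g ⊛ h)) j
    ≡⟨ cong (λ w → f 0 ℤ.* w ℤ.+ (tail f ⊛ (g ⊛ h)) j) (sym (⊛-suc g h j)) ⟩
  f 0 ℤ.* (g ⊛ h) (suc j) ℤ.+ (tail f ⊛ (g ⊛ h)) j
    ≡⟨ sym (⊛-suc f (g ⊛ h) j) ⟩
  (f ⊛ (g ⊛ h)) (suc j) ∎
  where
  open ≡-Reasoning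
  regroup : ∀ a b c x y → a ℤ.* b ℤ.* c ℤ.+ (a ℤ.* x ℤ.+ y) ≡ a ℤ.* (b ℤ.* c ℤ.+ x) ℤ.+ y
  regroup = ℤ-Solver.solve-∀

⊛-suc′ : ∀ j f g → (f ⊛ g) (suc j) ≡ g 0 ℤ.* f (suc j) ℤ.+ (f ⊛ tail g) j
⊛-suc′ zero f g = trans (⊛-suc f g 0) (trans (cong (λ w → f 0 ℤ.* g 1 ℤ.+ w) (⊛-zero (tail f) g))
  (trans (swap (f 0) (g 1) (f 1) (g 0)) (cong (λ w → g 0 ℤ.* f 1 ℤ.+ w) (sym (⊛-zero f (tail g))))))
  where
  swap : ∀ a b c d → a ℤ.* b ℤ.+ c ℤ.* d ≡ d ℤ.* c ℤ.+ a ℤ.* b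
  swap = ℤ-Solver.solve-∀
⊛-suc′ (suc j) f g = trans (⊛-suc f g (suc j))
  (trans (cong (λ w → f 0 ℤ.* g (suc (suc j)) ℤ.+ w) (⊛-suc′ j (tail f) g))
  (trans (swap (f 0 ℤ.* g (suc (suc j))) (g 0 ℤ.* f (suc (suc j))) ((tail f ⊛ tail g) j))
    (cong (λ w → g 0 ℤ.* f (suc (suc j)) ℤ.+ w) (sym (⊛-suc f (tail g) j)))))
  where
  swap : ∀ x y z → x ℤ.+ (y ℤ.+ z) ≡ y ℤ.+ (x ℤ.+ z)
  swap = ℤ-Solver.solve-∀

⊛-comm : ∀ j f g → (f ⊛ g) j ≡ (g ⊛ f) j
⊛-comm zero f g = trans (⊛-zero f g) (trans (ℤ.*-comm (f 0) (g 0)) (sym (⊛-zero g f)))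
⊛-comm (suc j) f g = trans (⊛-suc f g j)
  (trans (cong (λ w → f 0 ℤ.* g (suc j) ℤ.+ w) (⊛-comm j (tail f) g)) (sym (⊛-suc′ j g f)))

⊛-zeroˡ : ∀ j g → (𝟘 ⊛ g) j ≡ 0ℤ
⊛-zeroˡ zero    g = refl
⊛-zeroˡ (suc j) g = trans (⊛-suc 𝟘 g j) (trans (ℤ.+-identityˡ _) (⊛-zeroˡ j g))

X^suc-⊛ : ∀ a g j → (X^ suc a ⊛ g) (suc j) ≡ (X^ a ⊛ g) j
X^suc-⊛ a g j = trans (⊛-suc (X^ suc a) g j) (ℤ.+-identityˡ _)

⊛-identityˡ : ∀ j g → (X^ 0 ⊛ g) j ≡ g j
⊛-identityˡ zero    g = trans (⊛-zero (X^ 0) g) (ℤ.*-identityˡ (g 0))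
⊛-identityˡ (suc j) g = trans (⊛-suc (X^ 0) g j)
  (trans (cong₂ ℤ._+_ (ℤ.*-identityˡ (g (suc j))) (⊛-zeroˡ j g)) (ℤ.+-identityʳ (g (suc j))))

X^-+ : ∀ a b j → (X^ (a ℕ.+ b)) j ≡ (X^ a ⊛ X^ b) j
X^-+ zero    b j       = sym (⊛-identityˡ j (X^ b))
X^-+ (suc a) b zero    = refl
X^-+ (suc a) b (suc j) = trans (X^-+ a b j) (sym (X^suc-⊛ a (X^ b) j))

X^-< : ∀ a j → j ℕ.< a → (X^ a) j ≡ 0ℤ
X^-< (suc a) zero    _         = refl
X^-< (suc a) (suc j) (s≤s j<a) = X^-< a j j<a

-- A record rather than a function type, so that f and g can be inferred.
infix 4 _≐_[_]
record _≐_[_] (f g : PowerSeries) (m : ℕ) : Set where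
  constructor mk
  field coeff : ∀ j → j ℕ.< m → f j ≡ g j
open _≐_[_]

-- The ring operations are opaque so that unification does not unfold them.
infixl 6 _⊞_ _⊟_
infixl 7 _⊠_
infix  8 ⊟_

opaque
  _⊞_ _⊠_ : PowerSeries → PowerSeries → PowerSeries
  _⊞_ = _⊕_
  _⊠_ = _⊛_

  ⊟_ : PowerSeries → PowerSeries
  ⊟_ = ⊝_

_⊟_ : PowerSeries → PowerSeries → PowerSeries
f ⊟ g = f ⊞ ⊟ g

opaque
  unfolding _⊞_ _⊠_ ⊟_

  ⊞-coeff : ∀ f g j → (f ⊞ g) j ≡ f j ℤ.+ g j
  ⊞-coeff f g j = refl

  ⊟-coeff : ∀ f j → (⊟ f) j ≡ ℤ.- f j
  ⊟-coeff f j = refl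

  ⊠≡⊛ : ∀ f g → f ⊠ g ≡ f ⊛ g
  ⊠≡⊛ f g = refl

module Truncated (m : ℕ) where

  opaque
    unfolding _⊞_ _⊠_ ⊟_

    isCommutativeRing :
      IsCommutativeRing (λ f g → f ≐ g [ m ]) _⊞_ _⊠_ ⊟_ 𝟘 (X^ 0)
    isCommutativeRing = record
      { isRing = record
        { +-isAbelianGroup = record
          { isGroup = record
            { isMonoid = record
              { isSemigroup = record
                { isMagma = record
                  { isEquivalence = ≐-isEquivalence
                  ; ∙-cong = λ p q → mk λ j j< → cong₂ ℤ._+_ (coeff p j j<) (coeff q j j<) }
                ; assoc = λ f g h → mk λ j _ → ℤ.+-assoc (f j) (g j) (h j) }
              ; identity = (λ f → mk λ j _ → ℤ.+-identityˡ (f j))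
                         , (λ f → mk λ j _ → ℤ.+-identityʳ (f j)) }
            ; inverse = (λ f → mk λ j _ → ℤ.+-inverseˡ (f j))
                      , (λ f → mk λ j _ → ℤ.+-inverseʳ (f j))
            ; ⁻¹-cong = λ p → mk λ j j< → cong ℤ.-_ (coeff p j j<) }
          ; comm = λ f g → mk λ j _ → ℤ.+-comm (f j) (g j) }
        ; *-cong = λ p q → mk λ j j< → ⊛-cong-≤ j
            (λ i i≤j → coeff p i (ℕ.≤-<-trans i≤j j<)) (λ i i≤j → coeff q i (ℕ.≤-<-trans i≤j j<))
        ; *-assoc = λ f g h → mk λ j _ → ⊛-assoc j f g h
        ; *-identity = (λ f → mk λ j _ → ⊛-identityˡ j f)
                     , (λ f → mk λ j _ → trans (⊛-comm j f (X^ 0)) (⊛-identityˡ j f))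
        ; distrib = (λ f g h → mk λ j _ → trans (⊛-comm j f (g ⊕ h))
                      (trans (⊛-distribʳ j g h f) (cong₂ ℤ._+_ (⊛-comm j g f) (⊛-comm j h f))))
                  , (λ f g h → mk λ j _ → ⊛-distribʳ j g h f) }
      ; *-comm = λ f g → mk λ j _ → ⊛-comm j f g }
      where
      ≐-isEquivalence : IsEquivalence (λ f g → f ≐ g [ m ])
      ≐-isEquivalence = record
        { refl  = mk λ _ _ → refl
        ; sym   = λ p → mk λ j j< → sym (coeff p j j<)
        ; trans = λ p q → mk λ j j< → trans (coeff p j j<) (coeff q j j<) }

  truncated : CommutativeRing 0ℓ 0ℓ
  truncated = record { isCommutativeRing = isCommutativeRing }

X^-⊠ : ∀ {m} a b → X^ (a ℕ.+ b) ≐ X^ a ⊠ X^ b [ m ]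
X^-⊠ a b = mk λ j _ → trans (X^-+ a b j) (cong (λ f → f j) (sym (⊠≡⊛ (X^ a) (X^ b))))

-- Gauss's theta functions as products, after Shanks

module IntegerCoefficients (R : CommutativeRing 0ℓ 0ℓ) where
  open CommutativeRing R renaming (refl to ≈-refl; sym to ≈-sym; trans to ≈-trans; zero to *-zero)
  open import Algebra.Properties.Ring ring
    using (-0#≈0#; -‿involutive; -‿distribˡ-*; -‿distribʳ-*)
  open import Algebra.Properties.AbelianGroup +-abelianGroup using (⁻¹-∙-comm)
  open import Algebra.Properties.CommutativeSemigroup +-commutativeSemigroup using (interchange)
  open import Algebra.Properties.Semiring.Mult.TCOptimised semiring
    using (1+×; ×-homo-+; ×1-homo-*) renaming (_×_ to _×#_)
  open import Relation.Binary.Reasoning.Setoid setoid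

  ⟦_⟧ℤ : ℤ → Carrier
  ⟦ + n ⟧ℤ      = n ×# 1#
  ⟦ -[1+ n ] ⟧ℤ = - (suc n ×# 1#)

  ⊖-homo : ∀ m n → ⟦ m ℤ.⊖ n ⟧ℤ ≈ m ×# 1# - n ×# 1#
  ⊖-homo zero    zero    = ≈-sym (≈-trans (+-congˡ -0#≈0#) (+-identityʳ 0#))
  ⊖-homo zero    (suc n) = ≈-sym (+-identityˡ _)
  ⊖-homo (suc m) zero    = ≈-sym (≈-trans (+-congˡ -0#≈0#) (+-identityʳ _))
  ⊖-homo (suc m) (suc n) = begin
    ⟦ suc m ℤ.⊖ suc n ⟧ℤ                ≡⟨ cong ⟦_⟧ℤ (ℤ.[1+m]⊖[1+n]≡m⊖n m n) ⟩
    ⟦ m ℤ.⊖ n ⟧ℤ                        ≈⟨ ⊖-homo m n ⟩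
    m ×# 1# - n ×# 1#                   ≈⟨ +-identityˡ _ ⟨
    0# + (m ×# 1# - n ×# 1#)            ≈⟨ +-congʳ (-‿inverseʳ 1#) ⟨
    (1# - 1#) + (m ×# 1# - n ×# 1#)     ≈⟨ interchange _ _ _ _ ⟩
    (1# + m ×# 1#) + (- 1# - n ×# 1#)   ≈⟨ +-congˡ (⁻¹-∙-comm _ _) ⟩
    (1# + m ×# 1#) - (1# + n ×# 1#)     ≈⟨ +-cong (1+× m 1#) (-‿cong (1+× n 1#)) ⟨
    suc m ×# 1# - suc n ×# 1#           ∎

  +-homo : ∀ i j → ⟦ i ℤ.+ j ⟧ℤ ≈ ⟦ i ⟧ℤ + ⟦ j ⟧ℤ
  +-homo (+ m)      (+ n)      = ×-homo-+ 1# m n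
  +-homo (+ m)      -[1+ n ]   = ⊖-homo m (suc n)
  +-homo -[1+ m ]   (+ n)      = ≈-trans (⊖-homo n (suc m)) (+-comm _ _)
  +-homo -[1+ m ]   -[1+ n ]   = begin
    - (suc (suc (m ℕ.+ n)) ×# 1#)       ≡⟨ cong (λ k → - (suc k ×# 1#)) (ℕ.+-suc m n) ⟨
    - ((suc m ℕ.+ suc n) ×# 1#)         ≈⟨ -‿cong (×-homo-+ 1# (suc m) (suc n)) ⟩
    - (suc m ×# 1# + suc n ×# 1#)       ≈⟨ ⁻¹-∙-comm _ _ ⟨
    - (suc m ×# 1#) - (suc n ×# 1#)     ∎

  -‿homo : ∀ i → ⟦ ℤ.- i ⟧ℤ ≈ - ⟦ i ⟧ℤ
  -‿homo (+ zero)   = ≈-sym -0#≈0#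
  -‿homo (+ suc n)  = ≈-refl
  -‿homo -[1+ n ]   = ≈-sym (-‿involutive _)

  *-homo-+ : ∀ m j → ⟦ + m ℤ.* j ⟧ℤ ≈ ⟦ + m ⟧ℤ * ⟦ j ⟧ℤ
  *-homo-+ m (+ n) = ≈-trans (reflexive (cong ⟦_⟧ℤ (sym (ℤ.pos-* m n)))) (×1-homo-* m n)
  *-homo-+ m -[1+ n ] = begin
    ⟦ + m ℤ.* -[1+ n ] ⟧ℤ          ≡⟨ cong ⟦_⟧ℤ (ℤ.neg-distribʳ-* (+ m) (+ suc n)) ⟨
    ⟦ ℤ.- (+ m ℤ.* + suc n) ⟧ℤ     ≈⟨ -‿homo (+ m ℤ.* + suc n) ⟩
    - ⟦ + m ℤ.* + suc n ⟧ℤ         ≈⟨ -‿cong (*-homo-+ m (+ suc n)) ⟩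
    - (⟦ + m ⟧ℤ * ⟦ + suc n ⟧ℤ)    ≈⟨ -‿distribʳ-* _ _ ⟩
    ⟦ + m ⟧ℤ * ⟦ -[1+ n ] ⟧ℤ       ∎

  *-homo : ∀ i j → ⟦ i ℤ.* j ⟧ℤ ≈ ⟦ i ⟧ℤ * ⟦ j ⟧ℤ
  *-homo (+ m)    j = *-homo-+ m j
  *-homo -[1+ m ] j = begin
    ⟦ -[1+ m ] ℤ.* j ⟧ℤ          ≡⟨ cong ⟦_⟧ℤ (ℤ.neg-distribˡ-* (+ suc m) j) ⟨
    ⟦ ℤ.- (+ suc m ℤ.* j) ⟧ℤ     ≈⟨ -‿homo (+ suc m ℤ.* j) ⟩
    - ⟦ + suc m ℤ.* j ⟧ℤ         ≈⟨ -‿cong (*-homo-+ (suc m) j) ⟩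
    - (⟦ + suc m ⟧ℤ * ⟦ j ⟧ℤ)    ≈⟨ -‿distribˡ-* _ _ ⟩
    ⟦ -[1+ m ] ⟧ℤ * ⟦ j ⟧ℤ       ∎

  ℤ⟶R : CommutativeRing.rawRing ℤ.+-*-commutativeRing -Raw-AlmostCommutative⟶ fromCommutativeRing R
  ℤ⟶R = record
    { ⟦_⟧ = ⟦_⟧ℤ ; +-homo = +-homo ; *-homo = *-homo ; -‿homo = -‿homo
    ; 0-homo = ≈-refl ; 1-homo = ≈-refl }

  coeff≟ : ∀ i j → Maybe (⟦ i ⟧ℤ ≈ ⟦ j ⟧ℤ)
  coeff≟ i j with i ℤ.≟ j
  ... | yes i≡j = just (reflexive (cong ⟦_⟧ℤ i≡j))
  ... | no _    = nothing

  open Algebra.Solver.Ring (CommutativeRing.rawRing ℤ.+-*-commutativeRing)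
    (fromCommutativeRing R) ℤ⟶R coeff≟ public
    using (solve; con; _:=_; _:+_; _:*_; _:-_; :-_)

triangle : ℕ → ℕ
triangle zero    = 0
triangle (suc n) = triangle n ℕ.+ suc n

n≤triangle : ∀ n → n ℕ.≤ triangle n
n≤triangle zero    = z≤n
n≤triangle (suc n) = ℕ.m≤n+m (suc n) (triangle n)

record PowersOfQ (R : CommutativeRing 0ℓ 0ℓ) : Set where
  open CommutativeRing R
  -- M n plays the role of qⁿ, and inv n that of 1/(1 - qⁿ⁺¹).
  field
    M       : ℕ → Carrier
    M-0     : M 0 ≈ 1#
    M-+     : ∀ a b → M (a ℕ.+ b) ≈ M a * M b
    inv     : ℕ → Carrier
    inv-law : ∀ n → (1# - M (suc n)) * inv n ≈ 1#

module ThetaProducts (R : CommutativeRing 0ℓ 0ℓ) (powers : PowersOfQ R) where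
  open CommutativeRing R
    renaming (refl to ≈-refl; sym to ≈-sym; trans to ≈-trans; zero to *-zero)
  open PowersOfQ powers
  open import Relation.Binary.Reasoning.Setoid setoid
  open IntegerCoefficients R

  Σ Π : (ℕ → Carrier) → ℕ → Carrier
  Σ = fold _+_ 0#
  Π = fold _*_ 1#

  2# : Carrier
  2# = 1# + 1#

  sgn : ℕ → Carrier
  sgn zero    = 1#
  sgn (suc n) = - sgn n

  -- C = (q; q), C² = (q²; q²), D = (-q; q), O = (q; q²), with U = 1/C and U² = 1/C².
  C C² D O U U² θ ψ : ℕ → Carrier
  C  = Π λ k → 1# - M (suc k)
  C² = Π λ k → 1# - M (2 ℕ.* suc k)
  D  = Π λ k → 1# + M (suc k)
  O  = Π λ k → 1# - M (suc (2 ℕ.* k))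
  U  = Π inv
  U² = Π λ k → inv (k ℕ.+ suc (k ℕ.+ 0))
  θ n = 1# + Σ (λ s → 2# * sgn (suc s) * M (suc s ℕ.* suc s)) n
  ψ = Σ λ s → M (triangle s)

  M-≡ : ∀ {a b} → a ≡ b → M a ≈ M b
  M-≡ a≡b = reflexive (cong M a≡b)

  Π-inverse : ∀ f g → (∀ k → f k * g k ≈ 1#) → ∀ n → Π f n * Π g n ≈ 1#
  Π-inverse f g fg≈1 zero    = *-identityˡ 1#
  Π-inverse f g fg≈1 (suc n) = begin
    (Π f n * f n) * (Π g n * g n)
      ≈⟨ solve 4 (λ a b x y → (a :* x) :* (b :* y) := (a :* b) :* (x :* y)) ≈-refl _ _ _ _ ⟩
    (Π f n * Π g n) * (f n * g n)   ≈⟨ *-cong (Π-inverse f g fg≈1 n) (fg≈1 n) ⟩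
    1# * 1#                         ≈⟨ *-identityˡ 1# ⟩
    1#                              ∎

  CU≈1 : ∀ n → C n * U n ≈ 1#
  CU≈1 = Π-inverse _ _ inv-law

  C²U²≈1 : ∀ n → C² n * U² n ≈ 1#
  C²U²≈1 = Π-inverse _ _ λ k → inv-law (k ℕ.+ suc (k ℕ.+ 0))

  -- Shanks's summands for D n * θ n, with s ≥ 1 shifted to start at 0.
  T : ℕ → ℕ → Carrier
  T n s = 2# * (- sgn s) * D s * C n * U (suc s) * M (suc s ℕ.* suc n)

  shanks-θ-step : ∀ n m →
    C (suc n) + Σ (T (suc n)) m ≈
      (1# + M (suc n)) * (C n + Σ (T n) m) - 2# * sgn m * C n * D m * U m * M (suc m ℕ.* suc n)
  shanks-θ-step n zero = begin
    C n * (1# - M (suc n)) + 0#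
      ≈⟨ solve 2 (λ a q → a :* (con 1ℤ :- q) :+ con 0ℤ :=
           (con 1ℤ :+ q) :* (a :+ con 0ℤ) :-
           (con 1ℤ :+ con 1ℤ) :* con 1ℤ :* a :* con 1ℤ :* con 1ℤ :* q) ≈-refl (C n) (M (suc n)) ⟩
    (1# + M (suc n)) * (C n + 0#) - 2# * 1# * C n * 1# * 1# * M (suc n)
      ≈⟨ +-congˡ (-‿cong (*-congˡ (M-≡ (sym (ℕ.*-identityˡ (suc n)))))) ⟩
    (1# + M (suc n)) * (C n + 0#) - 2# * 1# * C n * 1# * 1# * M (1 ℕ.* suc n) ∎
  shanks-θ-step n (suc m) = begin
    C (suc n) + (Σ (T (suc n)) m + T (suc n) m)
      ≈⟨ +-assoc _ _ _ ⟨
    (C (suc n) + Σ (T (suc n)) m) + T (suc n) m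
      ≈⟨ +-cong (shanks-θ-step n m) (*-congˡ M-shift) ⟩
    ((1# + q) * (c′ + σ) - 2# * s * c′ * d * u * w) + 2# * (- s) * d * (c′ * (1# - q)) * (u * v) * (p * w)
      ≈⟨ +-congʳ (+-congˡ (-‿cong (*-congʳ (*-congˡ u-step)))) ⟩
    ((1# + q) * (c′ + σ) - 2# * s * c′ * d * (u * ((1# - p) * v)) * w)
      + 2# * (- s) * d * (c′ * (1# - q)) * (u * v) * (p * w)
      ≈⟨ solve 9 (λ q c σ s d u v p w → let 2′ = con 1ℤ :+ con 1ℤ in
           ((con 1ℤ :+ q) :* (c :+ σ) :- 2′ :* s :* c :* d :* (u :* ((con 1ℤ :- p) :* v)) :* w)
             :+ 2′ :* (:- s) :* d :* (c :* (con 1ℤ :- q)) :* (u :* v) :* (p :* w)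
           := (con 1ℤ :+ q) :* (c :+ (σ :+ 2′ :* (:- s) :* d :* c :* (u :* v) :* w))
             :- 2′ :* (:- s) :* c :* (d :* (con 1ℤ :+ p)) :* (u :* v) :* (q :* w))
           ≈-refl q c′ σ s d u v p w ⟩
    (1# + q) * (c′ + (σ + T n m)) - 2# * (- s) * c′ * D (suc m) * U (suc m) * (q * w)
      ≈⟨ +-congˡ (-‿cong (*-congˡ (≈-sym (M-+ (suc n) (suc m ℕ.* suc n))))) ⟩
    (1# + q) * (c′ + (σ + T n m)) - 2# * (- s) * c′ * D (suc m) * U (suc m) * M (suc (suc m) ℕ.* suc n) ∎
    where
    q = M (suc n)
    p = M (suc m)
    c′ = C n
    σ = Σ (T n) m
    s = sgn m
    d = D m
    u = U m
    v = inv m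
    w = M (suc m ℕ.* suc n)
    M-shift : M (suc m ℕ.* suc (suc n)) ≈ p * w
    M-shift = ≈-trans (M-≡ (ℕ.*-suc (suc m) (suc n))) (M-+ (suc m) (suc m ℕ.* suc n))
    u-step : u ≈ u * ((1# - p) * v)
    u-step = ≈-sym (≈-trans (*-congˡ (inv-law m)) (*-identityʳ u))

  shanks-θ : ∀ n → D n * θ n ≈ C n + Σ (T n) n
  shanks-θ zero    = ≈-trans (*-identityˡ _) ≈-refl
  shanks-θ (suc n) = begin
    (d * (1# + q)) * (1# + (t + 2# * (- s) * w))
      ≈⟨ solve 5 (λ d q t s w → let 2′ = con 1ℤ :+ con 1ℤ in
           (d :* (con 1ℤ :+ q)) :* (con 1ℤ :+ (t :+ 2′ :* (:- s) :* w)) :=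
           (con 1ℤ :+ q) :* (d :* (con 1ℤ :+ t)) :- 2′ :* s :* d :* w
             :+ 2′ :* (:- s) :* d :* (q :* w)) ≈-refl d q t s w ⟩
    (1# + q) * (d * θ n) - 2# * s * d * w + 2# * (- s) * d * (q * w)
      ≈⟨ +-cong (+-cong (*-congˡ (shanks-θ n)) (-‿cong (*-congʳ (insert n)))) (*-congʳ (insert (suc n))) ⟩
    (1# + q) * (C n + Σ (T n) n) - 2# * s * d * (C n * U n) * w
      + 2# * (- s) * d * (C (suc n) * U (suc n)) * (q * w)
      ≈⟨ +-cong (+-congˡ (-‿cong (solve 6 (λ a s d c u w →
             a :* s :* d :* (c :* u) :* w := a :* s :* c :* d :* u :* w) ≈-refl 2# s d (C n) (U n) w)))
           (solve 6 (λ a s d c u w → a :* s :* d :* (c :* u) :* w := a :* s :* d :* c :* u :* w)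
             ≈-refl 2# (- s) d (C (suc n)) (U (suc n)) (q * w)) ⟩
    ((1# + q) * (C n + Σ (T n) n) - 2# * s * C n * d * U n * w)
      + 2# * (- s) * d * C (suc n) * U (suc n) * (q * w)
      ≈⟨ +-cong (≈-sym (shanks-θ-step n n)) (*-congˡ (≈-sym M-shift)) ⟩
    (C (suc n) + Σ (T (suc n)) n) + T (suc n) n
      ≈⟨ +-assoc _ _ _ ⟩
    C (suc n) + Σ (T (suc n)) (suc n) ∎
    where
    q = M (suc n)
    d = D n
    s = sgn n
    t = Σ (λ s → 2# * sgn (suc s) * M (suc s ℕ.* suc s)) n
    w = M (suc n ℕ.* suc n)
    insert : ∀ k {x} → x ≈ x * (C k * U k)
    insert k {x} = ≈-sym (≈-trans (*-congˡ (CU≈1 k)) (*-identityʳ x))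
    M-shift : M (suc n ℕ.* suc (suc n)) ≈ q * w
    M-shift = ≈-trans (M-≡ (ℕ.*-suc (suc n) (suc n))) (M-+ (suc n) (suc n ℕ.* suc n))

  -- Shanks's summands for O n * ψ (2 * n).
  S : ℕ → ℕ → Carrier
  S n s = C² n * U² s * O s * M (s ℕ.* suc (2 ℕ.* n))

  S-shift : ∀ n s → M (s ℕ.* suc (2 ℕ.* suc n)) ≈ M (2 ℕ.* s) * M (s ℕ.* suc (2 ℕ.* n))
  S-shift n s = ≈-trans (M-≡ (index s n)) (M-+ (2 ℕ.* s) (s ℕ.* suc (2 ℕ.* n)))
    where
    index : ∀ s n → s ℕ.* suc (2 ℕ.* suc n) ≡ 2 ℕ.* s ℕ.+ s ℕ.* suc (2 ℕ.* n)
    index = ℕ-Solver.solve-∀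

  M-suc : ∀ n → M (suc n) ≈ M 1 * M n
  M-suc = M-+ 1

  M-2*suc : ∀ n → M (2 ℕ.* suc n) ≈ M 1 * M (suc (2 ℕ.* n))
  M-2*suc n = ≈-trans (M-≡ (ℕ.*-suc 2 n)) (M-suc (suc (2 ℕ.* n)))

  shanks-ψ-step : ∀ n m →
    Σ (S (suc n)) m ≈ (1# - M (suc (2 ℕ.* n))) * Σ (S n) m + (1# - M (2 ℕ.* m)) * S n m
  shanks-ψ-step n zero = begin
    0#
      ≈⟨ solve 2 (λ o x → con 0ℤ := (con 1ℤ :- o) :* con 0ℤ :+ (con 1ℤ :- con 1ℤ) :* x) ≈-refl _ _ ⟩
    (1# - M (suc (2 ℕ.* n))) * 0# + (1# - 1#) * S n 0
      ≈⟨ +-congˡ (*-congʳ (+-congˡ (-‿cong (≈-sym M-0)))) ⟩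
    (1# - M (suc (2 ℕ.* n))) * 0# + (1# - M 0) * S n 0 ∎
  shanks-ψ-step n (suc m) = begin
    Σ (S (suc n)) m + S (suc n) m
      ≈⟨ +-cong (shanks-ψ-step n m)
           (*-cong (*-congʳ (*-congʳ (*-congˡ (+-congˡ (-‿cong (M-2*suc n)))))) (S-shift n m)) ⟩
    ((1# - o) * σ + (1# - p) * (c′ * u * b * w)) + c′ * (1# - q * o) * u * b * (p * w)
      ≈⟨ solve 8 (λ q o p c σ u b w →
           ((con 1ℤ :- o) :* σ :+ (con 1ℤ :- p) :* (c :* u :* b :* w))
             :+ c :* (con 1ℤ :- q :* o) :* u :* b :* (p :* w)
           := (con 1ℤ :- o) :* (σ :+ c :* u :* b :* w)
             :+ con 1ℤ :* (c :* u :* (b :* (con 1ℤ :- q :* p)) :* (o :* w)))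
           ≈-refl q o p c′ σ u b w ⟩
    (1# - o) * (σ + S n m) + 1# * (c′ * u * (b * (1# - q * p)) * (o * w))
      ≈⟨ +-congˡ (*-cong (≈-sym (inv-law _)) (*-cong (*-congˡ (*-congˡ (+-congˡ (-‿cong
           (≈-sym (M-suc (2 ℕ.* m))))))) (≈-sym (M-+ (suc (2 ℕ.* n)) (m ℕ.* suc (2 ℕ.* n)))))) ⟩
    (1# - o) * (σ + S n m) + (1# - M (2 ℕ.* suc m)) * v * (c′ * u * O (suc m) * M (suc m ℕ.* suc (2 ℕ.* n)))
      ≈⟨ +-congˡ (solve 6 (λ a v c u b w → a :* v :* (c :* u :* b :* w) := a :* (c :* (u :* v) :* b :* w))
           ≈-refl _ _ _ _ _ _) ⟩
    (1# - o) * (σ + S n m) + (1# - M (2 ℕ.* suc m)) * S n (suc m) ∎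
    where
    q = M 1
    o = M (suc (2 ℕ.* n))
    p = M (2 ℕ.* m)
    c′ = C² n
    σ = Σ (S n) m
    u = U² m
    b = O m
    w = M (m ℕ.* suc (2 ℕ.* n))
    v = inv (m ℕ.+ suc (m ℕ.+ 0))

  triangle-double : ∀ n → triangle (2 ℕ.* n) ≡ n ℕ.* suc (2 ℕ.* n)
  triangle-double zero    = refl
  triangle-double (suc n) = trans (cong triangle (ℕ.*-suc 2 n))
    (trans (cong (λ k → k ℕ.+ suc (2 ℕ.* n) ℕ.+ suc (suc (2 ℕ.* n))) (triangle-double n)) (index n))
    where
    index : ∀ n → n ℕ.* suc (2 ℕ.* n) ℕ.+ suc (2 ℕ.* n) ℕ.+ suc (suc (2 ℕ.* n))
                    ≡ suc n ℕ.* suc (2 ℕ.* suc n)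
    index = ℕ-Solver.solve-∀

  shanks-ψ : ∀ n → O n * ψ (2 ℕ.* n) ≈ Σ (S n) n
  shanks-ψ zero    = *-identityˡ 0#
  shanks-ψ (suc n) = begin
    O (suc n) * ψ (2 ℕ.* suc n)
      ≡⟨ cong (λ k → O (suc n) * ψ k) (ℕ.*-suc 2 n) ⟩
    b * (1# - o) * (y + M (triangle (2 ℕ.* n)) + M (triangle (2 ℕ.* n) ℕ.+ suc (2 ℕ.* n)))
      ≈⟨ *-congˡ (+-cong (+-congˡ t-≈) (≈-trans (M-+ _ _) (*-congʳ t-≈))) ⟩
    b * (1# - o) * (y + t + t * o)
      ≈⟨ solve 4 (λ b o y t → b :* (con 1ℤ :- o) :* (y :+ t :+ t :* o) :=
           (con 1ℤ :- o) :* (b :* y) :+ b :* t :* (con 1ℤ :- o :* o)) ≈-refl b o y t ⟩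
    (1# - o) * (b * y) + b * t * (1# - o * o)
      ≈⟨ +-cong (*-congˡ (shanks-ψ n)) (*-congˡ (+-congˡ (-‿cong (*-congˡ (M-suc (2 ℕ.* n)))))) ⟩
    (1# - o) * Σ (S n) n + b * t * (1# - o * (q * p))
      ≈⟨ +-congˡ (solve 5 (λ b t o q p → b :* t :* (con 1ℤ :- o :* (q :* p)) :=
           con 1ℤ :* ((con 1ℤ :- p) :* b :* t :+ (con 1ℤ :- q :* o) :* b :* (p :* t))) ≈-refl b t o q p) ⟩
    (1# - o) * Σ (S n) n + 1# * ((1# - p) * b * t + (1# - q * o) * b * (p * t))
      ≈⟨ +-congˡ (*-cong (≈-sym (C²U²≈1 n)) (+-congˡ (*-cong (*-congʳ (+-congˡ (-‿cong
           (≈-sym (M-2*suc n))))) (≈-sym (S-shift n n))))) ⟩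
    (1# - o) * Σ (S n) n + C² n * U² n *
      ((1# - p) * b * t + (1# - M (2 ℕ.* suc n)) * b * M (n ℕ.* suc (2 ℕ.* suc n)))
      ≈⟨ solve 8 (λ a c u p b t r w → a :+ c :* u :* (p :* b :* t :+ r :* b :* w) :=
           (a :+ p :* (c :* u :* b :* t)) :+ c :* r :* u :* b :* w) ≈-refl _ _ _ _ _ _ _ _ ⟩
    ((1# - o) * Σ (S n) n + (1# - p) * S n n) + S (suc n) n
      ≈⟨ +-congʳ (≈-sym (shanks-ψ-step n n)) ⟩
    Σ (S (suc n)) n + S (suc n) n ∎
    where
    q = M 1
    o = M (suc (2 ℕ.* n))
    p = M (2 ℕ.* n)
    b = O n
    y = ψ (2 ℕ.* n)
    t = M (n ℕ.* suc (2 ℕ.* n))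
    t-≈ : M (triangle (2 ℕ.* n)) ≈ t
    t-≈ = M-≡ (triangle-double n)

  E²-product : ∀ n → Π (λ k → (1# - M (suc k)) * (1# - M (2 ℕ.* suc k))) n ≈ C n * C² n
  E²-product zero    = ≈-sym (*-identityˡ 1#)
  E²-product (suc n) = ≈-trans (*-congʳ (E²-product n))
    (solve 4 (λ a b x y → (a :* b) :* (x :* y) := (a :* x) :* (b :* y)) ≈-refl _ _ _ _)

  C²≈DC : ∀ n → C² n ≈ D n * C n
  C²≈DC zero    = ≈-sym (*-identityˡ 1#)
  C²≈DC (suc n) = begin
    C² n * (1# - M (2 ℕ.* suc n))
      ≈⟨ *-cong (C²≈DC n) (+-congˡ (-‿cong (≈-trans (M-+ (suc n) (suc n ℕ.+ 0))
           (*-congˡ (M-≡ (ℕ.+-identityʳ (suc n))))))) ⟩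
    D n * C n * (1# - M (suc n) * M (suc n))
      ≈⟨ solve 3 (λ d c q → d :* c :* (con 1ℤ :- q :* q) :=
           (d :* (con 1ℤ :+ q)) :* (c :* (con 1ℤ :- q))) ≈-refl _ _ _ ⟩
    D (suc n) * C (suc n) ∎

  C-double : ∀ n → C (2 ℕ.* n) ≈ O n * C² n
  C-double zero    = ≈-sym (*-identityˡ 1#)
  C-double (suc n) = begin
    C (2 ℕ.* suc n)
      ≡⟨ cong C (ℕ.*-suc 2 n) ⟩
    C (2 ℕ.* n) * (1# - M (suc (2 ℕ.* n))) * (1# - M (2 ℕ.+ 2 ℕ.* n))
      ≈⟨ *-cong (*-congʳ (C-double n)) (+-congˡ (-‿cong (M-≡ (sym (ℕ.*-suc 2 n))))) ⟩
    O n * C² n * (1# - M (suc (2 ℕ.* n))) * (1# - M (2 ℕ.* suc n))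
      ≈⟨ solve 4 (λ o c x y → o :* c :* x :* y := (o :* x) :* (c :* y)) ≈-refl _ _ _ _ ⟩
    O (suc n) * C² (suc n) ∎

  Σ-zero : ∀ f n → (∀ s → f s ≈ 0#) → Σ f n ≈ 0#
  Σ-zero f zero    f≈0 = ≈-refl
  Σ-zero f (suc n) f≈0 = ≈-trans (+-cong (Σ-zero f n f≈0) (f≈0 n)) (+-identityʳ 0#)

  module Nilpotent (L : ℕ) (M≈0 : ∀ k → L ℕ.≤ k → M k ≈ 0#) where

    C-stable : ∀ n → L ℕ.≤ suc n → ∀ k → C (k ℕ.+ n) ≈ C n
    C-stable n L≤n zero    = ≈-refl
    C-stable n L≤n (suc k) = begin
      C (k ℕ.+ n) * (1# - M (suc k ℕ.+ n))
        ≈⟨ *-cong (C-stable n L≤n k) (+-congˡ (-‿cong (M≈0 _ (ℕ.≤-trans L≤n (s≤s (ℕ.m≤n+m n k)))))) ⟩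
      C n * (1# - 0#)
        ≈⟨ solve 1 (λ x → x :* (con 1ℤ :- con 0ℤ) := x) ≈-refl (C n) ⟩
      C n ∎

    DO≈1 : ∀ n → L ℕ.≤ n → D n * O n ≈ 1#
    DO≈1 n L≤n = begin
      D n * O n                      ≈⟨ ≈-trans (*-congˡ (CU≈1 n)) (*-identityʳ _) ⟨
      D n * O n * (C n * U n)
        ≈⟨ solve 4 (λ d o c u → d :* o :* (c :* u) := (o :* (d :* c)) :* u) ≈-refl _ _ _ _ ⟩
      O n * (D n * C n) * U n        ≈⟨ *-congʳ (*-congˡ (C²≈DC n)) ⟨
      O n * C² n * U n               ≈⟨ *-congʳ (C-double n) ⟨
      C (2 ℕ.* n) * U n              ≡⟨ cong (λ k → C (n ℕ.+ k) * U n) (ℕ.+-identityʳ n) ⟩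
      C (n ℕ.+ n) * U n              ≈⟨ *-congʳ (C-stable n (ℕ.m≤n⇒m≤1+n L≤n) n) ⟩
      C n * U n                      ≈⟨ CU≈1 n ⟩
      1#                             ∎

    Dθ≈C : ∀ n → L ℕ.≤ n → D n * θ n ≈ C n
    Dθ≈C n L≤n = ≈-trans (shanks-θ n) (≈-trans (+-congˡ (Σ-zero (T n) n T≈0)) (+-identityʳ (C n)))
      where
      T≈0 : ∀ s → T n s ≈ 0#
      T≈0 s = ≈-trans (*-congˡ (M≈0 _ (ℕ.≤-trans L≤n
        (ℕ.≤-trans (ℕ.n≤1+n n) (ℕ.m≤m+n (suc n) (s ℕ.* suc n)))))) (zeroʳ _)

    Oψ≈C² : ∀ n → L ℕ.≤ suc n → O (suc n) * ψ (2 ℕ.* suc n) ≈ C² (suc n)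
    Oψ≈C² n L≤n = ≈-trans (shanks-ψ (suc n)) (Σ≈ n)
      where
      Σ≈ : ∀ k → Σ (S (suc n)) (suc k) ≈ C² (suc n)
      Σ≈ zero    = ≈-trans (+-congˡ (*-congˡ M-0)) (solve 1 (λ x →
        con 0ℤ :+ x :* con 1ℤ :* con 1ℤ :* con 1ℤ := x) ≈-refl (C² (suc n)))
      Σ≈ (suc k) = ≈-trans (+-cong (Σ≈ k) (≈-trans (*-congˡ (M≈0 _ (ℕ.≤-trans L≤n
        (ℕ.≤-trans (ℕ.m≤n⇒m≤1+n (ℕ.m≤m+n (suc n) (suc n ℕ.+ 0))) (ℕ.m≤m+n _ _))))) (zeroʳ _)))
        (+-identityʳ _)

    CC²≈θψ : ∀ n → L ℕ.≤ suc n → C (suc n) * C² (suc n) ≈ θ (suc n) * ψ (2 ℕ.* suc n)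
    CC²≈θψ n L≤n = begin
      C (suc n) * C² (suc n)
        ≈⟨ *-cong (Dθ≈C (suc n) L≤n) (Oψ≈C² n L≤n) ⟨
      (D (suc n) * θ (suc n)) * (O (suc n) * ψ (2 ℕ.* suc n))
        ≈⟨ solve 4 (λ d t o y → (d :* t) :* (o :* y) := (d :* o) :* (t :* y)) ≈-refl _ _ _ _ ⟩
      (D (suc n) * O (suc n)) * (θ (suc n) * ψ (2 ℕ.* suc n))
        ≈⟨ ≈-trans (*-congʳ (DO≈1 (suc n) L≤n)) (*-identityˡ _) ⟩
      θ (suc n) * ψ (2 ℕ.* suc n) ∎

    C²-stable : ∀ n → L ℕ.≤ suc n → ∀ k → C² (k ℕ.+ n) ≈ C² n
    C²-stable n L≤n zero    = ≈-refl
    C²-stable n L≤n (suc k) = begin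
      C² (k ℕ.+ n) * (1# - M (2 ℕ.* suc (k ℕ.+ n)))
        ≈⟨ *-cong (C²-stable n L≤n k) (+-congˡ (-‿cong (M≈0 _ (ℕ.≤-trans L≤n
             (ℕ.≤-trans (s≤s (ℕ.m≤n+m n k)) (ℕ.m≤m+n _ _)))))) ⟩
      C² n * (1# - 0#)
        ≈⟨ solve 1 (λ x → x :* (con 1ℤ :- con 0ℤ) := x) ≈-refl (C² n) ⟩
      C² n ∎

    ψ-stable : ∀ n → L ℕ.≤ n → ∀ k → ψ (k ℕ.+ n) ≈ ψ n
    ψ-stable n L≤n zero    = ≈-refl
    ψ-stable n L≤n (suc k) = ≈-trans (+-cong (ψ-stable n L≤n k) (M≈0 _
      (ℕ.≤-trans L≤n (ℕ.≤-trans (ℕ.m≤n+m n k) (n≤triangle (k ℕ.+ n)))))) (+-identityʳ (ψ n))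

-- The theta functions as power series in qᵈ

sgn : ℕ → ℤ
sgn zero    = 1ℤ
sgn (suc n) = ℤ.- sgn n

χ : ℤ → ℤ
χ s = sgn ℤ.∣ s ∣

square tri : ℤ → ℕ
square s = ℤ.∣ s ∣ ℕ.* ℤ.∣ s ∣
tri (+ n)    = triangle n
tri -[1+ n ] = triangle n

-- The sum over the integers from -N to N - 1.
ΣZ : (ℤ → PowerSeries) → ℕ → PowerSeries
ΣZ h = fold _⊞_ 𝟘 λ k → h (+ k) ⊞ h -[1+ k ]

θ-term ψ-term : ℕ → ℤ → PowerSeries
θ-term d s = χ s · X^ (d ℕ.* square s)
ψ-term d t = X^ (d ℕ.* tri t)

E-partial : ℕ → ℕ → PowerSeries
E-partial d = fold _⊛_ (X^ 0) λ k → X^ 0 ⊖ X^ (d ℕ.* suc k)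

E[_] : ℕ → PowerSeries
E[ d ] j = E-partial d j j

opaque
  unfolding _⊞_ _⊠_ ⊟_

  E-partial-⊠ : ∀ d n → E-partial d n ≡ fold _⊠_ (X^ 0) (λ k → X^ 0 ⊟ X^ (d ℕ.* suc k)) n
  E-partial-⊠ d n = refl

  EE²-partial-⊠ : ∀ n → EE²-partial n ≡
    fold _⊠_ (X^ 0) (λ k → (X^ 0 ⊟ X^ (suc k)) ⊠ (X^ 0 ⊟ X^ (2 ℕ.* suc k))) n
  EE²-partial-⊠ n = refl

module _ (m : ℕ) where
  open CommutativeRing (Truncated.truncated m)
    renaming (refl to ≈-refl; sym to ≈-sym; trans to ≈-trans; zero to *-zero)

  fold-⊠-cong : ∀ {f g} → (∀ k → f k ≐ g k [ m ]) → ∀ n →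
    fold _⊠_ (X^ 0) f n ≐ fold _⊠_ (X^ 0) g n [ m ]
  fold-⊠-cong f≐g zero    = ≈-refl
  fold-⊠-cong f≐g (suc n) = *-cong (fold-⊠-cong f≐g n) (f≐g n)

module ThetaSeries (d′ m : ℕ) where
  d : ℕ
  d = suc d′

  open CommutativeRing (Truncated.truncated m)
    renaming (refl to ≈-refl; sym to ≈-sym; trans to ≈-trans; zero to *-zero)
  open IntegerCoefficients (Truncated.truncated m)
  open import Relation.Binary.Reasoning.Setoid setoid

  M : ℕ → PowerSeries
  M k = X^ (d ℕ.* k)

  X^≐𝟘 : ∀ a → m ℕ.≤ a → X^ a ≐ 𝟘 [ m ]
  X^≐𝟘 a m≤a = mk λ j j<m → X^-< a j (ℕ.≤-trans j<m m≤a)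

  M-0 : M 0 ≐ X^ 0 [ m ]
  M-0 = reflexive (cong X^_ (ℕ.*-zeroʳ d))

  M-+ : ∀ a b → M (a ℕ.+ b) ≐ M a ⊠ M b [ m ]
  M-+ a b = ≈-trans (reflexive (cong X^_ (ℕ.*-distribˡ-+ d a b)))
    (X^-⊠ (d ℕ.* a) (d ℕ.* b))

  M≐𝟘 : ∀ k → m ℕ.≤ k → M k ≐ 𝟘 [ m ]
  M≐𝟘 k m≤k = X^≐𝟘 _ (ℕ.≤-trans m≤k (ℕ.m≤m+n k (d′ ℕ.* k)))

  geometric : ℕ → ℕ → PowerSeries
  geometric e = fold _⊞_ 𝟘 λ i → M (e ℕ.* i)

  geometric-sum : ∀ e k → (X^ 0 ⊟ M e) ⊠ geometric e k ≐ X^ 0 ⊟ M (e ℕ.* k) [ m ]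
  geometric-sum e zero    = begin
    (X^ 0 ⊟ M e) ⊠ 𝟘        ≈⟨ zeroʳ _ ⟩
    𝟘                       ≈⟨ -‿inverseʳ (X^ 0) ⟨
    X^ 0 ⊟ X^ 0             ≈⟨ +-congˡ (-‿cong M-0) ⟨
    X^ 0 ⊟ M 0              ≡⟨ cong (λ k → X^ 0 ⊟ M k) (ℕ.*-zeroʳ e) ⟨
    X^ 0 ⊟ M (e ℕ.* 0)      ∎
  geometric-sum e (suc k) = begin
    (X^ 0 ⊟ M e) ⊠ (geometric e k ⊞ M (e ℕ.* k))
      ≈⟨ distribˡ _ _ _ ⟩
    (X^ 0 ⊟ M e) ⊠ geometric e k ⊞ (X^ 0 ⊟ M e) ⊠ M (e ℕ.* k)
      ≈⟨ +-congʳ (geometric-sum e k) ⟩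
    (X^ 0 ⊟ M (e ℕ.* k)) ⊞ (X^ 0 ⊟ M e) ⊠ M (e ℕ.* k)
      ≈⟨ solve 2 (λ x y → (con 1ℤ :- y) :+ (con 1ℤ :- x) :* y := con 1ℤ :- x :* y) ≈-refl _ _ ⟩
    X^ 0 ⊟ M e ⊠ M (e ℕ.* k)
      ≈⟨ +-congˡ (-‿cong (M-+ e (e ℕ.* k))) ⟨
    X^ 0 ⊟ M (e ℕ.+ e ℕ.* k)
      ≡⟨ cong (λ k → X^ 0 ⊟ M k) (ℕ.*-suc e k) ⟨
    X^ 0 ⊟ M (e ℕ.* suc k) ∎

  inv : ℕ → PowerSeries
  inv n = geometric (suc n) m

  inv-law : ∀ n → (X^ 0 ⊟ M (suc n)) ⊠ inv n ≐ X^ 0 [ m ]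
  inv-law n = begin
    (X^ 0 ⊟ M (suc n)) ⊠ inv n      ≈⟨ geometric-sum (suc n) m ⟩
    X^ 0 ⊟ M (suc n ℕ.* m)          ≈⟨ +-congˡ (-‿cong (M≐𝟘 _ (ℕ.m≤m+n m (n ℕ.* m)))) ⟩
    X^ 0 ⊟ 𝟘                        ≈⟨ solve 1 (λ x → x :- con 0ℤ := x) ≈-refl (X^ 0) ⟩
    X^ 0                            ∎

  powers : PowersOfQ (Truncated.truncated m)
  powers = record { M = M ; M-0 = M-0 ; M-+ = M-+ ; inv = inv ; inv-law = inv-law }

  module Θ = ThetaProducts (Truncated.truncated m) powers
  module Θ₀ = Θ.Nilpotent m M≐𝟘

  sgn-⊠ : ∀ n f → Θ.sgn n ⊠ f ≐ sgn n · f [ m ]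
  sgn-⊠ zero    f = ≈-trans (*-identityˡ f) (mk λ j _ → sym (ℤ.*-identityˡ (f j)))
  sgn-⊠ (suc n) f = begin
    ⊟ Θ.sgn n ⊠ f       ≈⟨ solve 2 (λ x y → (:- x) :* y := :- (x :* y)) ≈-refl _ _ ⟩
    ⊟ (Θ.sgn n ⊠ f)     ≈⟨ -‿cong (sgn-⊠ n f) ⟩
    ⊟ (sgn n · f)       ≈⟨ mk (λ j _ → trans (⊟-coeff (sgn n · f) j) (ℤ.neg-distribˡ-* (sgn n) (f j))) ⟩
    sgn (suc n) · f     ∎

  θ≐Σθ-term+ : ∀ n → Θ.θ n ≐ ΣZ (θ-term d) n ⊞ θ-term d (+ n) [ m ]
  θ≐Σθ-term+ zero = ≈-trans (+-comm (X^ 0) 𝟘) (+-congˡ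
    (≈-trans (≈-sym M-0) (mk λ j _ → sym (ℤ.*-identityˡ (M 0 j)))))
  θ≐Σθ-term+ (suc n) = begin
    X^ 0 ⊞ (σ ⊞ Θ.2# ⊠ Θ.sgn (suc n) ⊠ M (suc n ℕ.* suc n))
      ≈⟨ solve 3 (λ s x y → con 1ℤ :+ (s :+ (con 1ℤ :+ con 1ℤ) :* x :* y) :=
           (con 1ℤ :+ s) :+ (x :* y :+ x :* y)) ≈-refl σ _ _ ⟩
    Θ.θ n ⊞ (Θ.sgn (suc n) ⊠ M (suc n ℕ.* suc n) ⊞ Θ.sgn (suc n) ⊠ M (suc n ℕ.* suc n))
      ≈⟨ +-cong (θ≐Σθ-term+ n) (+-cong (sgn-⊠ (suc n) _) (sgn-⊠ (suc n) _)) ⟩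
    (ΣZ (θ-term d) n ⊞ θ-term d (+ n)) ⊞ (θ-term d -[1+ n ] ⊞ θ-term d (+ suc n))
      ≈⟨ solve 4 (λ a b x y → (a :+ b) :+ (x :+ y) := (a :+ (b :+ x)) :+ y) ≈-refl _ _ _ _ ⟩
    ΣZ (θ-term d) (suc n) ⊞ θ-term d (+ suc n) ∎
    where
    σ = Θ.Σ (λ s → Θ.2# ⊠ Θ.sgn (suc s) ⊠ M (suc s ℕ.* suc s)) n

  θ≐Σθ-term : ∀ n → m ℕ.≤ suc n → Θ.θ (suc n) ≐ ΣZ (θ-term d) (suc n) [ m ]
  θ≐Σθ-term n m≤n = ≈-trans (θ≐Σθ-term+ (suc n)) (≈-trans (+-congˡ
    (mk λ j j<m → trans (cong (sgn (suc n) ℤ.*_)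
      (coeff (M≐𝟘 (suc n ℕ.* suc n) (ℕ.≤-trans m≤n (ℕ.m≤m*n (suc n) (suc n)))) j j<m))
      (ℤ.*-zeroʳ (sgn (suc n))))) (+-identityʳ _))

  Σψ-term : ∀ n → ΣZ (ψ-term d) n ≐ Θ.ψ n ⊞ Θ.ψ n [ m ]
  Σψ-term zero    = ≈-sym (+-identityˡ 𝟘)
  Σψ-term (suc n) = ≈-trans (+-congʳ (Σψ-term n))
    (solve 2 (λ a b → (a :+ a) :+ (b :+ b) := (a :+ b) :+ (a :+ b)) ≈-refl _ _)

  Σθ⊠Σψ : ∀ n → m ℕ.≤ suc n → let P = Θ.C (suc n) ⊠ Θ.C² (suc n) in
    ΣZ (θ-term d) (suc n) ⊠ ΣZ (ψ-term d) (suc n) ≐ P ⊞ P [ m ]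
  Σθ⊠Σψ n m≤n = begin
    ΣZ (θ-term d) (suc n) ⊠ ΣZ (ψ-term d) (suc n)
      ≈⟨ *-cong (≈-sym (θ≐Σθ-term n m≤n)) (Σψ-term (suc n)) ⟩
    Θ.θ (suc n) ⊠ (Θ.ψ (suc n) ⊞ Θ.ψ (suc n))
      ≈⟨ distribˡ _ _ _ ⟩
    Θ.θ (suc n) ⊠ Θ.ψ (suc n) ⊞ Θ.θ (suc n) ⊠ Θ.ψ (suc n)
      ≈⟨ +-cong θψ θψ ⟩
    Θ.C (suc n) ⊠ Θ.C² (suc n) ⊞ Θ.C (suc n) ⊠ Θ.C² (suc n) ∎
    where
    θψ : Θ.θ (suc n) ⊠ Θ.ψ (suc n) ≐ Θ.C (suc n) ⊠ Θ.C² (suc n) [ m ]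
    θψ = ≈-sym (≈-trans (Θ₀.CC²≈θψ n m≤n) (*-congˡ (≈-trans
      (reflexive (cong (λ k → Θ.ψ (suc n ℕ.+ k)) (ℕ.+-identityʳ (suc n))))
      (Θ₀.ψ-stable (suc n) m≤n (suc n)))))

E-partial-stable : ∀ d′ m N → m ℕ.≤ N → E-partial (suc d′) N ≐ E[ suc d′ ] [ m ]
E-partial-stable d′ m N m≤N = mk λ j j<m →
  let j≤N = ℕ.<⇒≤ (ℕ.≤-trans j<m m≤N) in
  trans (cong (λ n → E-partial (suc d′) n j) (sym (ℕ.m∸n+n≡m j≤N)))
  (trans (cong (λ f → f j) (E-partial-⊠ (suc d′) (N ℕ.∸ j ℕ.+ j)))
  (trans (coeff (ThetaSeries.Θ₀.C-stable d′ (suc j) j ℕ.≤-refl (N ℕ.∸ j)) j ℕ.≤-refl)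
    (cong (λ f → f j) (sym (E-partial-⊠ (suc d′) j)))))

EE²-partial-product : ∀ m n → let module T = ThetaSeries 0 m in
  EE²-partial n ≐ T.Θ.C n ⊠ T.Θ.C² n [ m ]
EE²-partial-product m n = ≈-trans (reflexive (EE²-partial-⊠ n)) (≈-trans (fold-⊠-cong m factor n) (T.Θ.E²-product n))
  where
  module T = ThetaSeries 0 m
  open CommutativeRing (Truncated.truncated m)
    renaming (refl to ≈-refl; sym to ≈-sym; trans to ≈-trans; zero to *-zero)
  X≐M : ∀ k → X^ k ≐ T.M k [ m ]
  X≐M k = reflexive (cong X^_ (sym (ℕ.*-identityˡ k)))
  factor : ∀ k → (X^ 0 ⊟ X^ (suc k)) ⊠ (X^ 0 ⊟ X^ (2 ℕ.* suc k)) ≐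
    (X^ 0 ⊟ T.M (suc k)) ⊠ (X^ 0 ⊟ T.M (2 ℕ.* suc k)) [ m ]
  factor k = *-cong (+-congˡ (-‿cong (X≐M (suc k)))) (+-congˡ (-‿cong (X≐M (2 ℕ.* suc k))))

EE²-partial-stable : ∀ m N → m ℕ.≤ N → EE²-partial N ≐ c [ m ]
EE²-partial-stable m N m≤N = mk λ j j<m →
  let j≤N = ℕ.<⇒≤ (ℕ.≤-trans j<m m≤N)
      module T = ThetaSeries 0 (suc j)
      open CommutativeRing (Truncated.truncated (suc j))
        renaming (refl to ≈-refl; sym to ≈-sym; trans to ≈-trans; zero to *-zero)
  in trans (cong (λ n → EE²-partial n j) (sym (ℕ.m∸n+n≡m j≤N)))
    (coeff (≈-trans (EE²-partial-product (suc j) (N ℕ.∸ j ℕ.+ j))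
      (≈-trans (*-cong (T.Θ₀.C-stable j ℕ.≤-refl (N ℕ.∸ j)) (T.Θ₀.C²-stable j ℕ.≤-refl (N ℕ.∸ j)))
        (≈-sym (EE²-partial-product (suc j) j)))) j ℕ.≤-refl)

Σθ⊠Σψ≐c+c : ∀ m n → m ℕ.≤ suc n →
  ΣZ (θ-term 1) (suc n) ⊠ ΣZ (ψ-term 1) (suc n) ≐ c ⊞ c [ m ]
Σθ⊠Σψ≐c+c m n m≤n = ≈-trans (ThetaSeries.Σθ⊠Σψ 0 m n m≤n) (+-cong P≐c P≐c)
  where
  open CommutativeRing (Truncated.truncated m)
    renaming (refl to ≈-refl; sym to ≈-sym; trans to ≈-trans; zero to *-zero)
  P≐c = ≈-trans (≈-sym (EE²-partial-product m (suc n))) (EE²-partial-stable m (suc n) m≤n)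

Σθ⊠Σψ≐EE² : ∀ d′ m n → m ℕ.≤ suc n → let d = suc d′ in
  ΣZ (θ-term d) (suc n) ⊠ ΣZ (ψ-term d) (suc n) ≐ E[ d ] ⊠ E[ d ℕ.* 2 ] ⊞ E[ d ] ⊠ E[ d ℕ.* 2 ] [ m ]
Σθ⊠Σψ≐EE² d′ m n m≤n = ≈-trans (ThetaSeries.Σθ⊠Σψ d′ m n m≤n) (+-cong P≐ P≐)
  where
  module T = ThetaSeries d′ m
  open CommutativeRing (Truncated.truncated m)
    renaming (refl to ≈-refl; sym to ≈-sym; trans to ≈-trans; zero to *-zero)
  C²≐E : T.Θ.C² (suc n) ≐ E-partial (suc d′ ℕ.* 2) (suc n) [ m ]
  C²≐E = ≈-trans (fold-⊠-cong m (λ k → reflexive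
    (cong (λ a → X^ 0 ⊟ X^ a) (sym (ℕ.*-assoc (suc d′) 2 (suc k))))) (suc n))
    (reflexive (sym (E-partial-⊠ (suc d′ ℕ.* 2) (suc n))))
  P≐ = *-cong (≈-trans (reflexive (sym (E-partial-⊠ (suc d′) (suc n))))
      (E-partial-stable d′ m (suc n) m≤n))
    (≈-trans C²≐E (E-partial-stable (suc (d′ ℕ.* 2)) m (suc n) m≤n))

-- Finite sums and sign-reversing involutions

sumOver : {A : Set} → (A → ℤ) → List A → ℤ
sumOver F = foldr (λ x a → F x ℤ.+ a) 0ℤ

sumOver-cong : {A : Set} {F G : A → ℤ} → ∀ xs → (∀ {x} → x ∈ xs → F x ≡ G x) →
  sumOver F xs ≡ sumOver G xs
sumOver-cong []       F≡G = refl
sumOver-cong (x ∷ xs) F≡G = cong₂ ℤ._+_ (F≡G (here refl)) (sumOver-cong xs (λ x∈ → F≡G (there x∈)))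

sumOver-map : {A B : Set} (F : B → ℤ) (f : A → B) → ∀ xs →
  sumOver F (map f xs) ≡ sumOver (λ x → F (f x)) xs
sumOver-map F f []       = refl
sumOver-map F f (x ∷ xs) = cong (λ a → F (f x) ℤ.+ a) (sumOver-map F f xs)

sumOver-neg : {A : Set} (F : A → ℤ) → ∀ xs → sumOver (λ x → ℤ.- F x) xs ≡ ℤ.- sumOver F xs
sumOver-neg F []       = refl
sumOver-neg F (x ∷ xs) = trans (cong (λ a → ℤ.- F x ℤ.+ a) (sumOver-neg F xs))
  (sym (ℤ.neg-distrib-+ (F x) (sumOver F xs)))

sumOver-++ : {A : Set} (F : A → ℤ) → ∀ xs ys →
  sumOver F (xs ++ ys) ≡ sumOver F xs ℤ.+ sumOver F ys
sumOver-++ F []       ys = sym (ℤ.+-identityˡ (sumOver F ys))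
sumOver-++ F (x ∷ xs) ys = trans (cong (λ a → F x ℤ.+ a) (sumOver-++ F xs ys))
  (sym (ℤ.+-assoc (F x) (sumOver F xs) (sumOver F ys)))

sumOver-× : {A B : Set} (F : A × B → ℤ) → ∀ xs ys →
  sumOver F (cartesianProduct xs ys) ≡ sumOver (λ x → sumOver (λ y → F (x , y)) ys) xs
sumOver-× F []       ys = refl
sumOver-× F (x ∷ xs) ys = trans (sumOver-++ F (map (x ,_) ys) (cartesianProduct xs ys))
  (cong₂ ℤ._+_ (sumOver-map F (x ,_) ys) (sumOver-× F xs ys))

sumOver-↭ : {A : Set} (F : A → ℤ) → ∀ {xs ys} → xs ↭ ys → sumOver F xs ≡ sumOver F ys
sumOver-↭ F ↭.refl          = refl
sumOver-↭ F (↭.prep x p)    = cong (λ a → F x ℤ.+ a) (sumOver-↭ F p)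
sumOver-↭ F {_ ∷ _ ∷ xs} (↭.swap x y p) = trans (exchange (F x) (F y) (sumOver F xs))
  (cong (λ a → F y ℤ.+ (F x ℤ.+ a)) (sumOver-↭ F p))
  where
  exchange : ∀ a b s → a ℤ.+ (b ℤ.+ s) ≡ b ℤ.+ (a ℤ.+ s)
  exchange = ℤ-Solver.solve-∀
sumOver-↭ F (↭.trans p q)   = trans (sumOver-↭ F p) (sumOver-↭ F q)

module _ {A : Set} (F : A → ℤ) where

  support? : ∀ x → Dec (F x ≢ 0ℤ)
  support? x = ¬? (F x ℤ.≟ 0ℤ)

  support : List A → List A
  support = filter support?

  sumOver-support : ∀ xs → sumOver F (support xs) ≡ sumOver F xs
  sumOver-support []       = refl
  sumOver-support (x ∷ xs) with F x ℤ.≟ 0ℤ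
  ... | yes Fx≡0 = trans (sumOver-support xs)
    (sym (trans (cong (ℤ._+ sumOver F xs) Fx≡0) (ℤ.+-identityˡ (sumOver F xs))))
  ... | no _     = cong (λ a → F x ℤ.+ a) (sumOver-support xs)

map-unique : {A B : Set} (f : A → B) → ∀ xs →
  (∀ {x y} → x ∈ xs → y ∈ xs → f x ≡ f y → x ≡ y) → Unique xs → Unique (map f xs)
map-unique f []       inj []        = []
map-unique f (x ∷ xs) inj (x∉ ∷ u) =
  All.map⁺ (All.tabulate λ y∈ fx≡fy → All.lookup x∉ y∈ (inj (here refl) (there y∈) fx≡fy))
  ∷ map-unique f xs (λ x∈ y∈ → inj (there x∈) (there y∈)) u

i≡-i⇒i≡0 : ∀ i → i ≡ ℤ.- i → i ≡ 0ℤ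
i≡-i⇒i≡0 (+ zero)  _ = refl
i≡-i⇒i≡0 (+ suc n) ()
i≡-i⇒i≡0 -[1+ n ]  ()

sign-reversing : {A : Set} (F : A → ℤ) (ι : A → A) → ∀ xs → Unique xs →
  (∀ {x} → x ∈ xs → F x ≢ 0ℤ → ι x ∈ xs) →
  (∀ {x} → F x ≢ 0ℤ → ι (ι x) ≡ x × F (ι x) ≡ ℤ.- F x) →
  sumOver F xs ≡ 0ℤ
sign-reversing F ι xs xs! closed reversing = trans (sym (sumOver-support F xs)) (i≡-i⇒i≡0 _ (begin
  sumOver F ys                     ≡⟨ sumOver-↭ F (∼bag⇒↭ (unique∧set⇒bag ys! ιys! set-eq)) ⟩
  sumOver F (map ι ys)             ≡⟨ sumOver-map F ι ys ⟩
  sumOver (λ x → F (ι x)) ys       ≡⟨ sumOver-cong ys (λ x∈ → proj₂ (reversing (F≢0 x∈))) ⟩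
  sumOver (λ x → ℤ.- F x) ys       ≡⟨ sumOver-neg F ys ⟩
  ℤ.- sumOver F ys                 ∎))
  where
  open ≡-Reasoning
  ys = support F xs
  ys! = filter⁺ (support? F) xs!
  F≢0 : ∀ {x} → x ∈ ys → F x ≢ 0ℤ
  F≢0 x∈ = proj₂ (∈-filter⁻ (support? F) {xs = xs} x∈)
  ι∈ : ∀ {x} → x ∈ ys → ι x ∈ ys
  ι∈ {x} x∈ = ∈-filter⁺ (support? F)
    (closed (proj₁ (∈-filter⁻ (support? F) {xs = xs} x∈)) (F≢0 x∈))
    (λ Fιx≡0 → F≢0 x∈ (ℤ.neg-injective (trans (sym (proj₂ (reversing (F≢0 x∈)))) Fιx≡0)))
  ιys! : Unique (map ι ys)
  ιys! = map-unique ι ys (λ x∈ y∈ ιx≡ιy → trans (sym (proj₁ (reversing (F≢0 x∈))))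
    (trans (cong ι ιx≡ιy) (proj₁ (reversing (F≢0 y∈))))) ys!
  set-eq : ∀ {x} → _
  set-eq {x} = mk⇔ {A = x ∈ ys} {B = x ∈ map ι ys}
    (λ x∈ → subst (_∈ map ι ys) (proj₁ (reversing (F≢0 x∈))) (∈-map⁺ ι (ι∈ x∈)))
    (λ x∈ → let (y , y∈ , x≡ιy) = ∈-map⁻ ι x∈ in subst (_∈ ys) (sym x≡ιy) (ι∈ y∈))

-- The integers from -N to N - 1

data InRange (N : ℕ) : ℤ → Set where
  pos : ∀ {k} → k ℕ.< N → InRange N (+ k)
  neg : ∀ {k} → k ℕ.< N → InRange N -[1+ k ]

range : ℕ → List ℤ
range zero    = []
range (suc N) = + N ∷ -[1+ N ] ∷ range N

InRange-suc : ∀ {N s} → InRange N s → InRange (suc N) s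
InRange-suc (pos k<N) = pos (ℕ.m≤n⇒m≤1+n k<N)
InRange-suc (neg k<N) = neg (ℕ.m≤n⇒m≤1+n k<N)

range-bounded : ∀ N → All (InRange N) (range N)
range-bounded zero    = []
range-bounded (suc N) = pos ℕ.≤-refl ∷ neg ℕ.≤-refl ∷ All.map InRange-suc (range-bounded N)

range-unique : ∀ N → Unique (range N)
range-unique zero    = []
range-unique (suc N) =
  ((λ ()) ∷ All.map (λ { (pos k<N) refl → ℕ.<-irrefl refl k<N }) (range-bounded N)) ∷
  All.map (λ { (neg k<N) refl → ℕ.<-irrefl refl k<N }) (range-bounded N) ∷
  range-unique N

∈-range : ∀ {N s} → InRange N s → s ∈ range N
∈-range {suc N} (pos {k} k<N) with k ℕ.≟ N
... | yes refl = here refl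
... | no  k≢N  = there (there (∈-range (pos (ℕ.≤∧≢⇒< (ℕ.≤-pred k<N) k≢N))))
∈-range {suc N} (neg {k} k<N) with k ℕ.≟ N
... | yes refl = there (here refl)
... | no  k≢N  = there (there (∈-range (neg (ℕ.≤∧≢⇒< (ℕ.≤-pred k<N) k≢N))))

ΣZ-coeff : ∀ h N j → ΣZ h N j ≡ sumOver (λ s → h s j) (range N)
ΣZ-coeff h zero    j = refl
ΣZ-coeff h (suc N) j = begin
  (ΣZ h N ⊞ (h (+ N) ⊞ h -[1+ N ])) j
    ≡⟨ trans (⊞-coeff (ΣZ h N) _ j) (cong₂ ℤ._+_ (ΣZ-coeff h N j) (⊞-coeff (h (+ N)) (h -[1+ N ]) j)) ⟩
  sumOver (λ s → h s j) (range N) ℤ.+ (h (+ N) j ℤ.+ h -[1+ N ] j)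
    ≡⟨ rotate (sumOver (λ s → h s j) (range N)) (h (+ N) j) (h -[1+ N ] j) ⟩
  sumOver (λ s → h s j) (range (suc N)) ∎
  where
  open ≡-Reasoning
  rotate : ∀ a b c → a ℤ.+ (b ℤ.+ c) ≡ b ℤ.+ (c ℤ.+ a)
  rotate = ℤ-Solver.solve-∀

-- Quadratic exponents and parity

square-ℤ : ∀ s → + square s ≡ s ℤ.* s
square-ℤ (+ n)    = ℤ.pos-* n n
square-ℤ -[1+ n ] = refl

triangle-ℤ : ∀ n → + triangle n ℤ.* + 2 ≡ + n ℤ.* (+ n ℤ.+ 1ℤ)
triangle-ℤ zero    = refl
triangle-ℤ (suc n) = begin
  + (triangle n ℕ.+ suc n) ℤ.* + 2
    ≡⟨ cong (ℤ._* + 2) (ℤ.pos-+ (triangle n) (suc n)) ⟩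
  (+ triangle n ℤ.+ + suc n) ℤ.* + 2
    ≡⟨ ℤ.*-distribʳ-+ (+ 2) (+ triangle n) (+ suc n) ⟩
  + triangle n ℤ.* + 2 ℤ.+ + suc n ℤ.* + 2
    ≡⟨ cong₂ ℤ._+_ (triangle-ℤ n) (cong (ℤ._* + 2) (ℤ.pos-+ 1 n)) ⟩
  + n ℤ.* (+ n ℤ.+ 1ℤ) ℤ.+ (1ℤ ℤ.+ + n) ℤ.* + 2
    ≡⟨ expand (+ n) ⟩
  (1ℤ ℤ.+ + n) ℤ.* ((1ℤ ℤ.+ + n) ℤ.+ 1ℤ)
    ≡⟨ cong (λ k → k ℤ.* (k ℤ.+ 1ℤ)) (sym (ℤ.pos-+ 1 n)) ⟩
  + suc n ℤ.* (+ suc n ℤ.+ 1ℤ) ∎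
  where
  open ≡-Reasoning
  expand : ∀ n → n ℤ.* (n ℤ.+ 1ℤ) ℤ.+ (1ℤ ℤ.+ n) ℤ.* + 2 ≡ (1ℤ ℤ.+ n) ℤ.* ((1ℤ ℤ.+ n) ℤ.+ 1ℤ)
  expand = ℤ-Solver.solve-∀

-[1+]≡ : ∀ n → -[1+ n ] ≡ ℤ.-1ℤ ℤ.- + n
-[1+]≡ zero    = refl
-[1+]≡ (suc n) = refl

tri-ℤ : ∀ t → + tri t ℤ.* + 2 ≡ t ℤ.* (t ℤ.+ 1ℤ)
tri-ℤ (+ n)    = triangle-ℤ n
tri-ℤ -[1+ n ] = trans (triangle-ℤ n) (trans (reflect (+ n))
  (cong (λ t → t ℤ.* (t ℤ.+ 1ℤ)) (sym (-[1+]≡ n))))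
  where
  reflect : ∀ n → n ℤ.* (n ℤ.+ 1ℤ) ≡ (ℤ.-1ℤ ℤ.- n) ℤ.* ((ℤ.-1ℤ ℤ.- n) ℤ.+ 1ℤ)
  reflect = ℤ-Solver.solve-∀

χ-suc : ∀ s → χ (1ℤ ℤ.+ s) ≡ ℤ.- χ s
χ-suc (+ n)          = refl
χ-suc -[1+ zero ]    = refl
χ-suc -[1+ suc n ]   = sym (ℤ.neg-involutive (sgn (suc n)))

χ-neg : ∀ s → χ (ℤ.- s) ≡ χ s
χ-neg s = cong sgn (ℤ.∣-i∣≡∣i∣ s)

χ-2+ : ∀ s → χ (+ 2 ℤ.+ s) ≡ χ s
χ-2+ s = trans (cong χ (ℤ.+-assoc 1ℤ 1ℤ s)) (trans (χ-suc (1ℤ ℤ.+ s))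
  (trans (cong ℤ.-_ (χ-suc s)) (ℤ.neg-involutive (χ s))))

χ-even+ : ∀ n s → χ (+ 2 ℤ.* + n ℤ.+ s) ≡ χ s
χ-even+ zero    s = cong χ (ℤ.+-identityˡ s)
χ-even+ (suc n) s = trans (cong (λ k → χ (+ 2 ℤ.* k ℤ.+ s)) (ℤ.pos-+ 1 n))
  (trans (cong χ (expand (+ n) s)) (trans (χ-2+ (+ 2 ℤ.* + n ℤ.+ s)) (χ-even+ n s)))
  where
  expand : ∀ n s → + 2 ℤ.* (1ℤ ℤ.+ n) ℤ.+ s ≡ + 2 ℤ.+ (+ 2 ℤ.* n ℤ.+ s)
  expand = ℤ-Solver.solve-∀

χ-even : ∀ q s → χ (+ 2 ℤ.* q ℤ.+ s) ≡ χ s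
χ-even (+ n)    s = χ-even+ n s
χ-even -[1+ n ] s = trans (sym (χ-even+ (suc n) (+ 2 ℤ.* -[1+ n ] ℤ.+ s)))
  (cong χ (cancel (+ suc n) s))
  where
  cancel : ∀ n s → + 2 ℤ.* n ℤ.+ (+ 2 ℤ.* (ℤ.- n) ℤ.+ s) ≡ s
  cancel = ℤ-Solver.solve-∀

-- ω s t is the indicator of s ≡ t - 1 (mod 3), that is, of the divisibility of
-- (2t + 1) + 2s√-2, of norm 8 (s² + t(t+1)/2) + 1, by 1 + √-2.
-- The involution replaces the factor 1 + √-2 by 1 - √-2.

three-divides? : ∀ s t → Dec (+ 3 ∣ s ℤ.- t ℤ.+ 1ℤ)
three-divides? s t = + 3 ∣? (s ℤ.- t ℤ.+ 1ℤ)

indicator : {P : Set} → Dec P → ℤ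
indicator (yes _) = 1ℤ
indicator (no _)  = 0ℤ

indicator-yes : ∀ {P} (P? : Dec P) → P → indicator P? ≡ 1ℤ
indicator-yes (yes _) p = refl
indicator-yes (no ¬p) p = contradiction p ¬p

indicator-no : ∀ {P} (P? : Dec P) → ¬ P → indicator P? ≡ 0ℤ
indicator-no (yes p) ¬p = contradiction p ¬p
indicator-no (no _)  ¬p = refl

ω : ℤ → ℤ → ℤ
ω s t = indicator (three-divides? s t)

conjugate-by : ∀ s t → Dec (+ 3 ∣ s ℤ.- t ℤ.+ 1ℤ) → ℤ × ℤ
conjugate-by s t (yes (divides q _)) = (+ 2 ℤ.* q ℤ.- 1ℤ ℤ.- s) , (ℤ.- s ℤ.- q)
conjugate-by s t (no _)              = s , t

conjugate : ℤ × ℤ → ℤ × ℤ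
conjugate (s , t) = conjugate-by s t (three-divides? s t)

exponent : ℤ × ℤ → ℕ
exponent (s , t) = square s ℕ.+ tri t

exponent-ℤ : ∀ s t → + exponent (s , t) ℤ.* + 8 ≡ + 8 ℤ.* (s ℤ.* s) ℤ.+ + 4 ℤ.* (t ℤ.* (t ℤ.+ 1ℤ))
exponent-ℤ s t = begin
  + (square s ℕ.+ tri t) ℤ.* + 8
    ≡⟨ cong (ℤ._* + 8) (ℤ.pos-+ (square s) (tri t)) ⟩
  (+ square s ℤ.+ + tri t) ℤ.* + 8
    ≡⟨ expand (+ square s) (+ tri t) ⟩
  + 8 ℤ.* + square s ℤ.+ + 4 ℤ.* (+ tri t ℤ.* + 2)
    ≡⟨ cong₂ (λ x y → + 8 ℤ.* x ℤ.+ + 4 ℤ.* y) (square-ℤ s) (tri-ℤ t) ⟩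
  + 8 ℤ.* (s ℤ.* s) ℤ.+ + 4 ℤ.* (t ℤ.* (t ℤ.+ 1ℤ)) ∎
  where
  open ≡-Reasoning
  expand : ∀ x y → (x ℤ.+ y) ℤ.* + 8 ≡ + 8 ℤ.* x ℤ.+ + 4 ℤ.* (y ℤ.* + 2)
  expand = ℤ-Solver.solve-∀

record Conjugate (s t : ℤ) (s′ t′ : ℤ) : Set where
  field
    divisible  : + 3 ∣ s′ ℤ.- t′ ℤ.+ 1ℤ
    involutive : conjugate (s′ , t′) ≡ (s , t)
    exponent≡  : exponent (s′ , t′) ≡ exponent (s , t)
    χ-reversed : χ s′ ≡ ℤ.- χ s

conjugate-correct : ∀ s t → + 3 ∣ s ℤ.- t ℤ.+ 1ℤ →
  let (s′ , t′) = conjugate (s , t) in Conjugate s t s′ t′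
conjugate-correct s t 3∣ with three-divides? s t
... | no ¬3∣ = contradiction 3∣ ¬3∣
... | yes (divides q eq) = record
  { divisible = divides q diff
  ; involutive = involutive
  ; exponent≡ = ℤ.+-injective (ℤ.*-cancelʳ-≡ _ _ (+ 8) (begin
      + exponent (s′ , t′) ℤ.* + 8                              ≡⟨ exponent-ℤ s′ t′ ⟩
      + 8 ℤ.* (s′ ℤ.* s′) ℤ.+ + 4 ℤ.* (t′ ℤ.* (t′ ℤ.+ 1ℤ))      ≡⟨ norm s q ⟩
      + 8 ℤ.* (s ℤ.* s) ℤ.+ + 4 ℤ.* (u ℤ.* (u ℤ.+ 1ℤ))
        ≡⟨ cong (λ t → + 8 ℤ.* (s ℤ.* s) ℤ.+ + 4 ℤ.* (t ℤ.* (t ℤ.+ 1ℤ))) (sym t≡) ⟩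
      + 8 ℤ.* (s ℤ.* s) ℤ.+ + 4 ℤ.* (t ℤ.* (t ℤ.+ 1ℤ))          ≡⟨ exponent-ℤ s t ⟨
      + exponent (s , t) ℤ.* + 8                                ∎))
  ; χ-reversed = trans (cong χ (regroup s q)) (trans (χ-even q (ℤ.- (1ℤ ℤ.+ s)))
      (trans (χ-neg (1ℤ ℤ.+ s)) (χ-suc s))) }
  where
  open ≡-Reasoning
  s′ = + 2 ℤ.* q ℤ.- 1ℤ ℤ.- s
  t′ = ℤ.- s ℤ.- q
  u = s ℤ.+ 1ℤ ℤ.- q ℤ.* + 3
  solve-t : ∀ s t → t ≡ s ℤ.+ 1ℤ ℤ.- (s ℤ.- t ℤ.+ 1ℤ)
  solve-t = ℤ-Solver.solve-∀
  t≡ : t ≡ u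
  t≡ = trans (solve-t s t) (cong (λ w → s ℤ.+ 1ℤ ℤ.- w) eq)
  norm : ∀ s q →
    + 8 ℤ.* ((+ 2 ℤ.* q ℤ.- 1ℤ ℤ.- s) ℤ.* (+ 2 ℤ.* q ℤ.- 1ℤ ℤ.- s))
      ℤ.+ + 4 ℤ.* ((ℤ.- s ℤ.- q) ℤ.* ((ℤ.- s ℤ.- q) ℤ.+ 1ℤ))
    ≡ + 8 ℤ.* (s ℤ.* s) ℤ.+ + 4 ℤ.* ((s ℤ.+ 1ℤ ℤ.- q ℤ.* + 3) ℤ.* ((s ℤ.+ 1ℤ ℤ.- q ℤ.* + 3) ℤ.+ 1ℤ))
  norm = ℤ-Solver.solve-∀
  regroup : ∀ s q → + 2 ℤ.* q ℤ.- 1ℤ ℤ.- s ≡ + 2 ℤ.* q ℤ.+ (ℤ.- (1ℤ ℤ.+ s))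
  regroup = ℤ-Solver.solve-∀
  diff-eq : ∀ s q → (+ 2 ℤ.* q ℤ.- 1ℤ ℤ.- s) ℤ.- (ℤ.- s ℤ.- q) ℤ.+ 1ℤ ≡ q ℤ.* + 3
  diff-eq = ℤ-Solver.solve-∀
  diff : s′ ℤ.- t′ ℤ.+ 1ℤ ≡ q ℤ.* + 3
  diff = diff-eq s q
  back-s : ∀ s q → + 2 ℤ.* q ℤ.- 1ℤ ℤ.- (+ 2 ℤ.* q ℤ.- 1ℤ ℤ.- s) ≡ s
  back-s = ℤ-Solver.solve-∀
  back-t : ∀ s q → ℤ.- (+ 2 ℤ.* q ℤ.- 1ℤ ℤ.- s) ℤ.- q ≡ s ℤ.+ 1ℤ ℤ.- q ℤ.* + 3
  back-t = ℤ-Solver.solve-∀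
  involutive : conjugate (s′ , t′) ≡ (s , t)
  involutive with three-divides? s′ t′
  ... | no ¬3∣ = contradiction (divides q diff) ¬3∣
  ... | yes (divides p eq′) with ℤ.*-cancelʳ-≡ p q (+ 3) (trans (sym eq′) diff)
  ... | refl = cong₂ _,_ (back-s s q) (trans (back-t s q) (sym t≡))

X^-support : ∀ a j → (X^ a) j ≢ 0ℤ → a ≡ j
X^-support zero    zero    _  = refl
X^-support zero    (suc j) ≢0 = contradiction refl ≢0
X^-support (suc a) zero    ≢0 = contradiction refl ≢0
X^-support (suc a) (suc j) ≢0 = cong suc (X^-support a j ≢0)

module _ (N e : ℕ) (e<N : e ℕ.< N) where

  weight : ℤ × ℤ → ℤ
  weight p@(s , t) = ω s t ℤ.* χ s ℤ.* (X^ exponent p) e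

  in-range : ∀ p → exponent p ≡ e → p ∈ cartesianProduct (range N) (range N)
  in-range (s , t) refl = ∈-cartesianProduct⁺
    (∈-range (s-range s (ℕ.≤-<-trans (ℕ.m≤m+n (square s) (tri t)) e<N)))
    (∈-range (t-range t (ℕ.≤-<-trans (ℕ.m≤n+m (tri t) (square s)) e<N)))
    where
    n≤n*n : ∀ n → n ℕ.≤ n ℕ.* n
    n≤n*n zero    = z≤n
    n≤n*n (suc n) = ℕ.m≤m*n (suc n) (suc n)
    s-range : ∀ s → square s ℕ.< N → InRange N s
    s-range (+ n)    <N = pos (ℕ.≤-<-trans (n≤n*n n) <N)
    s-range -[1+ n ] <N = neg (ℕ.≤-<-trans (ℕ.≤-trans (ℕ.n≤1+n n) (n≤n*n (suc n))) <N)
    t-range : ∀ t → tri t ℕ.< N → InRange N t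
    t-range (+ n)    <N = pos (ℕ.≤-<-trans (n≤triangle n) <N)
    t-range -[1+ n ] <N = neg (ℕ.≤-<-trans (n≤triangle n) <N)

  weight-support : ∀ s t → weight (s , t) ≢ 0ℤ →
    + 3 ∣ s ℤ.- t ℤ.+ 1ℤ × exponent (s , t) ≡ e
  weight-support s t ≢0 with three-divides? s t
  ... | no _   = contradiction refl ≢0
  ... | yes 3∣ = 3∣ , X^-support (exponent (s , t)) e λ X≡0 →
    ≢0 (trans (cong (λ w → 1ℤ ℤ.* χ s ℤ.* w) X≡0) (ℤ.*-zeroʳ (1ℤ ℤ.* χ s)))

  weight-sum : sumOver weight (cartesianProduct (range N) (range N)) ≡ 0ℤ
  weight-sum = sign-reversing weight conjugate _
    (cartesianProduct⁺ (range-unique N) (range-unique N))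
    (λ {(s , t)} _ ≢0 → let (3∣ , exp≡e) = weight-support s t ≢0 in
      in-range (conjugate (s , t)) (trans (Conjugate.exponent≡ (conjugate-correct s t 3∣)) exp≡e))
    (λ {(s , t)} ≢0 → let (3∣ , exp≡e) = weight-support s t ≢0
                          module C = Conjugate (conjugate-correct s t 3∣)
                      in C.involutive , reversed s t (proj₁ (conjugate (s , t))) (proj₂ (conjugate (s , t))) 3∣ C.divisible C.χ-reversed C.exponent≡)
    where
    reversed : ∀ s t s′ t′ → + 3 ∣ s ℤ.- t ℤ.+ 1ℤ → + 3 ∣ s′ ℤ.- t′ ℤ.+ 1ℤ → χ s′ ≡ ℤ.- χ s →
      exponent (s′ , t′) ≡ exponent (s , t) → weight (s′ , t′) ≡ ℤ.- weight (s , t)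
    reversed s t s′ t′ 3∣ 3∣′ χ≡ exp≡ = begin
      ω s′ t′ ℤ.* χ s′ ℤ.* (X^ exponent (s′ , t′)) e
        ≡⟨ cong₂ (λ w n → w ℤ.* χ s′ ℤ.* (X^ n) e)
             (trans (indicator-yes (three-divides? s′ t′) 3∣′) (sym (indicator-yes (three-divides? s t) 3∣))) exp≡ ⟩
      ω s t ℤ.* χ s′ ℤ.* (X^ exponent (s , t)) e
        ≡⟨ cong (λ w → ω s t ℤ.* w ℤ.* (X^ exponent (s , t)) e) χ≡ ⟩
      ω s t ℤ.* (ℤ.- χ s) ℤ.* (X^ exponent (s , t)) e
        ≡⟨ pull (ω s t) (χ s) ((X^ exponent (s , t)) e) ⟩
      ℤ.- weight (s , t) ∎
      where
      open ≡-Reasoning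
      pull : ∀ a b c → a ℤ.* (ℤ.- b) ℤ.* c ≡ ℤ.- (a ℤ.* b ℤ.* c)
      pull = ℤ-Solver.solve-∀

-- The 3-dissection of E(x)E(x²)

HasType : ℕ → PowerSeries → Set
HasType r f = ∀ j → j % 3 ≢ r → f j ≡ 0ℤ

residue : ∀ a r z → r ℕ.< 3 → + a ≡ + r ℤ.+ z ℤ.* + 3 → a % 3 ≡ r
residue a r (+ n) r<3 eq = trans (cong (_% 3) (ℤ.+-injective (trans eq
  (trans (cong (λ w → + r ℤ.+ w) (sym (ℤ.pos-* n 3))) (sym (ℤ.pos-+ r (n ℕ.* 3)))))))
  (trans (ℕ.[m+kn]%n≡m%n r n 3) (ℕ.m<n⇒m%n≡m r<3))
residue a r -[1+ n ] r<3 eq = contradiction (ℕ.≤-trans 3≤ (ℕ.≤-reflexive (ℤ.+-injective sum≡r)))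
  (ℕ.<⇒≱ r<3)
  where
  cancel : ∀ r n → (r ℤ.+ ℤ.- n ℤ.* + 3) ℤ.+ n ℤ.* + 3 ≡ r
  cancel = ℤ-Solver.solve-∀
  sum≡r : + (a ℕ.+ suc n ℕ.* 3) ≡ + r
  sum≡r = trans (ℤ.pos-+ a (suc n ℕ.* 3)) (trans (cong₂ ℤ._+_ eq (ℤ.pos-* (suc n) 3))
    (cancel (+ r) (+ suc n)))
  3≤ : 3 ℕ.≤ a ℕ.+ suc n ℕ.* 3
  3≤ = ℕ.≤-trans (ℕ.m≤m+n 3 (n ℕ.* 3)) (ℕ.m≤n+m _ a)

type-X^ : ∀ {r} a → a % 3 ≡ r → HasType r (X^ a)
type-X^ a a%3 j j%3≢r with (X^ a) j ℤ.≟ 0ℤ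
... | yes ≡0 = ≡0
... | no  ≢0 with X^-support a j ≢0
... | refl = contradiction a%3 j%3≢r

type-⊞ : ∀ {r f g} → HasType r f → HasType r g → HasType r (f ⊞ g)
type-⊞ {f = f} {g} p q j j≢ = trans (⊞-coeff f g j) (cong₂ ℤ._+_ (p j j≢) (q j j≢))

type-ΣZ : ∀ {r} h → (∀ s → HasType r (h s)) → ∀ n → HasType r (ΣZ h n)
type-ΣZ h p zero    j j≢ = refl
type-ΣZ h p (suc n) = type-⊞ (type-ΣZ h p n) (type-⊞ (p (+ n)) (p -[1+ n ]))

fold-zero : ∀ f n → (∀ i → i ℕ.< n → f i ≡ 0ℤ) → fold ℤ._+_ 0ℤ f n ≡ 0ℤ
fold-zero f zero    f≡0 = refl
fold-zero f (suc n) f≡0 = cong₂ ℤ._+_ (fold-zero f n λ i i<n → f≡0 i (ℕ.m≤n⇒m≤1+n i<n)) (f≡0 n ℕ.≤-refl)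

type-⊠ : ∀ {r s f g} → r ℕ.+ s ℕ.< 3 → HasType r f → HasType s g → HasType (r ℕ.+ s) (f ⊠ g)
type-⊠ {r} {s} {f} {g} r+s<3 p q j j≢ = trans (cong (λ h → h j) (⊠≡⊛ f g)) (fold-zero _ (suc j) term)
  where
  term : ∀ i → i ℕ.< suc j → f i ℤ.* g (j ℕ.∸ i) ≡ 0ℤ
  term i (s≤s i≤j) with i % 3 ℕ.≟ r
  ... | no  i≢ = trans (cong (ℤ._* g (j ℕ.∸ i)) (p i i≢)) (ℤ.*-zeroˡ (g (j ℕ.∸ i)))
  ... | yes i≡ with (j ℕ.∸ i) % 3 ℕ.≟ s
  ... | no  k≢ = trans (cong (λ w → f i ℤ.* w) (q (j ℕ.∸ i) k≢)) (ℤ.*-zeroʳ (f i))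
  ... | yes k≡ = contradiction (begin
    j % 3                                ≡⟨ cong (_% 3) (ℕ.m+[n∸m]≡n i≤j) ⟨
    (i ℕ.+ (j ℕ.∸ i)) % 3                ≡⟨ ℕ.%-distribˡ-+ i (j ℕ.∸ i) 3 ⟩
    (i % 3 ℕ.+ (j ℕ.∸ i) % 3) % 3        ≡⟨ cong₂ (λ a b → (a ℕ.+ b) % 3) i≡ k≡ ⟩
    (r ℕ.+ s) % 3                        ≡⟨ ℕ.m<n⇒m%n≡m r+s<3 ⟩
    r ℕ.+ s                              ∎) j≢
    where open ≡-Reasoning

component : ℕ → PowerSeries
component k j = if j % 3 ≡ᵇ k then c j else 0ℤ

component-≐ : ∀ {m} k f g → HasType k f → (∀ j → j % 3 ≡ k → g j ≡ 0ℤ) → c ≐ f ⊞ g [ m ] →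
  component k ≐ f [ m ]
component-≐ k f g f-type g-zero c≐ = mk coefficient
  where
  coefficient : ∀ j → j ℕ.< _ → component k j ≡ f j
  coefficient j j<m with j % 3 ≡ᵇ k in eq
  ... | true  = trans (coeff c≐ j j<m) (trans (⊞-coeff f g j) (trans
    (cong (λ w → f j ℤ.+ w) (g-zero j (ℕ.≡ᵇ⇒≡ (j % 3) k (subst Bool.T (sym eq) _))))
    (ℤ.+-identityʳ (f j))))
  ... | false = sym (f-type j (λ j%3≡k → subst Bool.T eq (ℕ.≡⇒≡ᵇ (j % 3) k j%3≡k)))

-- Residue classes of the exponents

square-3k : ∀ k → square (+ 3 ℤ.* k ℤ.+ 0ℤ) ≡ 9 ℕ.* square k
square-3k k = ℤ.+-injective (begin
  + square (+ 3 ℤ.* k ℤ.+ 0ℤ)                       ≡⟨ square-ℤ (+ 3 ℤ.* k ℤ.+ 0ℤ) ⟩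
  (+ 3 ℤ.* k ℤ.+ 0ℤ) ℤ.* (+ 3 ℤ.* k ℤ.+ 0ℤ)         ≡⟨ expand k ⟩
  + 9 ℤ.* (k ℤ.* k)                                 ≡⟨ cong (λ w → + 9 ℤ.* w) (square-ℤ k) ⟨
  + 9 ℤ.* + square k                                ≡⟨ ℤ.pos-* 9 (square k) ⟨
  + (9 ℕ.* square k)                                ∎)
  where
  open ≡-Reasoning
  expand : ∀ k → (+ 3 ℤ.* k ℤ.+ 0ℤ) ℤ.* (+ 3 ℤ.* k ℤ.+ 0ℤ) ≡ + 9 ℤ.* (k ℤ.* k)
  expand = ℤ-Solver.solve-∀

tri-3k+1 : ∀ k → tri (+ 3 ℤ.* k ℤ.+ 1ℤ) ≡ 1 ℕ.+ 9 ℕ.* tri k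
tri-3k+1 k = ℤ.+-injective (ℤ.*-cancelʳ-≡ _ _ (+ 2) (begin
  + tri (+ 3 ℤ.* k ℤ.+ 1ℤ) ℤ.* + 2                          ≡⟨ tri-ℤ (+ 3 ℤ.* k ℤ.+ 1ℤ) ⟩
  (+ 3 ℤ.* k ℤ.+ 1ℤ) ℤ.* ((+ 3 ℤ.* k ℤ.+ 1ℤ) ℤ.+ 1ℤ)        ≡⟨ expand k ⟩
  + 2 ℤ.+ + 9 ℤ.* (k ℤ.* (k ℤ.+ 1ℤ))                        ≡⟨ cong (λ w → + 2 ℤ.+ + 9 ℤ.* w) (tri-ℤ k) ⟨
  + 2 ℤ.+ + 9 ℤ.* (+ tri k ℤ.* + 2)                         ≡⟨ factor (+ tri k) ⟩
  (1ℤ ℤ.+ + 9 ℤ.* + tri k) ℤ.* + 2                          ≡⟨ cong (λ w → (1ℤ ℤ.+ w) ℤ.* + 2) (ℤ.pos-* 9 (tri k)) ⟨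
  (1ℤ ℤ.+ + (9 ℕ.* tri k)) ℤ.* + 2                          ≡⟨ cong (λ w → w ℤ.* + 2) (ℤ.pos-+ 1 (9 ℕ.* tri k)) ⟨
  + (1 ℕ.+ 9 ℕ.* tri k) ℤ.* + 2                             ∎))
  where
  open ≡-Reasoning
  expand : ∀ k → (+ 3 ℤ.* k ℤ.+ 1ℤ) ℤ.* ((+ 3 ℤ.* k ℤ.+ 1ℤ) ℤ.+ 1ℤ)
                   ≡ + 2 ℤ.+ + 9 ℤ.* (k ℤ.* (k ℤ.+ 1ℤ))
  expand = ℤ-Solver.solve-∀
  factor : ∀ t → + 2 ℤ.+ + 9 ℤ.* (t ℤ.* + 2) ≡ (1ℤ ℤ.+ + 9 ℤ.* t) ℤ.* + 2
  factor = ℤ-Solver.solve-∀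

square-3k%3 : ∀ k → square (+ 3 ℤ.* k ℤ.+ 0ℤ) % 3 ≡ 0
square-3k%3 k = residue (square (+ 3 ℤ.* k ℤ.+ 0ℤ)) 0 (+ 3 ℤ.* (k ℤ.* k)) (s≤s z≤n)
  (trans (square-ℤ (+ 3 ℤ.* k ℤ.+ 0ℤ)) (expand k))
  where
  expand : ∀ k → (+ 3 ℤ.* k ℤ.+ 0ℤ) ℤ.* (+ 3 ℤ.* k ℤ.+ 0ℤ) ≡ 0ℤ ℤ.+ + 3 ℤ.* (k ℤ.* k) ℤ.* + 3
  expand = ℤ-Solver.solve-∀

square-3k+1%3 : ∀ k → square (+ 3 ℤ.* k ℤ.+ 1ℤ) % 3 ≡ 1
square-3k+1%3 k = residue (square (+ 3 ℤ.* k ℤ.+ 1ℤ)) 1 (+ 3 ℤ.* (k ℤ.* k) ℤ.+ + 2 ℤ.* k) (s≤s (s≤s z≤n))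
  (trans (square-ℤ (+ 3 ℤ.* k ℤ.+ 1ℤ)) (expand k))
  where
  expand : ∀ k → (+ 3 ℤ.* k ℤ.+ 1ℤ) ℤ.* (+ 3 ℤ.* k ℤ.+ 1ℤ)
                   ≡ 1ℤ ℤ.+ (+ 3 ℤ.* (k ℤ.* k) ℤ.+ + 2 ℤ.* k) ℤ.* + 3
  expand = ℤ-Solver.solve-∀

tri-3k%3 : ∀ k → tri (+ 3 ℤ.* k ℤ.+ 0ℤ) % 3 ≡ 0
tri-3k%3 k = residue (tri (+ 3 ℤ.* k ℤ.+ 0ℤ)) 0 (+ 2 ℤ.* (k ℤ.* (+ 3 ℤ.* k ℤ.+ 1ℤ)) ℤ.- τ) (s≤s z≤n) (begin
  τ                                                                ≡⟨ split τ ⟩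
  + 2 ℤ.* (τ ℤ.* + 2) ℤ.- τ ℤ.* + 3                                ≡⟨ cong (λ w → + 2 ℤ.* w ℤ.- τ ℤ.* + 3) (tri-ℤ s) ⟩
  + 2 ℤ.* (s ℤ.* (s ℤ.+ 1ℤ)) ℤ.- τ ℤ.* + 3                         ≡⟨ factor k τ ⟩
  0ℤ ℤ.+ (+ 2 ℤ.* (k ℤ.* (+ 3 ℤ.* k ℤ.+ 1ℤ)) ℤ.- τ) ℤ.* + 3        ∎)
  where
  open ≡-Reasoning
  s = + 3 ℤ.* k ℤ.+ 0ℤ
  τ = + tri s
  split : ∀ τ → τ ≡ + 2 ℤ.* (τ ℤ.* + 2) ℤ.- τ ℤ.* + 3
  split = ℤ-Solver.solve-∀
  factor : ∀ k τ → + 2 ℤ.* ((+ 3 ℤ.* k ℤ.+ 0ℤ) ℤ.* ((+ 3 ℤ.* k ℤ.+ 0ℤ) ℤ.+ 1ℤ)) ℤ.- τ ℤ.* + 3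
                     ≡ 0ℤ ℤ.+ (+ 2 ℤ.* (k ℤ.* (+ 3 ℤ.* k ℤ.+ 1ℤ)) ℤ.- τ) ℤ.* + 3
  factor = ℤ-Solver.solve-∀

tri-3k+1%3 : ∀ k → tri (+ 3 ℤ.* k ℤ.+ 1ℤ) % 3 ≡ 1
tri-3k+1%3 k = trans (cong (_% 3) (tri-3k+1 k)) (trans
  (cong (λ w → (1 ℕ.+ w) % 3) (index (tri k))) (ℕ.[m+kn]%n≡m%n 1 (3 ℕ.* tri k) 3))
  where
  index : ∀ t → 9 ℕ.* t ≡ 3 ℕ.* t ℕ.* 3
  index = ℕ-Solver.solve-∀

3∣-residue : ∀ k l i j → + 3 ∣ (+ 3 ℤ.* k ℤ.+ i) ℤ.- (+ 3 ℤ.* l ℤ.+ j) ℤ.+ 1ℤ → + 3 ∣ i ℤ.- j ℤ.+ 1ℤ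
3∣-residue k l i j (divides q eq) = divides (q ℤ.- (k ℤ.- l)) (begin
  i ℤ.- j ℤ.+ 1ℤ                                                    ≡⟨ expand k l i j ⟩
  (+ 3 ℤ.* k ℤ.+ i) ℤ.- (+ 3 ℤ.* l ℤ.+ j) ℤ.+ 1ℤ ℤ.- (k ℤ.- l) ℤ.* + 3   ≡⟨ cong (λ w → w ℤ.- (k ℤ.- l) ℤ.* + 3) eq ⟩
  q ℤ.* + 3 ℤ.- (k ℤ.- l) ℤ.* + 3                                   ≡⟨ factor q (k ℤ.- l) ⟩
  (q ℤ.- (k ℤ.- l)) ℤ.* + 3                                         ∎)
  where
  open ≡-Reasoning
  expand : ∀ k l i j → i ℤ.- j ℤ.+ 1ℤ ≡
    (+ 3 ℤ.* k ℤ.+ i) ℤ.- (+ 3 ℤ.* l ℤ.+ j) ℤ.+ 1ℤ ℤ.- (k ℤ.- l) ℤ.* + 3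
  expand = ℤ-Solver.solve-∀
  factor : ∀ a b → a ℤ.* + 3 ℤ.- b ℤ.* + 3 ≡ (a ℤ.- b) ℤ.* + 3
  factor = ℤ-Solver.solve-∀

χ-3k : ∀ k → χ (+ 3 ℤ.* k ℤ.+ 0ℤ) ≡ χ k
χ-3k k = trans (cong χ (split k)) (χ-even k k)
  where
  split : ∀ k → + 3 ℤ.* k ℤ.+ 0ℤ ≡ + 2 ℤ.* k ℤ.+ k
  split = ℤ-Solver.solve-∀

tri-mirror : ∀ t → tri (ℤ.-1ℤ ℤ.- t) ≡ tri t
tri-mirror (+ n)    = cong tri (sym (-[1+]≡ n))
tri-mirror -[1+ n ] = refl

module Dissection (m : ℕ) where
  open CommutativeRing (Truncated.truncated m)
    renaming (refl to ≈-refl; sym to ≈-sym; trans to ≈-trans; zero to *-zero)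
  open IntegerCoefficients (Truncated.truncated m)
  open import Relation.Binary.Reasoning.Setoid setoid

  ΣZ-cong : ∀ {h g} → (∀ s → h s ≐ g s [ m ]) → ∀ n → ΣZ h n ≐ ΣZ g n [ m ]
  ΣZ-cong h≐g zero    = ≈-refl
  ΣZ-cong h≐g (suc n) = +-cong (ΣZ-cong h≐g n) (+-cong (h≐g (+ n)) (h≐g -[1+ n ]))

  ΣZ-𝟘 : ∀ n → ΣZ (λ _ → 𝟘) n ≐ 𝟘 [ m ]
  ΣZ-𝟘 zero    = ≈-refl
  ΣZ-𝟘 (suc n) = ≈-trans (+-cong (ΣZ-𝟘 n) (+-identityˡ 𝟘)) (+-identityˡ 𝟘)

  ΣZ-*ʳ : ∀ h f n → ΣZ h n * f ≐ ΣZ (λ s → h s * f) n [ m ]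
  ΣZ-*ʳ h f zero    = zeroˡ f
  ΣZ-*ʳ h f (suc n) = ≈-trans (distribʳ f _ _) (+-cong (ΣZ-*ʳ h f n) (distribʳ f _ _))

  ΣZ-*ˡ : ∀ f h n → f * ΣZ h n ≐ ΣZ (λ s → f * h s) n [ m ]
  ΣZ-*ˡ f h n = ≈-trans (*-comm f _) (≈-trans (ΣZ-*ʳ h f n) (ΣZ-cong (λ s → *-comm (h s) f) n))

  ΣZ-mirror : ∀ h n → ΣZ (λ s → h (ℤ.-1ℤ ℤ.- s)) n ≐ ΣZ h n [ m ]
  ΣZ-mirror h zero    = ≈-refl
  ΣZ-mirror h (suc n) = +-cong (ΣZ-mirror h n)
    (≈-trans (+-congʳ (reflexive (cong h (sym (-[1+]≡ n))))) (+-comm _ _))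

  ΣZ-split : ∀ h n → ΣZ h (3 ℕ.* n) ≐
    ΣZ (λ k → h (+ 3 ℤ.* k ℤ.+ 0ℤ)) n + ΣZ (λ k → h (+ 3 ℤ.* k ℤ.+ 1ℤ)) n
      + ΣZ (λ k → h (+ 3 ℤ.* k ℤ.+ + 2)) n [ m ]
  ΣZ-split h zero    = ≈-sym (≈-trans (+-identityʳ (𝟘 + 𝟘)) (+-identityʳ 𝟘))
  ΣZ-split h (suc n) = begin
    ΣZ h (3 ℕ.* suc n)
      ≡⟨ cong (ΣZ h) (ℕ.*-suc 3 n) ⟩
    ΣZ h (3 ℕ.* n) + (h (+ a) + h -[1+ a ]) + (h (+ suc a) + h -[1+ suc a ])
      + (h (+ suc (suc a)) + h -[1+ suc (suc a) ])
      ≈⟨ +-cong (+-cong (+-cong (ΣZ-split h n) (+-cong (at+ 0) (at- 0 2 refl)))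
           (+-cong (at+ 1) (at- 1 1 refl))) (+-cong (at+ 2) (at- 2 0 refl)) ⟩
    (ΣZ h₀ n + ΣZ h₁ n + ΣZ h₂ n) + (h₀ (+ n) + h₂ -[1+ n ]) + (h₁ (+ n) + h₁ -[1+ n ])
      + (h₂ (+ n) + h₀ -[1+ n ])
      ≈⟨ solve 9 (λ x y z a b c d e f →
           (x :+ y :+ z) :+ (a :+ f) :+ (b :+ e) :+ (c :+ d) :=
           (x :+ (a :+ d)) :+ (y :+ (b :+ e)) :+ (z :+ (c :+ f)))
           ≈-refl _ _ _ _ _ _ _ _ _ ⟩
    ΣZ h₀ (suc n) + ΣZ h₁ (suc n) + ΣZ h₂ (suc n) ∎
    where
    a = 3 ℕ.* n
    h₀ h₁ h₂ : ℤ → PowerSeries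
    h₀ k = h (+ 3 ℤ.* k ℤ.+ 0ℤ)
    h₁ k = h (+ 3 ℤ.* k ℤ.+ 1ℤ)
    h₂ k = h (+ 3 ℤ.* k ℤ.+ + 2)
    at+ : ∀ i → h (+ (i ℕ.+ a)) ≐ h (+ 3 ℤ.* + n ℤ.+ + i) [ m ]
    at+ i = reflexive (cong h (trans (ℤ.pos-+ i a) (trans (ℤ.+-comm (+ i) (+ a))
      (cong (λ w → w ℤ.+ + i) (ℤ.pos-* 3 n)))))
    reflect : ∀ i n → ℤ.-1ℤ ℤ.- (i ℤ.+ + 3 ℤ.* n) ≡ + 3 ℤ.* (ℤ.-1ℤ ℤ.- n) ℤ.+ (+ 2 ℤ.- i)
    reflect = ℤ-Solver.solve-∀
    at- : ∀ i j → + 2 ℤ.- + i ≡ + j → h -[1+ i ℕ.+ a ] ≐ h (+ 3 ℤ.* -[1+ n ] ℤ.+ + j) [ m ]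
    at- i j eq = reflexive (cong h (trans (-[1+]≡ (i ℕ.+ a))
      (trans (cong (λ w → ℤ.-1ℤ ℤ.- w) (trans (ℤ.pos-+ i a) (cong (λ w → + i ℤ.+ w) (ℤ.pos-* 3 n))))
      (trans (reflect (+ i) (+ n))
      (cong₂ (λ k r → + 3 ℤ.* k ℤ.+ r) (sym (-[1+]≡ n)) eq)))))

  N : ℕ
  N = suc m

  S T : ℤ → PowerSeries
  S i = ΣZ (λ k → θ-term 1 (+ 3 ℤ.* k ℤ.+ i)) N
  T i = ΣZ (λ k → ψ-term 1 (+ 3 ℤ.* k ℤ.+ i)) N

  S₂≐S₁ : S (+ 2) ≐ S 1ℤ [ m ]
  S₂≐S₁ = ≈-trans (ΣZ-cong (λ k → reflexive (trans (cong (θ-term 1) (negate k)) (even (+ 3 ℤ.* (ℤ.-1ℤ ℤ.- k) ℤ.+ 1ℤ)))) N)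
    (ΣZ-mirror (λ k → θ-term 1 (+ 3 ℤ.* k ℤ.+ 1ℤ)) N)
    where
    negate : ∀ k → + 3 ℤ.* k ℤ.+ + 2 ≡ ℤ.- (+ 3 ℤ.* (ℤ.-1ℤ ℤ.- k) ℤ.+ 1ℤ)
    negate = ℤ-Solver.solve-∀
    even : ∀ s → θ-term 1 (ℤ.- s) ≡ θ-term 1 s
    even s = cong (λ a → sgn a · X^ (1 ℕ.* (a ℕ.* a))) (ℤ.∣-i∣≡∣i∣ s)

  T₂≐T₀ : T (+ 2) ≐ T 0ℤ [ m ]
  T₂≐T₀ = ≈-trans (ΣZ-cong (λ k → reflexive (cong (λ a → X^ (1 ℕ.* a))
      (trans (cong tri (reflect k)) (tri-mirror (+ 3 ℤ.* (ℤ.-1ℤ ℤ.- k) ℤ.+ 0ℤ))))) N)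
    (ΣZ-mirror (λ k → ψ-term 1 (+ 3 ℤ.* k ℤ.+ 0ℤ)) N)
    where
    reflect : ∀ k → + 3 ℤ.* k ℤ.+ + 2 ≡ ℤ.-1ℤ ℤ.- (+ 3 ℤ.* (ℤ.-1ℤ ℤ.- k) ℤ.+ 0ℤ)
    reflect = ℤ-Solver.solve-∀

  summand : ℤ → ℤ → PowerSeries
  summand s t = (ω s t ℤ.* χ s) · X^ exponent (s , t)

  summand-sum : ΣZ (λ s → ΣZ (summand s) (3 ℕ.* N)) (3 ℕ.* N) ≐ 𝟘 [ m ]
  summand-sum = mk λ j j<m →
    let j<3N = ℕ.≤-trans j<m (ℕ.≤-trans (ℕ.n≤1+n m) (ℕ.m≤m+n N _))
        F = weight (3 ℕ.* N) j j<3N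
        R = range (3 ℕ.* N)
    in trans (ΣZ-coeff (λ s → ΣZ (summand s) (3 ℕ.* N)) (3 ℕ.* N) j)
      (trans (sumOver-cong R (λ {s} _ → ΣZ-coeff (summand s) (3 ℕ.* N) j))
      (trans (sym (sumOver-× F R R)) (weight-sum (3 ℕ.* N) j j<3N)))

  θ*ψ : ∀ s t → θ-term 1 s * ψ-term 1 t ≐ χ s · X^ exponent (s , t) [ m ]
  θ*ψ s t = ≈-trans (mk λ j _ → trans (cong (λ f → f j) (⊠≡⊛ (θ-term 1 s) (ψ-term 1 t)))
      (trans (·-⊛ j (χ s) (X^ (1 ℕ.* square s)) (ψ-term 1 t))
      (cong (λ w → χ s ℤ.* w) (sym (X^-+ (1 ℕ.* square s) (1 ℕ.* tri t) j)))))
    (reflexive (cong₂ (λ a b → χ s · X^ (a ℕ.+ b)) (ℕ.*-identityˡ (square s)) (ℕ.*-identityˡ (tri t))))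

  class-yes : ∀ s j → (∀ l → + 3 ∣ s ℤ.- (+ 3 ℤ.* l ℤ.+ j) ℤ.+ 1ℤ) →
    ΣZ (λ l → summand s (+ 3 ℤ.* l ℤ.+ j)) N ≐ θ-term 1 s * T j [ m ]
  class-yes s j 3∣ = ≈-trans (ΣZ-cong (λ l → ≈-trans
      (reflexive (cong (λ w → w · X^ exponent (s , + 3 ℤ.* l ℤ.+ j))
        (trans (cong (ℤ._* χ s) (indicator-yes (three-divides? s (+ 3 ℤ.* l ℤ.+ j)) (3∣ l)))
          (ℤ.*-identityˡ (χ s)))))
      (≈-sym (θ*ψ s (+ 3 ℤ.* l ℤ.+ j)))) N)
    (≈-sym (ΣZ-*ˡ (θ-term 1 s) (λ l → ψ-term 1 (+ 3 ℤ.* l ℤ.+ j)) N))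

  class-no : ∀ s j → (∀ l → ¬ + 3 ∣ s ℤ.- (+ 3 ℤ.* l ℤ.+ j) ℤ.+ 1ℤ) →
    ΣZ (λ l → summand s (+ 3 ℤ.* l ℤ.+ j)) N ≐ 𝟘 [ m ]
  class-no s j ¬3∣ = ≈-trans (ΣZ-cong (λ l → mk λ e _ →
      trans (cong (λ w → w ℤ.* χ s ℤ.* (X^ exponent (s , + 3 ℤ.* l ℤ.+ j)) e)
        (indicator-no (three-divides? s (+ 3 ℤ.* l ℤ.+ j)) (¬3∣ l)))
      (ℤ.*-zeroˡ ((X^ exponent (s , + 3 ℤ.* l ℤ.+ j)) e))) N) (ΣZ-𝟘 N)

  row₀ : ∀ k → let s = + 3 ℤ.* k ℤ.+ 0ℤ in ΣZ (summand s) (3 ℕ.* N) ≐ θ-term 1 s * T 1ℤ [ m ]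
  row₀ k = begin
    ΣZ (summand s) (3 ℕ.* N)     ≈⟨ ΣZ-split (summand s) N ⟩
    _ + _ + _                    ≈⟨ +-cong (+-cong
      (class-no s 0ℤ λ l 3∣ → from-no (+ 3 ∣? + 1) (3∣-residue k l 0ℤ 0ℤ 3∣))
      (class-yes s 1ℤ λ l → divides (k ℤ.- l) (multiple k l)))
      (class-no s (+ 2) λ l 3∣ → from-no (+ 3 ∣? -[1+ 0 ]) (3∣-residue k l 0ℤ (+ 2) 3∣)) ⟩
    𝟘 + θ-term 1 s * T 1ℤ + 𝟘    ≈⟨ ≈-trans (+-identityʳ _) (+-identityˡ _) ⟩
    θ-term 1 s * T 1ℤ            ∎
    where
    s = + 3 ℤ.* k ℤ.+ 0ℤ
    multiple : ∀ k l → + 3 ℤ.* k ℤ.+ 0ℤ ℤ.- (+ 3 ℤ.* l ℤ.+ 1ℤ) ℤ.+ 1ℤ ≡ (k ℤ.- l) ℤ.* + 3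
    multiple = ℤ-Solver.solve-∀

  row₁ : ∀ k → let s = + 3 ℤ.* k ℤ.+ 1ℤ in ΣZ (summand s) (3 ℕ.* N) ≐ θ-term 1 s * T (+ 2) [ m ]
  row₁ k = begin
    ΣZ (summand s) (3 ℕ.* N)       ≈⟨ ΣZ-split (summand s) N ⟩
    _ + _ + _                      ≈⟨ +-cong (+-cong
      (class-no s 0ℤ λ l 3∣ → from-no (+ 3 ∣? + 2) (3∣-residue k l 1ℤ 0ℤ 3∣))
      (class-no s 1ℤ λ l 3∣ → from-no (+ 3 ∣? + 1) (3∣-residue k l 1ℤ 1ℤ 3∣)))
      (class-yes s (+ 2) λ l → divides (k ℤ.- l) (multiple k l)) ⟩
    𝟘 + 𝟘 + θ-term 1 s * T (+ 2)   ≈⟨ ≈-trans (+-congʳ (+-identityˡ 𝟘)) (+-identityˡ _) ⟩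
    θ-term 1 s * T (+ 2)           ∎
    where
    s = + 3 ℤ.* k ℤ.+ 1ℤ
    multiple : ∀ k l → + 3 ℤ.* k ℤ.+ 1ℤ ℤ.- (+ 3 ℤ.* l ℤ.+ + 2) ℤ.+ 1ℤ ≡ (k ℤ.- l) ℤ.* + 3
    multiple = ℤ-Solver.solve-∀

  row₂ : ∀ k → let s = + 3 ℤ.* k ℤ.+ + 2 in ΣZ (summand s) (3 ℕ.* N) ≐ θ-term 1 s * T 0ℤ [ m ]
  row₂ k = begin
    ΣZ (summand s) (3 ℕ.* N)     ≈⟨ ΣZ-split (summand s) N ⟩
    _ + _ + _                    ≈⟨ +-cong (+-cong
      (class-yes s 0ℤ λ l → divides (k ℤ.- l ℤ.+ 1ℤ) (multiple k l))
      (class-no s 1ℤ λ l 3∣ → from-no (+ 3 ∣? + 2) (3∣-residue k l (+ 2) 1ℤ 3∣)))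
      (class-no s (+ 2) λ l 3∣ → from-no (+ 3 ∣? + 1) (3∣-residue k l (+ 2) (+ 2) 3∣)) ⟩
    θ-term 1 s * T 0ℤ + 𝟘 + 𝟘    ≈⟨ ≈-trans (+-identityʳ _) (+-identityʳ _) ⟩
    θ-term 1 s * T 0ℤ            ∎
    where
    s = + 3 ℤ.* k ℤ.+ + 2
    multiple : ∀ k l → + 3 ℤ.* k ℤ.+ + 2 ℤ.- (+ 3 ℤ.* l ℤ.+ 0ℤ) ℤ.+ 1ℤ ≡ (k ℤ.- l ℤ.+ 1ℤ) ℤ.* + 3
    multiple = ℤ-Solver.solve-∀

  cancellation : S 0ℤ * T 1ℤ + (S 1ℤ * T 0ℤ + S 1ℤ * T 0ℤ) ≐ 𝟘 [ m ]
  cancellation = begin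
    S 0ℤ * T 1ℤ + (S 1ℤ * T 0ℤ + S 1ℤ * T 0ℤ)
      ≈⟨ +-assoc _ _ _ ⟨
    S 0ℤ * T 1ℤ + S 1ℤ * T 0ℤ + S 1ℤ * T 0ℤ
      ≈⟨ +-cong (+-congˡ (*-congˡ T₂≐T₀)) (*-congʳ S₂≐S₁) ⟨
    S 0ℤ * T 1ℤ + S 1ℤ * T (+ 2) + S (+ 2) * T 0ℤ
      ≈⟨ +-cong (+-cong (collect 0ℤ 1ℤ row₀) (collect 1ℤ (+ 2) row₁)) (collect (+ 2) 0ℤ row₂) ⟨
    _ + _ + _
      ≈⟨ ΣZ-split (λ s → ΣZ (summand s) (3 ℕ.* N)) N ⟨
    ΣZ (λ s → ΣZ (summand s) (3 ℕ.* N)) (3 ℕ.* N)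
      ≈⟨ summand-sum ⟩
    𝟘 ∎
    where
    collect : ∀ i j →
      (∀ k → ΣZ (summand (+ 3 ℤ.* k ℤ.+ i)) (3 ℕ.* N) ≐ θ-term 1 (+ 3 ℤ.* k ℤ.+ i) * T j [ m ]) →
      ΣZ (λ k → ΣZ (summand (+ 3 ℤ.* k ℤ.+ i)) (3 ℕ.* N)) N ≐ S i * T j [ m ]
    collect i j row = ≈-trans (ΣZ-cong row N) (≈-sym (ΣZ-*ʳ (λ k → θ-term 1 (+ 3 ℤ.* k ℤ.+ i)) (T j) N))

  halve : ∀ {f g} → f + f ≐ g + g [ m ] → f ≐ g [ m ]
  halve {f} {g} 2f≐2g = mk λ j j<m → ℤ.*-cancelˡ-≡ (+ 2) (f j) (g j)
    (trans (double (f j)) (trans (trans (sym (⊞-coeff f f j)) (trans (coeff 2f≐2g j j<m) (⊞-coeff g g j)))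
      (sym (double (g j)))))
    where
    double : ∀ i → + 2 ℤ.* i ≡ i ℤ.+ i
    double = ℤ-Solver.solve-∀

  P₀ P₁ P₂ : PowerSeries
  P₀ = S 0ℤ * T 0ℤ
  P₁ = S 1ℤ * T 0ℤ
  P₂ = S 1ℤ * T 1ℤ

  c≐P₀+P₁+P₂ : c ≐ P₀ + P₁ + P₂ [ m ]
  c≐P₀+P₁+P₂ = halve (begin
    c + c
      ≈⟨ Σθ⊠Σψ≐c+c m (m ℕ.+ 2 ℕ.* N) (ℕ.≤-trans (ℕ.n≤1+n m) (ℕ.m≤m+n N _)) ⟨
    ΣZ (θ-term 1) (3 ℕ.* N) * ΣZ (ψ-term 1) (3 ℕ.* N)
      ≈⟨ *-cong (≈-trans (ΣZ-split (θ-term 1) N) (+-congˡ S₂≐S₁))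
                (≈-trans (ΣZ-split (ψ-term 1) N) (+-congˡ T₂≐T₀)) ⟩
    (S 0ℤ + S 1ℤ + S 1ℤ) * (T 0ℤ + T 1ℤ + T 0ℤ)
      ≈⟨ solve 4 (λ a b x y → (a :+ b :+ b) :* (x :+ y :+ x) :=
           (a :* x :+ b :* x :+ b :* y) :+ (a :* x :+ b :* x :+ b :* y)
             :+ (a :* y :+ (b :* x :+ b :* x))) ≈-refl _ _ _ _ ⟩
    (P₀ + P₁ + P₂) + (P₀ + P₁ + P₂) + (S 0ℤ * T 1ℤ + (P₁ + P₁))
      ≈⟨ ≈-trans (+-congˡ cancellation) (+-identityʳ _) ⟩
    (P₀ + P₁ + P₂) + (P₀ + P₁ + P₂) ∎)

  1*-type : ∀ {r} a → a % 3 ≡ r → HasType r (X^ (1 ℕ.* a))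
  1*-type {r} a a%3 = subst (λ n → HasType r (X^ n)) (sym (ℕ.*-identityˡ a)) (type-X^ a a%3)

  type-S : ∀ {r} i → (∀ k → square (+ 3 ℤ.* k ℤ.+ i) % 3 ≡ r) → HasType r (S i)
  type-S i sq = type-ΣZ _ (λ k j j≢ → trans
    (cong (λ w → χ (+ 3 ℤ.* k ℤ.+ i) ℤ.* w) (1*-type (square (+ 3 ℤ.* k ℤ.+ i)) (sq k) j j≢)) (ℤ.*-zeroʳ (χ (+ 3 ℤ.* k ℤ.+ i)))) N

  type-T : ∀ {r} i → (∀ k → tri (+ 3 ℤ.* k ℤ.+ i) % 3 ≡ r) → HasType r (T i)
  type-T i tr = type-ΣZ _ (λ k → 1*-type (tri (+ 3 ℤ.* k ℤ.+ i)) (tr k)) N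

  P₀-type : HasType 0 P₀
  P₀-type = type-⊠ (s≤s z≤n) (type-S 0ℤ square-3k%3) (type-T 0ℤ tri-3k%3)

  P₁-type : HasType 1 P₁
  P₁-type = type-⊠ (s≤s (s≤s z≤n)) (type-S 1ℤ square-3k+1%3) (type-T 0ℤ tri-3k%3)

  P₂-type : HasType 2 P₂
  P₂-type = type-⊠ (s≤s (s≤s (s≤s z≤n))) (type-S 1ℤ square-3k+1%3) (type-T 1ℤ tri-3k+1%3)

  component-by : ∀ {r₁ r₂} k f g h → HasType k f → HasType r₁ g → HasType r₂ h → k ≢ r₁ → k ≢ r₂ →
    c ≐ f + (g + h) [ m ] → component k ≐ f [ m ]
  component-by k f g h tf tg th k≢r₁ k≢r₂ = component-≐ k f (g + h) tf λ j j%3≡k →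
    trans (⊞-coeff g h j) (cong₂ ℤ._+_ (tg j (λ j≡ → k≢r₁ (trans (sym j%3≡k) j≡)))
      (th j (λ j≡ → k≢r₂ (trans (sym j%3≡k) j≡))))

  component₀ : component 0 ≐ P₀ [ m ]
  component₀ = component-by 0 P₀ P₁ P₂ P₀-type P₁-type P₂-type (λ ()) (λ ())
    (≈-trans c≐P₀+P₁+P₂ (+-assoc _ _ _))

  component₁ : component 1 ≐ P₁ [ m ]
  component₁ = component-by 1 P₁ P₀ P₂ P₁-type P₀-type P₂-type (λ ()) (λ ())
    (≈-trans c≐P₀+P₁+P₂ (≈-trans (+-congʳ (+-comm P₀ P₁)) (+-assoc _ _ _)))

  component₂ : component 2 ≐ P₂ [ m ]
  component₂ = component-by 2 P₂ P₀ P₁ P₂-type P₀-type P₁-type (λ ()) (λ ())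
    (≈-trans c≐P₀+P₁+P₂ (+-comm _ P₂))

  component-product : component 2 * component 0 ≐ - (component 1 * component 1 + component 1 * component 1) [ m ]
  component-product = begin
    component 2 * component 0
      ≈⟨ *-cong component₂ component₀ ⟩
    P₂ * P₀
      ≈⟨ solve 4 (λ a b x y → (b :* y) :* (a :* x) :=
           (a :* y :+ (b :* x :+ b :* x)) :* (b :* x) :- (b :* x :* (b :* x) :+ b :* x :* (b :* x)))
           ≈-refl _ _ _ _ ⟩
    (S 0ℤ * T 1ℤ + (P₁ + P₁)) * P₁ - (P₁ * P₁ + P₁ * P₁)
      ≈⟨ ≈-trans (+-congʳ (≈-trans (*-congʳ cancellation) (zeroˡ P₁))) (+-identityˡ _) ⟩
    - (P₁ * P₁ + P₁ * P₁)
      ≈⟨ -‿cong (+-cong (*-cong component₁ component₁) (*-cong component₁ component₁)) ⟨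
    - (component 1 * component 1 + component 1 * component 1) ∎

  S₀≐ : S 0ℤ ≐ ΣZ (θ-term 9) N [ m ]
  S₀≐ = ΣZ-cong (λ k → reflexive (cong₂ (λ a n → a · X^ n) (χ-3k k)
    (trans (ℕ.*-identityˡ (square (+ 3 ℤ.* k ℤ.+ 0ℤ))) (square-3k k)))) N

  T₁≐ : T 1ℤ ≐ X^ 1 * ΣZ (ψ-term 9) N [ m ]
  T₁≐ = ≈-trans (ΣZ-cong (λ k → ≈-trans (reflexive (cong X^_
      (trans (ℕ.*-identityˡ (tri (+ 3 ℤ.* k ℤ.+ 1ℤ))) (tri-3k+1 k)))) (X^-⊠ 1 (9 ℕ.* tri k))) N)
    (≈-sym (ΣZ-*ˡ (X^ 1) (ψ-term 9) N))

  component₁≐ : component 1 ≐ - (X^ 1 * (E[ 9 ] * E[ 18 ])) [ m ]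
  component₁≐ = ≈-trans component₁ (halve (begin
    P₁ + P₁
      ≈⟨ solve 2 (λ a p → p :+ p := (a :+ (p :+ p)) :- a) ≈-refl (S 0ℤ * T 1ℤ) P₁ ⟩
    (S 0ℤ * T 1ℤ + (P₁ + P₁)) - S 0ℤ * T 1ℤ
      ≈⟨ ≈-trans (+-congʳ cancellation) (+-identityˡ _) ⟩
    - (S 0ℤ * T 1ℤ)
      ≈⟨ -‿cong (*-cong S₀≐ T₁≐) ⟩
    - (ΣZ (θ-term 9) N * (X^ 1 * ΣZ (ψ-term 9) N))
      ≈⟨ solve 3 (λ a x b → :- (a :* (x :* b)) := :- (x :* (a :* b))) ≈-refl _ _ _ ⟩
    - (X^ 1 * (ΣZ (θ-term 9) N * ΣZ (ψ-term 9) N))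
      ≈⟨ -‿cong (*-congˡ (Σθ⊠Σψ≐EE² 8 m m (ℕ.n≤1+n m))) ⟩
    - (X^ 1 * (E[ 9 ] * E[ 18 ] + E[ 9 ] * E[ 18 ]))
      ≈⟨ solve 2 (λ x e → :- (x :* (e :+ e)) := (:- (x :* e)) :+ (:- (x :* e))) ≈-refl _ _ ⟩
    - (X^ 1 * (E[ 9 ] * E[ 18 ])) + - (X^ 1 * (E[ 9 ] * E[ 18 ])) ∎))

-- Rational arithmetic

ℚ-ring : Solver.AlmostCommutativeRing 0ℓ 0ℓ
ℚ-ring = Solver.fromCommutativeRing ℚ.+-*-commutativeRing λ x → dec⇒maybe (0ℚ ℚ.≟ x)

≤-by : ∀ {x y} z → 0ℚ ℚ.≤ z → x ℚ.+ z ≡ y → x ℚ.≤ y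
≤-by {x} z 0≤z refl = subst (ℚ._≤ x ℚ.+ z) (ℚ.+-identityʳ x) (ℚ.+-monoʳ-≤ x 0≤z)

0≤y-x : ∀ {x y} → x ℚ.≤ y → 0ℚ ℚ.≤ y ℚ.- x
0≤y-x {x} {y} x≤y = subst (ℚ._≤ y ℚ.- x) (ℚ.+-inverseʳ x) (ℚ.+-monoˡ-≤ (ℚ.- x) x≤y)

0≤+ : ∀ {x y} → 0ℚ ℚ.≤ x → 0ℚ ℚ.≤ y → 0ℚ ℚ.≤ x ℚ.+ y
0≤+ {x} {y} 0≤x 0≤y = subst (ℚ._≤ x ℚ.+ y) (ℚ.+-identityʳ 0ℚ) (ℚ.+-mono-≤ 0≤x 0≤y)

*-monoʳ : ∀ {x y} z → 0ℚ ℚ.≤ z → x ℚ.≤ y → x ℚ.* z ℚ.≤ y ℚ.* z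
*-monoʳ z 0≤z = ℚ.*-monoʳ-≤-nonNeg z {{ℚ.nonNegative 0≤z}}

*-monoˡ : ∀ {x y} z → 0ℚ ℚ.≤ z → x ℚ.≤ y → z ℚ.* x ℚ.≤ z ℚ.* y
*-monoˡ z 0≤z = ℚ.*-monoˡ-≤-nonNeg z {{ℚ.nonNegative 0≤z}}

0≤* : ∀ {x y} → 0ℚ ℚ.≤ x → 0ℚ ℚ.≤ y → 0ℚ ℚ.≤ x ℚ.* y
0≤* {x} {y} 0≤x 0≤y = subst (ℚ._≤ x ℚ.* y) (ℚ.*-zeroˡ y) (*-monoʳ y 0≤y 0≤x)

*-mono : ∀ {a b c d} → 0ℚ ℚ.≤ b → 0ℚ ℚ.≤ c → a ℚ.≤ b → c ℚ.≤ d → a ℚ.* c ℚ.≤ b ℚ.* d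
*-mono {b = b} {c} 0≤b 0≤c a≤b c≤d = ℚ.≤-trans (*-monoʳ c 0≤c a≤b) (*-monoˡ b 0≤b c≤d)

0≤1 : 0ℚ ℚ.≤ 1ℚ
0≤1 = ℚ.<⇒≤ (ℚ.positive⁻¹ 1ℚ)

0≤square : ∀ x → 0ℚ ℚ.≤ x ℚ.* x
0≤square x with ℚ.≤-total 0ℚ x
... | inj₁ 0≤x = 0≤* 0≤x 0≤x
... | inj₂ x≤0 = subst (0ℚ ℚ.≤_) (cancel x) (0≤* (ℚ.neg-antimono-≤ x≤0) (ℚ.neg-antimono-≤ x≤0))
  where
  cancel : ∀ x → (ℚ.- x) ℚ.* (ℚ.- x) ≡ x ℚ.* x
  cancel = solve-∀ ℚ-ring

square-cancel-≤ : ∀ x y → 0ℚ ℚ.≤ y → x ℚ.* x ℚ.≤ y ℚ.* y → x ℚ.≤ y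
square-cancel-≤ x y 0≤y xx≤yy = ℚ.≮⇒≥ λ y<x →
  let 0<x = ℚ.≤-<-trans 0≤y y<x in
  ℚ.<-irrefl refl (ℚ.<-≤-trans
    (ℚ.≤-<-trans (*-monoˡ y 0≤y (ℚ.<⇒≤ y<x)) (ℚ.*-monoˡ-<-pos x {{ℚ.positive 0<x}} y<x)) xx≤yy)

fromℤ-ℚ : ℤ → ℚ
fromℤ-ℚ k = k ℚ./ 1

toℚᵘ-fromℤ : ∀ k → ℚ.toℚᵘ (fromℤ-ℚ k) ℚᵘ.≃ ℚᵘ.mkℚᵘ k 0
toℚᵘ-fromℤ k = ℚ.toℚᵘ-fromℚᵘ (ℚᵘ.mkℚᵘ k 0)

fromℤ-+ : ∀ i j → fromℤ-ℚ (i ℤ.+ j) ≡ fromℤ-ℚ i ℚ.+ fromℤ-ℚ j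
fromℤ-+ i j = ℚ.toℚᵘ-injective (ℚᵘ.≃-trans (toℚᵘ-fromℤ (i ℤ.+ j)) (ℚᵘ.≃-sym
  (ℚᵘ.≃-trans (ℚ.toℚᵘ-homo-+ (fromℤ-ℚ i) (fromℤ-ℚ j))
  (ℚᵘ.≃-trans (ℚᵘ.+-cong (toℚᵘ-fromℤ i) (toℚᵘ-fromℤ j))
    (ℚᵘ.*≡* (cong (ℤ._* + 1) (cong₂ ℤ._+_ (ℤ.*-identityʳ i) (ℤ.*-identityʳ j))))))))

fromℤ-* : ∀ i j → fromℤ-ℚ (i ℤ.* j) ≡ fromℤ-ℚ i ℚ.* fromℤ-ℚ j
fromℤ-* i j = ℚ.toℚᵘ-injective (ℚᵘ.≃-trans (toℚᵘ-fromℤ (i ℤ.* j)) (ℚᵘ.≃-sym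
  (ℚᵘ.≃-trans (ℚ.toℚᵘ-homo-* (fromℤ-ℚ i) (fromℤ-ℚ j))
    (ℚᵘ.*-cong (toℚᵘ-fromℤ i) (toℚᵘ-fromℤ j)))))

fromℤ-neg : ∀ i → fromℤ-ℚ (ℤ.- i) ≡ ℚ.- fromℤ-ℚ i
fromℤ-neg i = ℚ.toℚᵘ-injective (ℚᵘ.≃-trans (toℚᵘ-fromℤ (ℤ.- i)) (ℚᵘ.≃-sym
  (ℚᵘ.≃-trans (ℚ.toℚᵘ-homo‿- (fromℤ-ℚ i)) (ℚᵘ.-‿cong (toℚᵘ-fromℤ i)))))

fromℤ-mono-≤ : ∀ {i j} → i ℤ.≤ j → fromℤ-ℚ i ℚ.≤ fromℤ-ℚ j
fromℤ-mono-≤ {i} {j} i≤j = ℚ.toℚᵘ-cancel-≤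
  (ℚᵘ.≤-respˡ-≃ (ℚᵘ.≃-sym (toℚᵘ-fromℤ i)) (ℚᵘ.≤-respʳ-≃ (ℚᵘ.≃-sym (toℚᵘ-fromℤ j))
    (ℚᵘ.*≤* (ℤ.*-monoʳ-≤-nonNeg (+ 1) i≤j))))

fromℕ : ℕ → ℚ
fromℕ n = fromℤ-ℚ (+ n)

0≤fromℕ : ∀ n → 0ℚ ℚ.≤ fromℕ n
0≤fromℕ n = fromℤ-mono-≤ {+ 0} {+ n} (ℤ.+≤+ z≤n)

fromℕ-suc : ∀ n → fromℕ (suc n) ≡ 1ℚ ℚ.+ fromℕ n
fromℕ-suc n = fromℤ-+ (+ 1) (+ n)

archimedean : ∀ q → ∃[ n ] q ℚ.≤ fromℕ n
archimedean q@(ℚ.mkℚ i d _) = ℤ.∣ i ∣ , ℚ.toℚᵘ-cancel-≤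
  (ℚᵘ.≤-respʳ-≃ (ℚᵘ.≃-sym (toℚᵘ-fromℤ (+ ℤ.∣ i ∣))) (ℚᵘ.*≤* (ℤ.≤-trans
    (ℤ.≤-reflexive (ℤ.*-identityʳ i)) (ℤ.≤-trans (i≤∣i∣ i)
      (ℤ.≤-trans (ℤ.+≤+ (ℕ.m≤m*n ℤ.∣ i ∣ (suc d))) (ℤ.≤-reflexive (ℤ.pos-* ℤ.∣ i ∣ (suc d))))))))
  where
  i≤∣i∣ : ∀ i → i ℤ.≤ + ℤ.∣ i ∣
  i≤∣i∣ (+ n)    = ℤ.≤-refl
  i≤∣i∣ -[1+ n ] = ℤ.-≤+

shrink : ∀ B ε → 0ℚ ℚ.≤ B → 0ℚ ℚ.< ε → ∃[ δ ] (0ℚ ℚ.< δ × B ℚ.* δ ℚ.≤ ε)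
shrink B ε 0≤B 0<ε = δ , 0<δ , ≤-by δ (ℚ.<⇒≤ 0<δ) (begin
  B ℚ.* δ ℚ.+ δ                    ≡⟨ factor B δ ⟩
  (B ℚ.+ 1ℚ) ℚ.* (ε ℚ.* D)         ≡⟨ regroup (B ℚ.+ 1ℚ) ε D ⟩
  ε ℚ.* ((B ℚ.+ 1ℚ) ℚ.* D)         ≡⟨ cong (ε ℚ.*_) (ℚ.*-inverseʳ (B ℚ.+ 1ℚ)) ⟩
  ε ℚ.* 1ℚ                         ≡⟨ ℚ.*-identityʳ ε ⟩
  ε                                ∎)
  where
  open ≡-Reasoning
  B+1>0 : ℚ.Positive (B ℚ.+ 1ℚ)
  B+1>0 = ℚ.nonNeg+pos⇒pos B {{ℚ.nonNegative 0≤B}} 1ℚ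
  instance
    B+1≢0 : ℚ.NonZero (B ℚ.+ 1ℚ)
    B+1≢0 = ℚ.pos⇒nonZero (B ℚ.+ 1ℚ) {{B+1>0}}
  D = ℚ.1/ (B ℚ.+ 1ℚ)
  δ = ε ℚ.* D
  0<δ : 0ℚ ℚ.< δ
  0<δ = ℚ.positive⁻¹ δ {{ℚ.pos*pos⇒pos ε {{ℚ.positive 0<ε}} D {{ℚ.1/pos⇒pos (B ℚ.+ 1ℚ) {{B+1>0}}}}}}
  factor : ∀ B δ → B ℚ.* δ ℚ.+ δ ≡ (B ℚ.+ 1ℚ) ℚ.* δ
  factor = solve-∀ ℚ-ring
  regroup : ∀ a b c → a ℚ.* (b ℚ.* c) ≡ b ℚ.* (a ℚ.* c)
  regroup = solve-∀ ℚ-ring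

infixr 8 _^ℚ_
_^ℚ_ : ℚ → ℕ → ℚ
r ^ℚ zero  = 1ℚ
r ^ℚ suc n = r ℚ.* r ^ℚ n

^ℚ-+ : ∀ r m n → r ^ℚ (m ℕ.+ n) ≡ r ^ℚ m ℚ.* r ^ℚ n
^ℚ-+ r zero    n = sym (ℚ.*-identityˡ (r ^ℚ n))
^ℚ-+ r (suc m) n = trans (cong (r ℚ.*_) (^ℚ-+ r m n)) (sym (ℚ.*-assoc r (r ^ℚ m) (r ^ℚ n)))

-- Gaussian rationals

record ℚ[i] : Set where
  constructor gauss
  field Re Im : ℚ
open ℚ[i] public

infixl 6 _+ᵍ_ _-ᵍ_
infixl 7 _*ᵍ_
infix  8 -ᵍ_

opaque
  _+ᵍ_ _*ᵍ_ : ℚ[i] → ℚ[i] → ℚ[i]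
  z +ᵍ w = gauss (Re z ℚ.+ Re w) (Im z ℚ.+ Im w)
  z *ᵍ w = gauss (Re z ℚ.* Re w ℚ.+ (ℚ.- (Im z ℚ.* Im w))) (Re z ℚ.* Im w ℚ.+ Im z ℚ.* Re w)

  -ᵍ_ : ℚ[i] → ℚ[i]
  -ᵍ z = gauss (ℚ.- Re z) (ℚ.- Im z)

_-ᵍ_ : ℚ[i] → ℚ[i] → ℚ[i]
z -ᵍ w = z +ᵍ -ᵍ w

embed : ℤ → ℚ[i]
embed k = gauss (fromℤ-ℚ k) 0ℚ

0ᵍ 1ᵍ : ℚ[i]
0ᵍ = embed 0ℤ
1ᵍ = embed 1ℤ

norm : ℚ[i] → ℚ
norm z = Re z ℚ.* Re z ℚ.+ Im z ℚ.* Im z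

opaque
  unfolding _+ᵍ_ _*ᵍ_ -ᵍ_

  gaussian-isCommutativeRing : IsCommutativeRing _≡_ _+ᵍ_ _*ᵍ_ -ᵍ_ 0ᵍ 1ᵍ
  gaussian-isCommutativeRing = record
    { isRing = record
      { +-isAbelianGroup = record
        { isGroup = record
          { isMonoid = record
            { isSemigroup = record
              { isMagma = record { isEquivalence = isEquivalence ; ∙-cong = cong₂ _+ᵍ_ }
              ; assoc = λ x y z → cong₂ gauss (ℚ.+-assoc (Re x) (Re y) (Re z)) (ℚ.+-assoc (Im x) (Im y) (Im z)) }
            ; identity = (λ x → cong₂ gauss (ℚ.+-identityˡ (Re x)) (ℚ.+-identityˡ (Im x)))
                       , (λ x → cong₂ gauss (ℚ.+-identityʳ (Re x)) (ℚ.+-identityʳ (Im x))) }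
          ; inverse = (λ x → cong₂ gauss (ℚ.+-inverseˡ (Re x)) (ℚ.+-inverseˡ (Im x)))
                    , (λ x → cong₂ gauss (ℚ.+-inverseʳ (Re x)) (ℚ.+-inverseʳ (Im x)))
          ; ⁻¹-cong = cong (λ z → -ᵍ z) }
        ; comm = λ x y → cong₂ gauss (ℚ.+-comm (Re x) (Re y)) (ℚ.+-comm (Im x) (Im y)) }
      ; *-cong = cong₂ _*ᵍ_
      ; *-assoc = λ x y z → cong₂ gauss
          (assoc-Re (Re x) (Im x) (Re y) (Im y) (Re z) (Im z))
          (assoc-Im (Re x) (Im x) (Re y) (Im y) (Re z) (Im z))
      ; *-identity = (λ x → cong₂ gauss (identityˡ-Re (Re x) (Im x)) (identityˡ-Im (Re x) (Im x)))
                   , (λ x → trans (*ᵍ-comm x 1ᵍ)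
                       (cong₂ gauss (identityˡ-Re (Re x) (Im x)) (identityˡ-Im (Re x) (Im x))))
      ; distrib = *ᵍ-distribˡ
                , (λ x y z → trans (*ᵍ-comm (y +ᵍ z) x)
                    (trans (*ᵍ-distribˡ x y z) (cong₂ _+ᵍ_ (*ᵍ-comm x y) (*ᵍ-comm x z)))) }
    ; *-comm = *ᵍ-comm }
    where
    isEquivalence : IsEquivalence {A = ℚ[i]} _≡_
    isEquivalence = record { refl = refl ; sym = sym ; trans = trans }
    assoc-Re : ∀ a b c d e f →
      (a ℚ.* c ℚ.+ (ℚ.- (b ℚ.* d))) ℚ.* e ℚ.+ (ℚ.- ((a ℚ.* d ℚ.+ b ℚ.* c) ℚ.* f))
      ≡ a ℚ.* (c ℚ.* e ℚ.+ (ℚ.- (d ℚ.* f))) ℚ.+ (ℚ.- (b ℚ.* (c ℚ.* f ℚ.+ d ℚ.* e)))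
    assoc-Re = solve-∀ ℚ-ring
    assoc-Im : ∀ a b c d e f →
      (a ℚ.* c ℚ.+ (ℚ.- (b ℚ.* d))) ℚ.* f ℚ.+ (a ℚ.* d ℚ.+ b ℚ.* c) ℚ.* e
      ≡ a ℚ.* (c ℚ.* f ℚ.+ d ℚ.* e) ℚ.+ b ℚ.* (c ℚ.* e ℚ.+ (ℚ.- (d ℚ.* f)))
    assoc-Im = solve-∀ ℚ-ring
    identityˡ-Re : ∀ a b → 1ℚ ℚ.* a ℚ.+ (ℚ.- (0ℚ ℚ.* b)) ≡ a
    identityˡ-Re = solve-∀ ℚ-ring
    identityˡ-Im : ∀ a b → 1ℚ ℚ.* b ℚ.+ 0ℚ ℚ.* a ≡ b
    identityˡ-Im = solve-∀ ℚ-ring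
    comm-Re : ∀ a b c d → a ℚ.* c ℚ.+ (ℚ.- (b ℚ.* d)) ≡ c ℚ.* a ℚ.+ (ℚ.- (d ℚ.* b))
    comm-Re = solve-∀ ℚ-ring
    comm-Im : ∀ a b c d → a ℚ.* d ℚ.+ b ℚ.* c ≡ c ℚ.* b ℚ.+ d ℚ.* a
    comm-Im = solve-∀ ℚ-ring
    *ᵍ-comm : ∀ x y → x *ᵍ y ≡ y *ᵍ x
    *ᵍ-comm x y = cong₂ gauss (comm-Re (Re x) (Im x) (Re y) (Im y)) (comm-Im (Re x) (Im x) (Re y) (Im y))
    distrib-Re : ∀ a b c d e f → a ℚ.* (c ℚ.+ e) ℚ.+ (ℚ.- (b ℚ.* (d ℚ.+ f)))
      ≡ (a ℚ.* c ℚ.+ (ℚ.- (b ℚ.* d))) ℚ.+ (a ℚ.* e ℚ.+ (ℚ.- (b ℚ.* f)))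
    distrib-Re = solve-∀ ℚ-ring
    distrib-Im : ∀ a b c d e f → a ℚ.* (d ℚ.+ f) ℚ.+ b ℚ.* (c ℚ.+ e)
      ≡ (a ℚ.* d ℚ.+ b ℚ.* c) ℚ.+ (a ℚ.* f ℚ.+ b ℚ.* e)
    distrib-Im = solve-∀ ℚ-ring
    *ᵍ-distribˡ : ∀ x y z → x *ᵍ (y +ᵍ z) ≡ x *ᵍ y +ᵍ x *ᵍ z
    *ᵍ-distribˡ x y z = cong₂ gauss (distrib-Re (Re x) (Im x) (Re y) (Im y) (Re z) (Im z))
      (distrib-Im (Re x) (Im x) (Re y) (Im y) (Re z) (Im z))

  embed-+ : ∀ i j → embed (i ℤ.+ j) ≡ embed i +ᵍ embed j
  embed-+ i j = cong₂ gauss (fromℤ-+ i j) (sym (ℚ.+-identityʳ 0ℚ))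

  embed-neg : ∀ i → embed (ℤ.- i) ≡ -ᵍ embed i
  embed-neg i = cong₂ gauss (fromℤ-neg i) refl

  embed-* : ∀ i j → embed (i ℤ.* j) ≡ embed i *ᵍ embed j
  embed-* i j = cong₂ gauss (trans (fromℤ-* i j) (pad (fromℤ-ℚ i ℚ.* fromℤ-ℚ j)))
    (vanish (fromℤ-ℚ i) (fromℤ-ℚ j))
    where
    pad : ∀ a → a ≡ a ℚ.+ (ℚ.- (0ℚ ℚ.* 0ℚ))
    pad = solve-∀ ℚ-ring
    vanish : ∀ a b → 0ℚ ≡ a ℚ.* 0ℚ ℚ.+ 0ℚ ℚ.* b
    vanish = solve-∀ ℚ-ring

  norm-* : ∀ z w → norm (z *ᵍ w) ≡ norm z ℚ.* norm w
  norm-* z w = multiplicative (Re z) (Im z) (Re w) (Im w)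
    where
    multiplicative : ∀ a b c d →
      (a ℚ.* c ℚ.+ (ℚ.- (b ℚ.* d))) ℚ.* (a ℚ.* c ℚ.+ (ℚ.- (b ℚ.* d)))
        ℚ.+ (a ℚ.* d ℚ.+ b ℚ.* c) ℚ.* (a ℚ.* d ℚ.+ b ℚ.* c)
      ≡ (a ℚ.* a ℚ.+ b ℚ.* b) ℚ.* (c ℚ.* c ℚ.+ d ℚ.* d)
    multiplicative = solve-∀ ℚ-ring

  norm-neg : ∀ z → norm (-ᵍ z) ≡ norm z
  norm-neg z = even (Re z) (Im z)
    where
    even : ∀ a b → (ℚ.- a) ℚ.* (ℚ.- a) ℚ.+ (ℚ.- b) ℚ.* (ℚ.- b) ≡ a ℚ.* a ℚ.+ b ℚ.* b
    even = solve-∀ ℚ-ring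

  norm-+ : ∀ z w → norm (z +ᵍ w) ≡
    norm z ℚ.+ norm w ℚ.+ fromℤ-ℚ (+ 2) ℚ.* (Re z ℚ.* Re w ℚ.+ Im z ℚ.* Im w)
  norm-+ z w = expand (Re z) (Im z) (Re w) (Im w)
    where
    expand : ∀ a b c d → (a ℚ.+ c) ℚ.* (a ℚ.+ c) ℚ.+ (b ℚ.+ d) ℚ.* (b ℚ.+ d)
      ≡ (a ℚ.* a ℚ.+ b ℚ.* b) ℚ.+ (c ℚ.* c ℚ.+ d ℚ.* d) ℚ.+ (1ℚ ℚ.+ 1ℚ) ℚ.* (a ℚ.* c ℚ.+ b ℚ.* d)
    expand = solve-∀ ℚ-ring

  Re-minus : ∀ z w → Re (z -ᵍ w) ≡ Re z ℚ.- Re w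
  Re-minus z w = refl

  Im-minus : ∀ z w → Im (z -ᵍ w) ≡ Im z ℚ.- Im w
  Im-minus z w = refl

gaussian : CommutativeRing 0ℓ 0ℓ
gaussian = record { isCommutativeRing = gaussian-isCommutativeRing }

-- z ⊴ b means |z| ≤ b.
infix 4 _⊴_
record _⊴_ (z : ℚ[i]) (b : ℚ) : Set where
  constructor bound
  field
    0≤b    : 0ℚ ℚ.≤ b
    norm≤  : norm z ℚ.≤ b ℚ.* b
open _⊴_

0≤norm : ∀ z → 0ℚ ℚ.≤ norm z
0≤norm z = 0≤+ (0≤square (Re z)) (0≤square (Im z))

⊴-mono : ∀ {z a b} → a ℚ.≤ b → z ⊴ a → z ⊴ b
⊴-mono {z} {a} {b} a≤b (bound 0≤a n) = bound 0≤b′ (ℚ.≤-trans n (*-mono 0≤b′ 0≤a a≤b a≤b))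
  where 0≤b′ = ℚ.≤-trans 0≤a a≤b

⊴-* : ∀ {z w a b} → z ⊴ a → w ⊴ b → z *ᵍ w ⊴ a ℚ.* b
⊴-* {z} {w} {a} {b} (bound 0≤a m) (bound 0≤b′ n) = bound (0≤* 0≤a 0≤b′)
  (subst (ℚ._≤ a ℚ.* b ℚ.* (a ℚ.* b)) (sym (norm-* z w))
    (subst (norm z ℚ.* norm w ℚ.≤_) (regroup a b) (*-mono (0≤* 0≤a 0≤a) (0≤norm w) m n)))
  where
  regroup : ∀ a b → a ℚ.* a ℚ.* (b ℚ.* b) ≡ a ℚ.* b ℚ.* (a ℚ.* b)
  regroup = solve-∀ ℚ-ring

⊴-neg : ∀ {z a} → z ⊴ a → -ᵍ z ⊴ a
⊴-neg {z} {a} (bound 0≤a n) = bound 0≤a (subst (ℚ._≤ a ℚ.* a) (sym (norm-neg z)) n)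

⊴-+ : ∀ {z w a b} → z ⊴ a → w ⊴ b → z +ᵍ w ⊴ a ℚ.+ b
⊴-+ {z} {w} {a} {b} (bound 0≤a m) (bound 0≤b′ n) = bound (0≤+ 0≤a 0≤b′)
  (subst₂ ℚ._≤_ (sym (norm-+ z w)) (expand a b)
    (ℚ.+-mono-≤ (ℚ.+-mono-≤ m n) (*-monoˡ (fromℤ-ℚ (+ 2)) (0≤fromℕ 2) dot≤)))
  where
  dot = Re z ℚ.* Re w ℚ.+ Im z ℚ.* Im w
  det = Re z ℚ.* Im w ℚ.- Im z ℚ.* Re w
  expand : ∀ a b → a ℚ.* a ℚ.+ b ℚ.* b ℚ.+ (1ℚ ℚ.+ 1ℚ) ℚ.* (a ℚ.* b) ≡ (a ℚ.+ b) ℚ.* (a ℚ.+ b)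
  expand = solve-∀ ℚ-ring
  lagrange : ∀ a b c d → (a ℚ.* c ℚ.+ b ℚ.* d) ℚ.* (a ℚ.* c ℚ.+ b ℚ.* d)
      ℚ.+ (a ℚ.* d ℚ.- b ℚ.* c) ℚ.* (a ℚ.* d ℚ.- b ℚ.* c)
    ≡ (a ℚ.* a ℚ.+ b ℚ.* b) ℚ.* (c ℚ.* c ℚ.+ d ℚ.* d)
  lagrange = solve-∀ ℚ-ring
  regroup : ∀ a b → a ℚ.* a ℚ.* (b ℚ.* b) ≡ a ℚ.* b ℚ.* (a ℚ.* b)
  regroup = solve-∀ ℚ-ring
  dot≤ : dot ℚ.≤ a ℚ.* b
  dot≤ = square-cancel-≤ dot (a ℚ.* b) (0≤* 0≤a 0≤b′)
    (ℚ.≤-trans (≤-by (det ℚ.* det) (0≤square det) (lagrange (Re z) (Im z) (Re w) (Im w)))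
      (subst (norm z ℚ.* norm w ℚ.≤_) (regroup a b) (*-mono (0≤* 0≤a 0≤a) (0≤norm w) m n)))

⊴-embed : ∀ k → embed k ⊴ fromℕ ℤ.∣ k ∣
⊴-embed k = bound (0≤fromℕ ℤ.∣ k ∣) (ℚ.≤-reflexive (begin
  fromℤ-ℚ k ℚ.* fromℤ-ℚ k ℚ.+ 0ℚ ℚ.* 0ℚ       ≡⟨ drop (fromℤ-ℚ k) ⟩
  fromℤ-ℚ k ℚ.* fromℤ-ℚ k                     ≡⟨ fromℤ-* k k ⟨
  fromℤ-ℚ (k ℤ.* k)                           ≡⟨ cong fromℤ-ℚ (trans (sym (square-ℤ k)) (ℤ.pos-* ℤ.∣ k ∣ ℤ.∣ k ∣)) ⟩
  fromℤ-ℚ (+ ℤ.∣ k ∣ ℤ.* + ℤ.∣ k ∣)           ≡⟨ fromℤ-* (+ ℤ.∣ k ∣) (+ ℤ.∣ k ∣) ⟩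
  fromℕ ℤ.∣ k ∣ ℚ.* fromℕ ℤ.∣ k ∣             ∎))
  where
  open ≡-Reasoning
  drop : ∀ a → a ℚ.* a ℚ.+ 0ℚ ℚ.* 0ℚ ≡ a ℚ.* a
  drop = solve-∀ ℚ-ring

⊴-0 : ∀ {b} → 0ℚ ℚ.≤ b → 0ᵍ ⊴ b
⊴-0 0≤b′ = ⊴-mono 0≤b′ (⊴-embed 0ℤ)

abs≤ : ∀ x b → 0ℚ ℚ.≤ b → x ℚ.* x ℚ.≤ b ℚ.* b → ℚ.∣ x ∣ ℚ.≤ b
abs≤ x b 0≤b′ xx≤bb = square-cancel-≤ ℚ.∣ x ∣ b 0≤b′
  (subst (ℚ._≤ b ℚ.* b) (trans (sym (ℚ.0≤p⇒∣p∣≡p (0≤square x))) (ℚ.∣p*q∣≡∣p∣*∣q∣ x x)) xx≤bb)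

⊴⇒∣Re∣≤ : ∀ {z b} → z ⊴ b → ℚ.∣ Re z ∣ ℚ.≤ b
⊴⇒∣Re∣≤ {z} {b} (bound 0≤b′ n) = abs≤ (Re z) b 0≤b′
  (ℚ.≤-trans (≤-by (Im z ℚ.* Im z) (0≤square (Im z)) refl) n)

⊴⇒∣Im∣≤ : ∀ {z b} → z ⊴ b → ℚ.∣ Im z ∣ ℚ.≤ b
⊴⇒∣Im∣≤ {z} {b} (bound 0≤b′ n) = abs≤ (Im z) b 0≤b′
  (ℚ.≤-trans (≤-by (Re z ℚ.* Re z) (0≤square (Re z))
    (ℚ.+-comm (Im z ℚ.* Im z) (Re z ℚ.* Re z))) n)

-- Evaluation of power series at Gaussian rationals

module G = CommutativeRing gaussian
module G-Solver = IntegerCoefficients gaussian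
open G-Solver using (solve; con; _:=_; _:+_; _:*_; _:-_; :-_)

infixr 9 _↑_
_↑_ : ℚ[i] → ℕ → ℚ[i]
z ↑ zero  = 1ᵍ
z ↑ suc n = z *ᵍ z ↑ n

eval : PowerSeries → ℚ[i] → ℕ → ℚ[i]
eval f z = fold _+ᵍ_ 0ᵍ λ j → embed (f j) *ᵍ z ↑ j

eval-front : ∀ f z N → eval f z (suc N) ≡ embed (f 0) +ᵍ z *ᵍ eval (tail f) z N
eval-front f z zero    = solve 2 (λ a z → con 0ℤ :+ a :* con 1ℤ := a :+ z :* con 0ℤ) refl (embed (f 0)) z
eval-front f z (suc N) = trans (cong (_+ᵍ embed (f (suc N)) *ᵍ (z *ᵍ z ↑ N)) (eval-front f z N))
  (solve 5 (λ a z e b p → (a :+ z :* e) :+ b :* (z :* p) := a :+ z :* (e :+ b :* p))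
    refl (embed (f 0)) z (eval (tail f) z N) (embed (f (suc N))) (z ↑ N))

eval-cong : ∀ {f g} z N → (∀ j → j ℕ.< N → f j ≡ g j) → eval f z N ≡ eval g z N
eval-cong z zero    f≡g = refl
eval-cong z (suc N) f≡g = cong₂ _+ᵍ_ (eval-cong z N λ j j<N → f≡g j (ℕ.m≤n⇒m≤1+n j<N))
  (cong (λ k → embed k *ᵍ z ↑ N) (f≡g N ℕ.≤-refl))

eval-⊕ : ∀ f g z N → eval (f ⊕ g) z N ≡ eval f z N +ᵍ eval g z N
eval-⊕ f g z zero    = sym (G.+-identityˡ 0ᵍ)
eval-⊕ f g z (suc N) = trans (cong₂ _+ᵍ_ (eval-⊕ f g z N) (cong (_*ᵍ z ↑ N) (embed-+ (f N) (g N))))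
  (solve 5 (λ x y a b p → (x :+ y) :+ (a :+ b) :* p := (x :+ a :* p) :+ (y :+ b :* p))
    refl (eval f z N) (eval g z N) (embed (f N)) (embed (g N)) (z ↑ N))

eval-⊝ : ∀ f z N → eval (⊝ f) z N ≡ -ᵍ eval f z N
eval-⊝ f z zero    = solve 0 (con 0ℤ := :- con 0ℤ) refl
eval-⊝ f z (suc N) = trans (cong₂ _+ᵍ_ (eval-⊝ f z N) (cong (_*ᵍ z ↑ N) (embed-neg (f N))))
  (solve 3 (λ x a p → :- x :+ (:- a) :* p := :- (x :+ a :* p)) refl (eval f z N) (embed (f N)) (z ↑ N))

eval-· : ∀ k f z N → eval (k · f) z N ≡ embed k *ᵍ eval f z N
eval-· k f z zero    = solve 1 (λ k → con 0ℤ := k :* con 0ℤ) refl (embed k)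
eval-· k f z (suc N) = trans (cong₂ _+ᵍ_ (eval-· k f z N) (cong (_*ᵍ z ↑ N) (embed-* k (f N))))
  (solve 4 (λ k x a p → k :* x :+ k :* a :* p := k :* (x :+ a :* p))
    refl (embed k) (eval f z N) (embed (f N)) (z ↑ N))

eval-X^ : ∀ a z N → a ℕ.< N → eval (X^ a) z N ≡ z ↑ a
eval-X^ zero    z (suc N) _         = trans (eval-front (X^ 0) z N)
  (trans (cong (λ w → 1ᵍ +ᵍ z *ᵍ w) (eval-𝟘 N))
    (solve 1 (λ z → con 1ℤ :+ z :* con 0ℤ := con 1ℤ) refl z))
  where
  eval-𝟘 : ∀ N → eval 𝟘 z N ≡ 0ᵍ
  eval-𝟘 zero    = refl
  eval-𝟘 (suc N) = trans (cong (_+ᵍ 0ᵍ *ᵍ z ↑ N) (eval-𝟘 N))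
    (solve 1 (λ p → con 0ℤ :+ con 0ℤ :* p := con 0ℤ) refl (z ↑ N))
eval-X^ (suc a) z (suc N) (s≤s a<N) = trans (eval-front (X^ suc a) z N)
  (trans (G.+-identityˡ (z *ᵍ eval (X^ a) z N)) (cong (z *ᵍ_) (eval-X^ a z N a<N)))

opaque
  size : ℤ → ℚ
  size k = fromℕ ℤ.∣ k ∣

  0≤size : ∀ k → 0ℚ ℚ.≤ size k
  0≤size k = 0≤fromℕ ℤ.∣ k ∣

  size-+ : ∀ i j → size (i ℤ.+ j) ℚ.≤ size i ℚ.+ size j
  size-+ i j = ℚ.≤-trans (fromℤ-mono-≤ (ℤ.+≤+ (ℤ.∣i+j∣≤∣i∣+∣j∣ i j)))
    (ℚ.≤-reflexive (fromℤ-+ (+ ℤ.∣ i ∣) (+ ℤ.∣ j ∣)))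

  size-* : ∀ i j → size (i ℤ.* j) ≡ size i ℚ.* size j
  size-* i j = trans (cong fromℕ (ℤ.∣i*j∣≡∣i∣*∣j∣ i j))
    (trans (cong fromℤ-ℚ (ℤ.pos-* ℤ.∣ i ∣ ℤ.∣ j ∣)) (fromℤ-* (+ ℤ.∣ i ∣) (+ ℤ.∣ j ∣)))

  size-neg : ∀ i → size (ℤ.- i) ≡ size i
  size-neg i = cong fromℕ (ℤ.∣-i∣≡∣i∣ i)

  size-0 : size 0ℤ ≡ 0ℚ
  size-0 = refl

  size-1 : size 1ℤ ≡ 1ℚ
  size-1 = refl

  embed-bound : ∀ k → embed k ⊴ size k
  embed-bound = ⊴-embed

module Weighted (r : ℚ) (0≤r : 0ℚ ℚ.≤ r) (r<1 : r ℚ.< 1ℚ) where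

  r≤1 : r ℚ.≤ 1ℚ
  r≤1 = ℚ.<⇒≤ r<1

  0≤r^ : ∀ n → 0ℚ ℚ.≤ r ^ℚ n
  0≤r^ zero    = 0≤1
  0≤r^ (suc n) = 0≤* 0≤r (0≤r^ n)

  r^≤1 : ∀ n → r ^ℚ n ℚ.≤ 1ℚ
  r^≤1 zero    = ℚ.≤-refl
  r^≤1 (suc n) = *-mono {r} {1ℚ} {r ^ℚ n} {1ℚ} 0≤1 (0≤r^ n) r≤1 (r^≤1 n)

  r^-antitone : ∀ m n → r ^ℚ (m ℕ.+ n) ℚ.≤ r ^ℚ n
  r^-antitone m n = subst₂ ℚ._≤_ (sym (^ℚ-+ r m n)) (ℚ.*-identityˡ (r ^ℚ n))
    (*-monoʳ (r ^ℚ n) (0≤r^ n) (r^≤1 m))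

  -- Partial sums of the norm Σ |fⱼ| rʲ.
  mass : PowerSeries → ℕ → ℚ
  mass f = fold ℚ._+_ 0ℚ λ j → size (f j) ℚ.* r ^ℚ j

  0≤term : ∀ (f : PowerSeries) j → 0ℚ ℚ.≤ size (f j) ℚ.* r ^ℚ j
  0≤term f j = 0≤* (0≤size (f j)) (0≤r^ j)

  0≤mass : ∀ f N → 0ℚ ℚ.≤ mass f N
  0≤mass f zero    = ℚ.≤-refl
  0≤mass f (suc N) = 0≤+ (0≤mass f N) (0≤term f N)

  mass-suc : ∀ f N → mass f N ℚ.≤ mass f (suc N)
  mass-suc f N = ≤-by (size (f N) ℚ.* r ^ℚ N) (0≤term f N) refl

  mass-front : ∀ f N → mass f (suc N) ≡ size (f 0) ℚ.+ r ℚ.* mass (tail f) N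
  mass-front f zero    = base (size (f 0)) r
    where
    base : ∀ a r → 0ℚ ℚ.+ a ℚ.* 1ℚ ≡ a ℚ.+ r ℚ.* 0ℚ
    base = solve-∀ ℚ-ring
  mass-front f (suc N) = trans (cong (ℚ._+ size (f (suc N)) ℚ.* (r ℚ.* r ^ℚ N)) (mass-front f N))
    (step (size (f 0)) r (mass (tail f) N) (size (f (suc N))) (r ^ℚ N))
    where
    step : ∀ a r e b p → (a ℚ.+ r ℚ.* e) ℚ.+ b ℚ.* (r ℚ.* p) ≡ a ℚ.+ r ℚ.* (e ℚ.+ b ℚ.* p)
    step = solve-∀ ℚ-ring

  mass-mono : ∀ f g N → (∀ j → j ℕ.< N → size (f j) ℚ.≤ size (g j)) → mass f N ℚ.≤ mass g N
  mass-mono f g zero    f≤g = ℚ.≤-refl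
  mass-mono f g (suc N) f≤g = ℚ.+-mono-≤ (mass-mono f g N λ j j<N → f≤g j (ℕ.m≤n⇒m≤1+n j<N))
    (*-monoʳ (r ^ℚ N) (0≤r^ N) (f≤g N ℕ.≤-refl))

  mass-⊕ : ∀ f g N → mass (f ⊕ g) N ℚ.≤ mass f N ℚ.+ mass g N
  mass-⊕ f g zero    = ℚ.≤-refl
  mass-⊕ f g (suc N) = ℚ.≤-trans
    (ℚ.+-mono-≤ (mass-⊕ f g N) (*-monoʳ (r ^ℚ N) (0≤r^ N) (size-+ (f N) (g N))))
    (ℚ.≤-reflexive (regroup (mass f N) (mass g N) (size (f N)) (size (g N)) (r ^ℚ N)))
    where
    regroup : ∀ x y a b p → (x ℚ.+ y) ℚ.+ (a ℚ.+ b) ℚ.* p ≡ (x ℚ.+ a ℚ.* p) ℚ.+ (y ℚ.+ b ℚ.* p)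
    regroup = solve-∀ ℚ-ring

  mass-⊖ : ∀ f g N → mass (f ⊖ g) N ℚ.≤ mass f N ℚ.+ mass g N
  mass-⊖ f g N = ℚ.≤-trans (mass-⊕ f (⊝ g) N) (ℚ.+-monoʳ-≤ (mass f N)
    (mass-mono (⊝ g) g N λ j _ → ℚ.≤-reflexive (size-neg (g j))))

  mass-· : ∀ k f N → mass (k · f) N ≡ size k ℚ.* mass f N
  mass-· k f zero    = sym (ℚ.*-zeroʳ (size k))
  mass-· k f (suc N) = trans
    (cong₂ ℚ._+_ (mass-· k f N) (cong (ℚ._* r ^ℚ N) (size-* k (f N))))
    (factor (size k) (mass f N) (size (f N)) (r ^ℚ N))
    where
    factor : ∀ k x a p → k ℚ.* x ℚ.+ k ℚ.* a ℚ.* p ≡ k ℚ.* (x ℚ.+ a ℚ.* p)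
    factor = solve-∀ ℚ-ring

  mass-X^ : ∀ a N → mass (X^ a) N ℚ.≤ r ^ℚ a
  mass-X^ a       zero    = 0≤r^ a
  mass-X^ zero    (suc N) = ℚ.≤-reflexive (trans (mass-front (X^ 0) N)
    (trans (cong₂ (λ s w → s ℚ.+ r ℚ.* w) size-1 (mass-𝟘 N)) (drop r)))
    where
    drop : ∀ r → 1ℚ ℚ.+ r ℚ.* 0ℚ ≡ 1ℚ
    drop = solve-∀ ℚ-ring
    mass-𝟘 : ∀ N → mass 𝟘 N ≡ 0ℚ
    mass-𝟘 zero    = refl
    mass-𝟘 (suc N) = trans (cong₂ (λ m s → m ℚ.+ s ℚ.* r ^ℚ N) (mass-𝟘 N) size-0)
      (trans (ℚ.+-identityˡ (0ℚ ℚ.* r ^ℚ N)) (ℚ.*-zeroˡ (r ^ℚ N)))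
  mass-X^ (suc a) (suc N) = ℚ.≤-trans (ℚ.≤-reflexive (trans (mass-front (X^ suc a) N)
    (trans (cong (ℚ._+ r ℚ.* mass (X^ a) N) size-0) (ℚ.+-identityˡ (r ℚ.* mass (X^ a) N))))) (*-monoˡ r 0≤r (mass-X^ a N))

  mass-⊛ : ∀ f g N → mass (f ⊛ g) N ℚ.≤ mass f N ℚ.* mass g N
  mass-⊛ f g zero    = ℚ.≤-refl
  mass-⊛ f g (suc N) = begin
    mass (f ⊛ g) (suc N)
      ≡⟨ mass-front (f ⊛ g) N ⟩
    size ((f ⊛ g) 0) ℚ.+ r ℚ.* mass (tail (f ⊛ g)) N
      ≤⟨ ℚ.+-mono-≤ (ℚ.≤-reflexive (trans (cong size (⊛-zero f g)) (size-* (f 0) (g 0))))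
           (*-monoˡ r 0≤r tail≤) ⟩
    s ℚ.* t ℚ.+ r ℚ.* (s ℚ.* τ ℚ.+ σ ℚ.* mass g N)
      ≤⟨ ℚ.+-monoʳ-≤ (s ℚ.* t) (*-monoˡ r 0≤r (ℚ.+-monoʳ-≤ (s ℚ.* τ)
           (*-monoˡ σ (0≤mass (tail f) N) (mass-suc g N)))) ⟩
    s ℚ.* t ℚ.+ r ℚ.* (s ℚ.* τ ℚ.+ σ ℚ.* mass g (suc N))
      ≡⟨ cong (λ w → s ℚ.* t ℚ.+ r ℚ.* (s ℚ.* τ ℚ.+ σ ℚ.* w)) (mass-front g N) ⟩
    s ℚ.* t ℚ.+ r ℚ.* (s ℚ.* τ ℚ.+ σ ℚ.* (t ℚ.+ r ℚ.* τ))
      ≡⟨ factor s t r σ τ ⟩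
    (s ℚ.+ r ℚ.* σ) ℚ.* (t ℚ.+ r ℚ.* τ)
      ≡⟨ cong₂ ℚ._*_ (mass-front f N) (mass-front g N) ⟨
    mass f (suc N) ℚ.* mass g (suc N) ∎
    where
    open ℚ.≤-Reasoning
    s = size (f 0)
    t = size (g 0)
    σ = mass (tail f) N
    τ = mass (tail g) N
    factor : ∀ s t r σ τ → s ℚ.* t ℚ.+ r ℚ.* (s ℚ.* τ ℚ.+ σ ℚ.* (t ℚ.+ r ℚ.* τ))
      ≡ (s ℚ.+ r ℚ.* σ) ℚ.* (t ℚ.+ r ℚ.* τ)
    factor = solve-∀ ℚ-ring
    tail≤ : mass (tail (f ⊛ g)) N ℚ.≤ s ℚ.* τ ℚ.+ σ ℚ.* mass g N
    tail≤ = begin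
      mass (tail (f ⊛ g)) N
        ≤⟨ mass-mono (tail (f ⊛ g)) (f 0 · tail g ⊕ tail f ⊛ g) N
             (λ j _ → ℚ.≤-reflexive (cong size (⊛-suc f g j))) ⟩
      mass (f 0 · tail g ⊕ tail f ⊛ g) N
        ≤⟨ mass-⊕ (f 0 · tail g) (tail f ⊛ g) N ⟩
      mass (f 0 · tail g) N ℚ.+ mass (tail f ⊛ g) N
        ≤⟨ ℚ.+-mono-≤ (ℚ.≤-reflexive (mass-· (f 0) (tail g) N)) (mass-⊛ (tail f) g N) ⟩
      s ℚ.* τ ℚ.+ σ ℚ.* mass g N ∎

  module _ {z : ℚ[i]} (z⊴rr : z ⊴ r ℚ.* r) where

    ↑-bound : ∀ n → z ↑ n ⊴ r ^ℚ n ℚ.* r ^ℚ n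
    ↑-bound zero    = ⊴-embed 1ℤ
    ↑-bound (suc n) = subst (z ↑ suc n ⊴_) (regroup r (r ^ℚ n)) (⊴-* z⊴rr (↑-bound n))
      where
      regroup : ∀ r p → r ℚ.* r ℚ.* (p ℚ.* p) ≡ r ℚ.* p ℚ.* (r ℚ.* p)
      regroup = solve-∀ ℚ-ring

    term-bound : ∀ (f : PowerSeries) j → embed (f j) *ᵍ z ↑ j ⊴ size (f j) ℚ.* (r ^ℚ j ℚ.* r ^ℚ j)
    term-bound f j = ⊴-* (embed-bound (f j)) (↑-bound j)

    eval-bound : ∀ f N → eval f z N ⊴ mass f N
    eval-bound f zero    = ⊴-embed 0ℤ
    eval-bound f (suc N) = ⊴-+ (eval-bound f N) (⊴-mono
      (*-monoˡ (size (f N)) (0≤size (f N))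
        (subst (r ^ℚ N ℚ.* r ^ℚ N ℚ.≤_) (ℚ.*-identityʳ (r ^ℚ N)) (*-monoˡ (r ^ℚ N) (0≤r^ N) (r^≤1 N))))
      (term-bound f N))

    eval-tail : ∀ f N k → eval f z (k ℕ.+ N) -ᵍ eval f z N ⊴ r ^ℚ N ℚ.* (mass f (k ℕ.+ N) ℚ.- mass f N)
    eval-tail f N zero    = subst₂ _⊴_ (sym (G.-‿inverseʳ (eval f z N))) (sym (vanish (r ^ℚ N) (mass f N))) (⊴-embed 0ℤ)
      where
      vanish : ∀ p m → p ℚ.* (m ℚ.- m) ≡ 0ℚ
      vanish = solve-∀ ℚ-ring
    eval-tail f N (suc k) = subst₂ _⊴_
      (solve 3 (λ x y t → (x :- y) :+ t := (x :+ t) :- y) refl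
        (eval f z (k ℕ.+ N)) (eval f z N) (embed (f (k ℕ.+ N)) *ᵍ z ↑ (k ℕ.+ N)))
      (regroup (r ^ℚ N) (mass f (k ℕ.+ N)) (mass f N) (size (f (k ℕ.+ N))) (r ^ℚ (k ℕ.+ N)))
      (⊴-+ (eval-tail f N k) (⊴-mono
        (*-monoˡ (size (f (k ℕ.+ N))) (0≤size (f (k ℕ.+ N)))
          (*-monoʳ (r ^ℚ (k ℕ.+ N)) (0≤r^ (k ℕ.+ N)) (r^-antitone k N)))
        (term-bound f (k ℕ.+ N))))
      where
      regroup : ∀ p m m₀ s q → p ℚ.* (m ℚ.- m₀) ℚ.+ s ℚ.* (p ℚ.* q) ≡ p ℚ.* ((m ℚ.+ s ℚ.* q) ℚ.- m₀)
      regroup = solve-∀ ℚ-ring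

    eval-tail-≤ : ∀ f B → (∀ n → mass f n ℚ.≤ B) → ∀ N n → N ℕ.≤ n →
      eval f z n -ᵍ eval f z N ⊴ B ℚ.* r ^ℚ N
    eval-tail-≤ f B f≤B N n N≤n = ⊴-mono
      (ℚ.≤-trans (*-monoˡ (r ^ℚ N) (0≤r^ N) (ℚ.≤-trans (≤-by (mass f N) (0≤mass f N) (cancel (mass f n) (mass f N))) (f≤B n)))
        (ℚ.≤-reflexive (ℚ.*-comm (r ^ℚ N) B)))
      (subst (λ m → eval f z m -ᵍ eval f z N ⊴ r ^ℚ N ℚ.* (mass f m ℚ.- mass f N)) (ℕ.m∸n+n≡m N≤n)
        (eval-tail f N (n ℕ.∸ N)))
      where
      cancel : ∀ a b → a ℚ.- b ℚ.+ b ≡ a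
      cancel = solve-∀ ℚ-ring

    eval-agree : ∀ f g B → (∀ n → mass f n ℚ.≤ B) → (∀ n → mass g n ℚ.≤ B) → ∀ N → f ≐ g [ N ] →
      ∀ n → N ℕ.≤ n → eval f z n -ᵍ eval g z n ⊴ (B ℚ.+ B) ℚ.* r ^ℚ N
    eval-agree f g B f≤B g≤B N f≐g n N≤n = subst₂ _⊴_
      (trans (cong (λ w → (eval f z n -ᵍ eval f z N) +ᵍ -ᵍ (eval g z n -ᵍ w)) (sym (eval-cong z N (coeff f≐g))))
        (solve 3 (λ x y c → (x :- c) :+ :- (y :- c) := x :- y) refl (eval f z n) (eval g z n) (eval f z N)))
      (sym (ℚ.*-distribʳ-+ (r ^ℚ N) B B))
      (⊴-+ (eval-tail-≤ f B f≤B N n N≤n) (⊴-neg (eval-tail-≤ g B g≤B N n N≤n)))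

    eval-⊛ : ∀ f g N → eval f z N *ᵍ eval g z N -ᵍ eval (f ⊛ g) z N ⊴ mass f N ℚ.* mass g N ℚ.* r ^ℚ N
    eval-⊛ f g zero    = subst (_⊴ 0ℚ ℚ.* 0ℚ ℚ.* 1ℚ)
      (solve 0 (con 0ℤ := con 0ℤ :* con 0ℤ :- con 0ℤ) refl) (⊴-embed 0ℤ)
    eval-⊛ f g (suc N) = subst (_⊴ mass f (suc N) ℚ.* mass g (suc N) ℚ.* r ^ℚ suc N) (sym split)
      (⊴-mono (ℚ.≤-trans (ℚ.≤-reflexive (regroup r σ (mass g N) (size (g N)) (r ^ℚ N)))
          (*-monoʳ (r ℚ.* r ^ℚ N) (0≤r^ (suc N)) (*-monoʳ (mass g (suc N)) (0≤mass g (suc N))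
            (≤-by {r ℚ.* σ} {mass f (suc N)} s (0≤size (f 0)) (trans (ℚ.+-comm (r ℚ.* σ) s) (sym (mass-front f N)))))))
        (⊴-* z⊴rr (⊴-+ (eval-⊛ (tail f) g N) (⊴-* (eval-bound (tail f) N) (term-bound g N)))))
      where
      s = size (f 0)
      σ = mass (tail f) N
      F = eval (tail f) z N
      H = eval (tail f ⊛ g) z N
      K = eval (tail g) z N
      regroup : ∀ r σ m t p → r ℚ.* r ℚ.* (σ ℚ.* m ℚ.* p ℚ.+ σ ℚ.* (t ℚ.* (p ℚ.* p)))
        ≡ r ℚ.* σ ℚ.* (m ℚ.+ t ℚ.* p) ℚ.* (r ℚ.* p)
      regroup = solve-∀ ℚ-ring
      product : eval (f ⊛ g) z (suc N) ≡ embed (f 0) *ᵍ eval g z (suc N) +ᵍ z *ᵍ H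
      product = begin
        eval (f ⊛ g) z (suc N)
          ≡⟨ eval-front (f ⊛ g) z N ⟩
        embed ((f ⊛ g) 0) +ᵍ z *ᵍ eval (tail (f ⊛ g)) z N
          ≡⟨ cong₂ (λ x y → x +ᵍ z *ᵍ y) (trans (cong embed (⊛-zero f g)) (embed-* (f 0) (g 0)))
               (trans (eval-cong z N (λ j _ → ⊛-suc f g j)) (trans (eval-⊕ (f 0 · tail g) (tail f ⊛ g) z N)
                 (cong (_+ᵍ H) (eval-· (f 0) (tail g) z N)))) ⟩
        embed (f 0) *ᵍ embed (g 0) +ᵍ z *ᵍ (embed (f 0) *ᵍ K +ᵍ H)
          ≡⟨ solve 5 (λ a b z k h → a :* b :+ z :* (a :* k :+ h) := a :* (b :+ z :* k) :+ z :* h)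
               refl (embed (f 0)) (embed (g 0)) z K H ⟩
        embed (f 0) *ᵍ (embed (g 0) +ᵍ z *ᵍ K) +ᵍ z *ᵍ H
          ≡⟨ cong (λ w → embed (f 0) *ᵍ w +ᵍ z *ᵍ H) (eval-front g z N) ⟨
        embed (f 0) *ᵍ eval g z (suc N) +ᵍ z *ᵍ H ∎
        where open ≡-Reasoning
      split : eval f z (suc N) *ᵍ eval g z (suc N) -ᵍ eval (f ⊛ g) z (suc N)
        ≡ z *ᵍ ((F *ᵍ eval g z N -ᵍ H) +ᵍ F *ᵍ (embed (g N) *ᵍ z ↑ N))
      split = trans (cong₂ (λ x y → x *ᵍ eval g z (suc N) -ᵍ y) (eval-front f z N) product)
        (solve 6 (λ a z F G t H → (a :+ z :* F) :* (G :+ t) :- (a :* (G :+ t) :+ z :* H)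
          := z :* ((F :* G :- H) :+ F :* t)) refl
          (embed (f 0)) z F (eval g z N) (embed (g N) *ᵍ z ↑ N) H)

  -- Bernoulli's inequality for 1/r.
  r^-decay : ∀ n → r ^ℚ n ℚ.* (1ℚ ℚ.+ fromℕ n ℚ.* (1ℚ ℚ.- r)) ℚ.≤ 1ℚ
  r^-decay zero    = ℚ.≤-reflexive (base r)
    where
    base : ∀ r → 1ℚ ℚ.* (1ℚ ℚ.+ 0ℚ ℚ.* (1ℚ ℚ.- r)) ≡ 1ℚ
    base = solve-∀ ℚ-ring
  r^-decay (suc n) = ℚ.≤-trans (≤-by (p ℚ.* (h ℚ.* (h ℚ.+ m ℚ.* h)))
      (0≤* (0≤r^ n) (0≤* 0≤h (0≤+ 0≤h (0≤* (0≤fromℕ n) 0≤h))))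
      (trans (cong (λ w → r ℚ.* p ℚ.* (1ℚ ℚ.+ w ℚ.* h) ℚ.+ p ℚ.* (h ℚ.* (h ℚ.+ m ℚ.* h))) (fromℕ-suc n))
        (expand r p m)))
    (r^-decay n)
    where
    h = 1ℚ ℚ.- r
    p = r ^ℚ n
    m = fromℕ n
    0≤h : 0ℚ ℚ.≤ h
    0≤h = 0≤y-x r≤1
    expand : ∀ r p m → r ℚ.* p ℚ.* (1ℚ ℚ.+ (1ℚ ℚ.+ m) ℚ.* (1ℚ ℚ.- r))
        ℚ.+ p ℚ.* ((1ℚ ℚ.- r) ℚ.* ((1ℚ ℚ.- r) ℚ.+ m ℚ.* (1ℚ ℚ.- r)))
      ≡ p ℚ.* (1ℚ ℚ.+ m ℚ.* (1ℚ ℚ.- r))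
    expand = solve-∀ ℚ-ring

  0<1-r : 0ℚ ℚ.< 1ℚ ℚ.- r
  0<1-r = subst (ℚ._< 1ℚ ℚ.- r) (ℚ.+-inverseʳ r) (ℚ.+-monoˡ-< (ℚ.- r) r<1)

  r^-small : ∀ B ε → 0ℚ ℚ.≤ B → 0ℚ ℚ.< ε → Eventually λ n → B ℚ.* r ^ℚ n ℚ.≤ ε
  r^-small B ε 0≤B 0<ε = N , small
    where
    h = 1ℚ ℚ.- r
    εh = ε ℚ.* h
    0<εh : 0ℚ ℚ.< εh
    0<εh = ℚ.positive⁻¹ εh {{ℚ.pos*pos⇒pos ε {{ℚ.positive 0<ε}} h {{ℚ.positive 0<1-r}}}}
    instance
      εh≢0 : ℚ.NonZero εh
      εh≢0 = ℚ.pos⇒nonZero εh {{ℚ.positive 0<εh}}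
    Q = B ℚ.* ℚ.1/ εh
    N = proj₁ (archimedean Q)
    0≤εh = ℚ.<⇒≤ 0<εh
    B≤ : ∀ n → N ℕ.≤ n → B ℚ.≤ fromℕ n ℚ.* εh
    B≤ n N≤n = ℚ.≤-trans (ℚ.≤-reflexive (sym (trans (ℚ.*-assoc B (ℚ.1/ εh) εh)
        (trans (cong (B ℚ.*_) (ℚ.*-inverseˡ εh)) (ℚ.*-identityʳ B)))))
      (*-monoʳ εh 0≤εh (ℚ.≤-trans (proj₂ (archimedean Q)) (fromℤ-mono-≤ (ℤ.+≤+ N≤n))))
    expand : ∀ ε h m p → ε ℚ.* (p ℚ.* (1ℚ ℚ.+ m ℚ.* h)) ≡ m ℚ.* (ε ℚ.* h) ℚ.* p ℚ.+ ε ℚ.* p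
    expand = solve-∀ ℚ-ring
    small : ∀ n → N ℕ.≤ n → B ℚ.* r ^ℚ n ℚ.≤ ε
    small n N≤n = ℚ.≤-trans (*-monoʳ (r ^ℚ n) (0≤r^ n) (B≤ n N≤n))
      (ℚ.≤-trans (≤-by (ε ℚ.* r ^ℚ n) (0≤* (ℚ.<⇒≤ 0<ε) (0≤r^ n)) (sym (expand ε h (fromℕ n) (r ^ℚ n))))
      (ℚ.≤-trans (*-monoˡ ε (ℚ.<⇒≤ 0<ε) (r^-decay n)) (ℚ.≤-reflexive (ℚ.*-identityʳ ε))))

  -- The product of the norms of the factors 1 - xᵏ, 1 ≤ k ≤ n.
  product : ℕ → ℚ
  product = fold ℚ._*_ 1ℚ λ k → 1ℚ ℚ.+ r ^ℚ suc k

  0≤factor : ∀ k → 0ℚ ℚ.≤ 1ℚ ℚ.+ r ^ℚ suc k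
  0≤factor k = 0≤+ 0≤1 (0≤r^ (suc k))

  0≤product : ∀ n → 0ℚ ℚ.≤ product n
  0≤product zero    = 0≤1
  0≤product (suc n) = 0≤* (0≤product n) (0≤factor n)

  product-suc : ∀ n → product n ℚ.≤ product (suc n)
  product-suc n = ≤-by (product n ℚ.* r ^ℚ suc n) (0≤* (0≤product n) (0≤r^ (suc n)))
    (expand (product n) (r ^ℚ suc n))
    where
    expand : ∀ a b → a ℚ.+ a ℚ.* b ≡ a ℚ.* (1ℚ ℚ.+ b)
    expand = solve-∀ ℚ-ring

  product-+ : ∀ k n → product n ℚ.≤ product (k ℕ.+ n)
  product-+ zero    n = ℚ.≤-refl
  product-+ (suc k) n = ℚ.≤-trans (product-+ k n) (product-suc (k ℕ.+ n))

  product-bounded : ∃[ B ] (∀ n → product n ℚ.≤ B)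
  product-bounded = B , λ n → ℚ.≤-trans (product-+ n₀ n)
    (subst (λ k → product k ℚ.≤ B) (ℕ.+-comm n n₀)
      (ℚ.*-cancelˡ-≤-pos (1ℚ ℚ.- r) {{ℚ.positive 0<1-r}} (ℚ.≤-trans (invariant n)
        (ℚ.≤-trans (*-monoˡ B 0≤B (≤-by (r ^ℚ suc (n ℕ.+ n₀)) (0≤r^ (suc (n ℕ.+ n₀))) (restore (1ℚ ℚ.- r) (r ^ℚ suc (n ℕ.+ n₀)))))
          (ℚ.≤-reflexive (ℚ.*-comm B (1ℚ ℚ.- r)))))))
    where
    2q≤ : Eventually λ n → fromℕ 2 ℚ.* r ^ℚ n ℚ.≤ 1ℚ ℚ.- r
    2q≤ = r^-small (fromℕ 2) (1ℚ ℚ.- r) (0≤fromℕ 2) 0<1-r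
    n₀ = proj₁ 2q≤
    B = fromℕ 2 ℚ.* product n₀
    0≤B : 0ℚ ℚ.≤ B
    0≤B = 0≤* (0≤fromℕ 2) (0≤product n₀)
    restore : ∀ h q → h ℚ.- q ℚ.+ q ≡ h
    restore = solve-∀ ℚ-ring
    base : ∀ h q P → h ℚ.* P ℚ.+ P ℚ.* (h ℚ.- (1ℚ ℚ.+ 1ℚ) ℚ.* q) ≡ (1ℚ ℚ.+ 1ℚ) ℚ.* P ℚ.* (h ℚ.- q)
    base = solve-∀ ℚ-ring
    step : ∀ r q B → B ℚ.* ((1ℚ ℚ.- r) ℚ.- q) ℚ.* (1ℚ ℚ.+ q) ℚ.+ B ℚ.* (q ℚ.* q)
      ≡ B ℚ.* ((1ℚ ℚ.- r) ℚ.- r ℚ.* q)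
    step = solve-∀ ℚ-ring
    -- (1 - r - q) (1 + q) ≤ 1 - r - r q makes the bound pass from q = rⁿ⁺¹ to r q.
    invariant : ∀ n → (1ℚ ℚ.- r) ℚ.* product (n ℕ.+ n₀) ℚ.≤ B ℚ.* ((1ℚ ℚ.- r) ℚ.- r ^ℚ suc (n ℕ.+ n₀))
    invariant zero    = ≤-by (product n₀ ℚ.* ((1ℚ ℚ.- r) ℚ.- fromℕ 2 ℚ.* r ^ℚ suc n₀))
      (0≤* (0≤product n₀) (0≤y-x (proj₂ 2q≤ (suc n₀) (ℕ.n≤1+n n₀))))
      (base (1ℚ ℚ.- r) (r ^ℚ suc n₀) (product n₀))
    invariant (suc n) = ℚ.≤-trans
      (ℚ.≤-reflexive (sym (ℚ.*-assoc (1ℚ ℚ.- r) (product (n ℕ.+ n₀)) (1ℚ ℚ.+ q))))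
      (ℚ.≤-trans (*-monoʳ (1ℚ ℚ.+ q) (0≤factor (n ℕ.+ n₀)) (invariant n))
        (≤-by (B ℚ.* (q ℚ.* q)) (0≤* 0≤B (0≤square q)) (step r q B)))
      where q = r ^ℚ suc (n ℕ.+ n₀)

-- Complex numbers through their rational approximations

open import Defs using (_+_; _*_; _-_; -_; _^_; _≈_)

at : ℂ → ℕ → ℚ[i]
at z n = gauss (seq (re z) n) (seq (im z) n)

opaque
  unfolding _+ᵍ_ _*ᵍ_ -ᵍ_

  at-+ : ∀ z w n → at (z + w) n ≡ at z n +ᵍ at w n
  at-+ z w n = refl

  at-* : ∀ z w n → at (z * w) n ≡ at z n *ᵍ at w n
  at-* z w n = refl

  at-neg : ∀ z n → at (- z) n ≡ -ᵍ at z n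
  at-neg z n = refl

at-minus : ∀ z w n → at (z - w) n ≡ at z n -ᵍ at w n
at-minus z w n = trans (at-+ z (- w) n) (cong (at z n +ᵍ_) (at-neg w n))

at-^ : ∀ z k n → at (z ^ k) n ≡ at z n ↑ k
at-^ z zero    n = refl
at-^ z (suc k) n = trans (at-* z (z ^ k) n) (cong (at z n *ᵍ_) (at-^ z k n))

always : {P : ℕ → Set} → (∀ n → P n) → Eventually P
always p = 0 , λ n _ → p n

both : {P Q R : ℕ → Set} → Eventually P → Eventually Q → (∀ {n} → P n → Q n → R n) → Eventually R
both (M , p) (N , q) f = M ℕ.⊔ N , λ n n≥ →
  f (p n (ℕ.≤-trans (ℕ.m≤m⊔n M N) n≥)) (q n (ℕ.≤-trans (ℕ.m≤n⊔m M N) n≥))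

0<half : ∀ {ε} → 0ℚ ℚ.< ε → 0ℚ ℚ.< ε ℚ.* ½
0<half {ε} 0<ε = subst (ℚ._< ε ℚ.* ½) (ℚ.*-zeroˡ ½) (ℚ.*-monoˡ-<-pos ½ 0<ε)

half+half : ∀ ε → ε ℚ.* ½ ℚ.+ ε ℚ.* ½ ≡ ε
half+half ε = trans (sym (ℚ.*-distribˡ-+ ε ½ ½)) (ℚ.*-identityʳ ε)

half< : ∀ {ε} → 0ℚ ℚ.< ε → ε ℚ.* ½ ℚ.< ε
half< {ε} 0<ε = subst₂ ℚ._<_ (ℚ.+-identityʳ (ε ℚ.* ½)) (half+half ε) (ℚ.+-monoʳ-< (ε ℚ.* ½) (0<half 0<ε))

Null : (ℕ → ℚ[i]) → Set
Null u = ∀ ε → 0ℚ ℚ.< ε → Eventually λ n → u n ⊴ ε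

Null-+ : ∀ {u v} → Null u → Null v → Null (λ n → u n +ᵍ v n)
Null-+ {u} {v} u→0 v→0 ε 0<ε = both (u→0 (ε ℚ.* ½) (0<half 0<ε)) (v→0 (ε ℚ.* ½) (0<half 0<ε))
  λ {n} p q → subst (u n +ᵍ v n ⊴_) (half+half ε) (⊴-+ p q)

Null-*-bounded : ∀ {u v : ℕ → ℚ[i]} B → 0ℚ ℚ.≤ B → Eventually (λ n → u n ⊴ B) → Null v → Null (λ n → u n *ᵍ v n)
Null-*-bounded B 0≤B u⊴B v→0 ε 0<ε =
  let (δ , 0<δ , Bδ≤ε) = shrink B ε 0≤B 0<ε in
  both u⊴B (v→0 δ 0<δ) λ p q → ⊴-mono Bδ≤ε (⊴-* p q)

Null-≡ : ∀ {u v} → Eventually (λ n → u n ≡ v n) → Null u → Null v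
Null-≡ u≡v u→0 ε 0<ε = both u≡v (u→0 ε 0<ε) λ eq p → subst (_⊴ ε) eq p

Null⇒≈ : ∀ z w → Null (λ n → at z n -ᵍ at w n) → z ≈ w
Null⇒≈ z w z-w→0 =
  (λ ε 0<ε → let (N , small) = z-w→0 (ε ℚ.* ½) (0<half 0<ε) in N , λ n n≥ → ℚ.≤-<-trans
    (subst (λ q → ℚ.∣ q ∣ ℚ.≤ ε ℚ.* ½) (Re-minus (at z n) (at w n)) (⊴⇒∣Re∣≤ (small n n≥))) (half< 0<ε)) ,
  (λ ε 0<ε → let (N , small) = z-w→0 (ε ℚ.* ½) (0<half 0<ε) in N , λ n n≥ → ℚ.≤-<-trans
    (subst (λ q → ℚ.∣ q ∣ ℚ.≤ ε ℚ.* ½) (Im-minus (at z n) (at w n)) (⊴⇒∣Im∣≤ (small n n≥))) (half< 0<ε))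

uniform-limit-cauchy : (a : ℕ → ℝ) (v : ℕ → ℚ) →
  (∀ ε → 0ℚ ℚ.< ε → ∃[ N ] Eventually λ n → ℚ.∣ seq (a N) n ℚ.- v n ∣ ℚ.≤ ε) → IsCauchy v
uniform-limit-cauchy a v close ε 0<ε = cauchy-v
  where
  δ = ε ℚ.* ½ ℚ.* ½
  N = proj₁ (close δ (0<half (0<half 0<ε)))
  near : Eventually λ n → ℚ.∣ seq (a N) n ℚ.- v n ∣ ℚ.≤ δ
  near = proj₂ (close δ (0<half (0<half 0<ε)))
  s = seq (a N)
  s-cauchy = cauchy (a N) (ε ℚ.* ½) (0<half 0<ε)
  n₀ = proj₁ near ℕ.⊔ proj₁ s-cauchy
  split : ∀ x y p q → x ℚ.- y ≡ (ℚ.- (p ℚ.- x)) ℚ.+ ((p ℚ.- q) ℚ.+ (q ℚ.- y))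
  split = solve-∀ ℚ-ring
  quarters : ∀ e → e ℚ.* ½ ℚ.+ (e ℚ.+ e ℚ.* ½) ≡ e ℚ.+ e
  quarters e = trans (swap (e ℚ.* ½) e) (cong (e ℚ.+_) (half+half e))
    where
    swap : ∀ h e → h ℚ.+ (e ℚ.+ h) ≡ e ℚ.+ (h ℚ.+ h)
    swap = solve-∀ ℚ-ring
  bound-v : ∀ m n → n₀ ℕ.≤ m → n₀ ℕ.≤ n → ℚ.∣ v m ℚ.- v n ∣ ℚ.< ε
  bound-v m n m≥ n≥ = begin-strict
    ℚ.∣ v m ℚ.- v n ∣
      ≡⟨ cong ℚ.∣_∣ (split (v m) (v n) (s m) (s n)) ⟩
    ℚ.∣ (ℚ.- (s m ℚ.- v m)) ℚ.+ ((s m ℚ.- s n) ℚ.+ (s n ℚ.- v n)) ∣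
      ≤⟨ ℚ.∣p+q∣≤∣p∣+∣q∣ (ℚ.- (s m ℚ.- v m)) ((s m ℚ.- s n) ℚ.+ (s n ℚ.- v n)) ⟩
    ℚ.∣ ℚ.- (s m ℚ.- v m) ∣ ℚ.+ ℚ.∣ (s m ℚ.- s n) ℚ.+ (s n ℚ.- v n) ∣
      ≤⟨ ℚ.+-mono-≤ (ℚ.≤-trans (ℚ.≤-reflexive (ℚ.∣-p∣≡∣p∣ (s m ℚ.- v m))) (near-at m m≥))
           (ℚ.∣p+q∣≤∣p∣+∣q∣ (s m ℚ.- s n) (s n ℚ.- v n)) ⟩
    δ ℚ.+ (ℚ.∣ s m ℚ.- s n ∣ ℚ.+ ℚ.∣ s n ℚ.- v n ∣)
      <⟨ ℚ.+-monoʳ-< δ (ℚ.+-mono-<-≤ (proj₂ s-cauchy m n (late m≥) (late n≥)) (near-at n n≥)) ⟩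
    δ ℚ.+ (ε ℚ.* ½ ℚ.+ δ)
      ≡⟨ quarters (ε ℚ.* ½) ⟩
    ε ℚ.* ½ ℚ.+ ε ℚ.* ½
      ≡⟨ half+half ε ⟩
    ε ∎
    where
    open ℚ.≤-Reasoning
    late : ∀ {k} → n₀ ℕ.≤ k → proj₁ s-cauchy ℕ.≤ k
    late = ℕ.≤-trans (ℕ.m≤n⊔m (proj₁ near) (proj₁ s-cauchy))
    near-at : ∀ k → n₀ ℕ.≤ k → ℚ.∣ s k ℚ.- v k ∣ ℚ.≤ δ
    near-at k k≥ = proj₂ near k (ℕ.≤-trans (ℕ.m≤m⊔n (proj₁ near) (proj₁ s-cauchy)) k≥)
  cauchy-v : ∃[ N ] (∀ m n → N ℕ.≤ m → N ℕ.≤ n → ℚ.∣ v m ℚ.- v n ∣ ℚ.< ε)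
  cauchy-v = n₀ , bound-v

module Limit (s : ℕ → ℂ) (v : ℕ → ℚ[i])
  (close : ∀ ε → 0ℚ ℚ.< ε → Eventually λ N → Eventually λ n → at (s N) n -ᵍ v n ⊴ ε) where

  close-N : ∀ ε → 0ℚ ℚ.< ε → ∃[ N ] Eventually λ n → at (s N) n -ᵍ v n ⊴ ε
  close-N ε 0<ε = let (N , h) = close ε 0<ε in N , h N ℕ.≤-refl

  limit : ℂ
  limit =
    mkℝ (λ n → Re (v n)) (uniform-limit-cauchy (λ N → re (s N)) (λ n → Re (v n)) λ ε 0<ε →
      let (N , n₀ , h) = close-N ε 0<ε in N , n₀ , λ n n≥ →
        subst (λ q → ℚ.∣ q ∣ ℚ.≤ ε) (Re-minus (at (s N) n) (v n)) (⊴⇒∣Re∣≤ (h n n≥)))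
    +i
    mkℝ (λ n → Im (v n)) (uniform-limit-cauchy (λ N → im (s N)) (λ n → Im (v n)) λ ε 0<ε →
      let (N , n₀ , h) = close-N ε 0<ε in N , n₀ , λ n n≥ →
        subst (λ q → ℚ.∣ q ∣ ℚ.≤ ε) (Im-minus (at (s N) n) (v n)) (⊴⇒∣Im∣≤ (h n n≥)))

  converges : s ⟶ limit
  converges ε 0<ε =
    let e = ε ℚ.* ½
        0<e = 0<half 0<ε
        0≤e = ℚ.<⇒≤ 0<e
        (N₀ , h) = close e 0<e
    in N₀ , λ N N≥ →
      0<ε , e ℚ.* e , ℚ.positive⁻¹ (e ℚ.* e) {{ℚ.pos*pos⇒pos e {{ℚ.positive 0<e}} e {{ℚ.positive 0<e}}}} ,
      proj₁ (h N N≥) , λ n n≥ →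
        ℚ.≤-trans (ℚ.+-monoˡ-≤ (e ℚ.* e)
            (subst (λ d → norm d ℚ.≤ e ℚ.* e) (sym (at-minus (s N) limit n)) (norm≤ (proj₂ (h N N≥) n n≥))))
          (≤-by (e ℚ.* e ℚ.+ e ℚ.* e) (0≤+ (0≤* 0≤e 0≤e) (0≤* 0≤e 0≤e))
            (trans (fourfold e) (cong₂ ℚ._*_ (half+half ε) (half+half ε))))
    where
    fourfold : ∀ e → e ℚ.* e ℚ.+ e ℚ.* e ℚ.+ (e ℚ.* e ℚ.+ e ℚ.* e) ≡ (e ℚ.+ e) ℚ.* (e ℚ.+ e)
    fourfold = solve-∀ ℚ-ring

-- The square root of |x| stays below some r < 1.
radius : ∀ x → ∣ x ∣< 1ℚ → ∃[ r ] (0ℚ ℚ.≤ r × r ℚ.< 1ℚ × Eventually λ n → at x n ⊴ r ℚ.* r)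
radius x (_ , δ , 0<δ , N , h) = r , 0≤r , r<1 , N , λ n n≥ → bound (0≤* 0≤r 0≤r)
  (ℚ.≤-trans (norm-at n n≥) (≤-by (t ℚ.* t ℚ.* (fromℕ 2 ℚ.+ (fromℕ 2 ℚ.- t) ℚ.* (fromℕ 2 ℚ.- t)))
    (0≤* (0≤square t) (0≤+ (0≤fromℕ 2) (0≤square (fromℕ 2 ℚ.- t)))) (expand t)))
  where
  t = δ ℚ.* ½ ℚ.* ½
  r = 1ℚ ℚ.- t
  0<t : 0ℚ ℚ.< t
  0<t = 0<half (0<half 0<δ)
  4t = t ℚ.+ t ℚ.+ (t ℚ.+ t)
  δ≡4t : δ ≡ 4t
  δ≡4t = sym (trans (cong₂ ℚ._+_ (half+half (δ ℚ.* ½)) (half+half (δ ℚ.* ½))) (half+half δ))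
  move : ∀ a d → a ℚ.+ d ℚ.- d ≡ a
  move = solve-∀ ℚ-ring
  norm-at : ∀ n → N ℕ.≤ n → norm (at x n) ℚ.≤ 1ℚ ℚ.- 4t
  norm-at n n≥ = subst₂ ℚ._≤_ (move (norm (at x n)) δ) (cong (λ w → 1ℚ ℚ.- w) δ≡4t)
    (ℚ.+-monoˡ-≤ (ℚ.- δ) (h n n≥))
  expand : ∀ t → (1ℚ ℚ.- (t ℚ.+ t ℚ.+ (t ℚ.+ t))) ℚ.+
      t ℚ.* t ℚ.* ((1ℚ ℚ.+ 1ℚ) ℚ.+ ((1ℚ ℚ.+ 1ℚ) ℚ.- t) ℚ.* ((1ℚ ℚ.+ 1ℚ) ℚ.- t))
    ≡ ((1ℚ ℚ.- t) ℚ.* (1ℚ ℚ.- t)) ℚ.* ((1ℚ ℚ.- t) ℚ.* (1ℚ ℚ.- t))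
  expand = solve-∀ ℚ-ring
  0≤r : 0ℚ ℚ.≤ r
  0≤r = ℚ.≤-trans (ℚ.≤-trans (0≤norm (at x N)) (norm-at N ℕ.≤-refl))
    (≤-by (t ℚ.+ (t ℚ.+ t)) (0≤+ 0≤t (0≤+ 0≤t 0≤t)) (regroup t))
    where
    0≤t = ℚ.<⇒≤ 0<t
    regroup : ∀ t → (1ℚ ℚ.- (t ℚ.+ t ℚ.+ (t ℚ.+ t))) ℚ.+ (t ℚ.+ (t ℚ.+ t)) ≡ 1ℚ ℚ.- t
    regroup = solve-∀ ℚ-ring
  r<1 : r ℚ.< 1ℚ
  r<1 = subst (r ℚ.<_) (ℚ.+-identityʳ 1ℚ) (ℚ.+-monoʳ-< 1ℚ (ℚ.neg-antimono-< 0<t))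

↑-+ : ∀ z m n → z ↑ (m ℕ.+ n) ≡ z ↑ m *ᵍ z ↑ n
↑-+ z zero    n = sym (G.*-identityˡ (z ↑ n))
↑-+ z (suc m) n = trans (cong (z *ᵍ_) (↑-+ z m n)) (sym (G.*-assoc z (z ↑ m) (z ↑ n)))

↑-* : ∀ z m n → z ↑ (m ℕ.* n) ≡ (z ↑ m) ↑ n
↑-* z m zero    = cong (z ↑_) (ℕ.*-zeroʳ m)
↑-* z m (suc n) = trans (cong (z ↑_) (ℕ.*-suc m n))
  (trans (↑-+ z m (m ℕ.* n)) (cong (z ↑ m *ᵍ_) (↑-* z m n)))

module Values (x : ℂ) (r : ℚ) (0≤r : 0ℚ ℚ.≤ r) (r<1 : r ℚ.< 1ℚ)
  (x⊴rr : Eventually λ n → at x n ⊴ r ℚ.* r) where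
  open Weighted r 0≤r r<1

  value : PowerSeries → ℕ → ℚ[i]
  value f n = eval f (at x n) n

  Bounded : PowerSeries → Set
  Bounded f = ∃[ B ] (∀ n → mass f n ℚ.≤ B)

  0≤bound : ∀ {f B} → (∀ n → mass f n ℚ.≤ B) → 0ℚ ℚ.≤ B
  0≤bound f≤B = f≤B 0

  value-⊛ : ∀ f g → Bounded f → Bounded g →
    Null (λ n → value f n *ᵍ value g n -ᵍ value (f ⊛ g) n)
  value-⊛ f g (A , f≤A) (B , g≤B) ε 0<ε =
    both x⊴rr (r^-small (A ℚ.* B) ε (0≤* (0≤bound {f} f≤A) (0≤bound {g} g≤B)) 0<ε) λ {n} x⊴ small →
      ⊴-mono (ℚ.≤-trans (*-monoʳ (r ^ℚ n) (0≤r^ n)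
          (*-mono (0≤bound {f} f≤A) (0≤mass g n) (f≤A n) (g≤B n))) small)
        (eval-⊛ x⊴ f g n)

  Bounded-⊛ : ∀ f g → Bounded f → Bounded g → Bounded (f ⊛ g)
  Bounded-⊛ f g (A , f≤A) (B , g≤B) = A ℚ.* B , λ n → ℚ.≤-trans (mass-⊛ f g n)
    (*-mono (0≤bound {f} f≤A) (0≤mass g n) (f≤A n) (g≤B n))

  value-bounded : ∀ f ((B , _) : Bounded f) → Eventually λ n → value f n ⊴ B
  value-bounded f (B , f≤B) = both x⊴rr (always λ n → f≤B n) λ {n} x⊴ f≤ → ⊴-mono f≤ (eval-bound x⊴ f n)

  sum-close : ∀ f a → (∀ j n → at (a j) n ≡ embed (f j) *ᵍ at x n ↑ j) → Bounded f →
    ∀ ε → 0ℚ ℚ.< ε → Eventually λ N → Eventually λ n → at (fold _+_ 0ℂ a N) n -ᵍ value f n ⊴ ε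
  sum-close f a a≡ (B , f≤B) ε 0<ε =
    let (N₀ , small) = r^-small B ε (0≤bound {f} f≤B) 0<ε in N₀ , λ N N≥ →
      both x⊴rr (N , λ n n≥ → n≥) λ {n} x⊴ n≥ → subst (_⊴ ε)
        (trans (solve 2 (λ u w → :- (u :- w) := w :- u) refl (value f n) (eval f (at x n) N))
          (cong (_-ᵍ value f n) (sym (partial N n))))
        (⊴-mono (small N N≥) (⊴-neg (eval-tail-≤ x⊴ f B f≤B N n n≥)))
    where
    partial : ∀ N n → at (fold _+_ 0ℂ a N) n ≡ eval f (at x n) N
    partial zero    n = refl
    partial (suc N) n = trans (at-+ (fold _+_ 0ℂ a N) (a N) n) (cong₂ _+ᵍ_ (partial N n) (a≡ N n))

  Bounded-≐ : ∀ (P : ℕ → PowerSeries) f → (∀ n → P n ≐ f [ n ]) → ∀ B → (∀ N n → mass (P N) n ℚ.≤ B) →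
    ∀ n → mass f n ℚ.≤ B
  Bounded-≐ P f P≐f B P≤B n = ℚ.≤-trans
    (mass-mono f (P n) n λ j j<n → ℚ.≤-reflexive (cong size (sym (coeff (P≐f n) j j<n)))) (P≤B n n)

  B₀ : ℚ
  B₀ = proj₁ product-bounded

  0≤B₀ : 0ℚ ℚ.≤ B₀
  0≤B₀ = ℚ.≤-trans (0≤product 0) (proj₂ product-bounded 0)

  mass-factor : ∀ a n → mass (X^ 0 ⊖ X^ a) n ℚ.≤ 1ℚ ℚ.+ r ^ℚ a
  mass-factor a n = ℚ.≤-trans (mass-⊖ (X^ 0) (X^ a) n) (ℚ.+-mono-≤ (mass-X^ 0 n) (mass-X^ a n))

  mass-factor-≤ : ∀ d′ k n → mass (X^ 0 ⊖ X^ (suc d′ ℕ.* suc k)) n ℚ.≤ 1ℚ ℚ.+ r ^ℚ suc k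
  mass-factor-≤ d′ k n = ℚ.≤-trans (mass-factor (suc d′ ℕ.* suc k) n) (ℚ.+-monoʳ-≤ 1ℚ
    (subst (λ a → r ^ℚ a ℚ.≤ r ^ℚ suc k) (ℕ.+-comm (d′ ℕ.* suc k) (suc k)) (r^-antitone (d′ ℕ.* suc k) (suc k))))

  mass-E-partial : ∀ d′ N n → mass (E-partial (suc d′) N) n ℚ.≤ product N
  mass-E-partial d′ zero    n = mass-X^ 0 n
  mass-E-partial d′ (suc N) n = ℚ.≤-trans (mass-⊛ (E-partial (suc d′) N) factor n)
    (*-mono (0≤product N) (0≤mass factor n) (mass-E-partial d′ N n) (mass-factor-≤ d′ N n))
    where
    factor : PowerSeries
    factor = X^ 0 ⊖ X^ (suc d′ ℕ.* suc N)

  E-partial-bounded : ∀ d′ N n → mass (E-partial (suc d′) N) n ℚ.≤ B₀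
  E-partial-bounded d′ N n = ℚ.≤-trans (mass-E-partial d′ N n) (proj₂ product-bounded N)

  E-bounded : ∀ d′ n → mass E[ suc d′ ] n ℚ.≤ B₀
  E-bounded d′ = Bounded-≐ (E-partial (suc d′)) E[ suc d′ ]
    (λ n → E-partial-stable d′ n n ℕ.≤-refl) B₀ (E-partial-bounded d′)

  mass-EE²-partial : ∀ N n → mass (EE²-partial N) n ℚ.≤ product N ℚ.* product N
  mass-EE²-partial zero    n = mass-X^ 0 n
  mass-EE²-partial (suc N) n = ℚ.≤-trans (mass-⊛ (EE²-partial N) (f₁ ⊛ f₂) n)
    (ℚ.≤-trans (*-mono (0≤* (0≤product N) (0≤product N)) (0≤mass (f₁ ⊛ f₂) n) (mass-EE²-partial N n)
        (ℚ.≤-trans (mass-⊛ f₁ f₂ n) (*-mono (0≤factor N) (0≤mass f₂ n) mass-f₁ (mass-factor-≤ 1 N n))))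
      (ℚ.≤-reflexive (regroup (product N) (1ℚ ℚ.+ r ^ℚ suc N))))
    where
    f₁ f₂ : PowerSeries
    f₁ = X^ 0 ⊖ X^ (suc N)
    f₂ = X^ 0 ⊖ X^ (2 ℕ.* suc N)
    mass-f₁ : mass f₁ n ℚ.≤ 1ℚ ℚ.+ r ^ℚ suc N
    mass-f₁ = mass-factor (suc N) n
    regroup : ∀ a b → a ℚ.* a ℚ.* (b ℚ.* b) ≡ a ℚ.* b ℚ.* (a ℚ.* b)
    regroup = solve-∀ ℚ-ring

  c-bounded : ∀ n → mass c n ℚ.≤ B₀ ℚ.* B₀
  c-bounded = Bounded-≐ EE²-partial c (λ n → EE²-partial-stable n n ℕ.≤-refl) (B₀ ℚ.* B₀)
    λ N n → ℚ.≤-trans (mass-EE²-partial N n)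
      (*-mono 0≤B₀ (0≤product N) (proj₂ product-bounded N) (proj₂ product-bounded N))

  component-bounded : ∀ k → Bounded (component k)
  component-bounded k = B₀ ℚ.* B₀ , λ n → ℚ.≤-trans (mass-mono (component k) c n (λ j _ → size≤ j)) (c-bounded n)
    where
    size≤ : ∀ j → size (component k j) ℚ.≤ size (c j)
    size≤ j with j % 3 ≡ᵇ k
    ... | true  = ℚ.≤-refl
    ... | false = subst (ℚ._≤ size (c j)) (sym size-0) (0≤size (c j))

  component-term : ℕ → ℕ → ℂ
  component-term k j = if j % 3 ≡ᵇ k then fromℤ (c j) * x ^ j else 0ℂ

  at-component-term : ∀ k j n → at (component-term k j) n ≡ embed (component k j) *ᵍ at x n ↑ j
  at-component-term k j n with j % 3 ≡ᵇ k
  ... | true  = trans (at-* (fromℤ (c j)) (x ^ j) n) (cong (embed (c j) *ᵍ_) (at-^ x j n))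
  ... | false = sym (G.zeroˡ (at x n ↑ j))

  module I (k : ℕ) = Limit (fold _+_ 0ℂ (component-term k)) (value (component k))
    (sum-close (component k) (component-term k) (at-component-term k) (component-bounded k))

  E-factor : ℕ → ℕ → ℂ
  E-factor d k = 1ℂ - (x ^ d) ^ suc k

  at-E-factor : ∀ d k n → at (E-factor d k) n ≡ 1ᵍ -ᵍ at x n ↑ (d ℕ.* suc k)
  at-E-factor d k n = trans (at-minus 1ℂ ((x ^ d) ^ suc k) n) (cong (λ w → 1ᵍ -ᵍ w)
    (trans (at-^ (x ^ d) (suc k) n) (trans (cong (_↑ suc k) (at-^ x d n)) (sym (↑-* (at x n) d (suc k))))))

  partial-product : ∀ d′ N → let d = suc d′ in
    Null (λ n → at (fold _*_ 1ℂ (E-factor d) N) n -ᵍ value (E-partial d N) n)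
  partial-product d′ zero ε 0<ε = 1 , λ n n≥ → subst (_⊴ ε)
    (trans (sym (G.-‿inverseʳ 1ᵍ)) (cong (λ w → 1ᵍ -ᵍ w) (sym (eval-X^ 0 (at x n) n n≥)))) (⊴-0 (ℚ.<⇒≤ 0<ε))
  partial-product d′ (suc N) = Null-≡ (suc a , λ n n≥ → regroup n n≥)
    (Null-+ (Null-*-bounded (1ℚ ℚ.+ r ^ℚ a) (0≤+ 0≤1 (0≤r^ a)) (value-bounded q (_ , mass-factor a)) (partial-product d′ N))
      (value-⊛ P q (_ , E-partial-bounded d′ N) (_ , mass-factor a)))
    where
    d = suc d′
    a = d ℕ.* suc N
    P q : PowerSeries
    P = E-partial d N
    q = X^ 0 ⊖ X^ a
    u : ℕ → ℚ[i]
    u = at (fold _*_ 1ℂ (E-factor d) N)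
    value-q : ∀ n → suc a ℕ.≤ n → value q n ≡ at (E-factor d N) n
    value-q n n≥ = trans (eval-⊕ (X^ 0) (⊝ X^ a) (at x n) n)
      (trans (cong₂ _+ᵍ_ (eval-X^ 0 (at x n) n (ℕ.≤-trans (s≤s z≤n) n≥))
        (trans (eval-⊝ (X^ a) (at x n) n) (cong (λ w → -ᵍ w) (eval-X^ a (at x n) n n≥))))
        (sym (at-E-factor d N n)))
    regroup : ∀ n → suc a ℕ.≤ n →
      value q n *ᵍ (u n -ᵍ value P n) +ᵍ (value P n *ᵍ value q n -ᵍ value (P ⊛ q) n) ≡
      at (fold _*_ 1ℂ (E-factor d) (suc N)) n -ᵍ value (P ⊛ q) n
    regroup n n≥ = trans
      (solve 4 (λ q u p w → q :* (u :- p) :+ (p :* q :- w) := u :* q :- w) refl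
        (value q n) (u n) (value P n) (value (P ⊛ q) n))
      (cong (_-ᵍ value (P ⊛ q) n) (trans (cong (u n *ᵍ_) (value-q n n≥))
        (sym (at-* (fold _*_ 1ℂ (E-factor d) N) (E-factor d N) n))))

  E-close : ∀ d′ ε → 0ℚ ℚ.< ε → let d = suc d′ in
    Eventually λ N → Eventually λ n → at (fold _*_ 1ℂ (E-factor d) N) n -ᵍ value E[ d ] n ⊴ ε
  E-close d′ ε 0<ε =
    let d = suc d′
        (N₀ , small) = r^-small (B₀ ℚ.+ B₀) (ε ℚ.* ½) (0≤+ 0≤B₀ 0≤B₀) (0<half 0<ε)
    in N₀ , λ N N≥ → both (partial-product d′ N (ε ℚ.* ½) (0<half 0<ε))
      (both x⊴rr (N , λ n n≥ → n≥) λ {n} x⊴ n≥ → ⊴-mono (small N N≥)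
        (eval-agree x⊴ (E-partial d N) E[ d ] B₀ (E-partial-bounded d′ N) (E-bounded d′) N
          (E-partial-stable d′ N N ℕ.≤-refl) n n≥))
      λ {n} p q → subst₂ _⊴_
        (solve 3 (λ a b c → (a :- b) :+ (b :- c) := a :- c) refl
          (at (fold _*_ 1ℂ (E-factor d) N) n) (value (E-partial d N) n) (value E[ d ] n))
        (half+half ε) (⊴-+ p q)

  module E (d′ : ℕ) = Limit (fold _*_ 1ℂ (E-factor (suc d′))) (value E[ suc d′ ]) (E-close d′)

  IsI-limit : ∀ k → IsI k x (I.limit k)
  IsI-limit = I.converges

  IsE-limit : ∀ d′ → IsE (x ^ suc d′) (E.limit d′)
  IsE-limit = E.converges

  opaque
    unfolding _⊞_ _⊠_ ⊟_

    component-product : ∀ j → (component 2 ⊛ component 0) j ≡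
      (⊝ (component 1 ⊛ component 1 ⊕ component 1 ⊛ component 1)) j
    component-product j = coeff (Dissection.component-product (suc j)) j ℕ.≤-refl

    component₁≡ : ∀ j → component 1 j ≡ (⊝ (X^ 1 ⊛ (E[ 9 ] ⊛ E[ 18 ]))) j
    component₁≡ j = coeff (Dissection.component₁≐ (suc j)) j ℕ.≤-refl

  I₀ I₁ I₂ E₉ E₁₈ : ℂ
  I₀ = I.limit 0
  I₁ = I.limit 1
  I₂ = I.limit 2
  E₉ = E.limit 8
  E₁₈ = E.limit 17

  I₂I₀≈ : I₂ * I₀ ≈ - (2ℂ * I₁ ^ 2)
  I₂I₀≈ = Null⇒≈ (I₂ * I₀) (- (2ℂ * I₁ ^ 2)) (Null-≡ (always regroup)
    (Null-+ (value-⊛ (component 2) (component 0) (component-bounded 2) (component-bounded 0))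
      (Null-+ I₁I₁ I₁I₁)))
    where
    I₁I₁ = value-⊛ (component 1) (component 1) (component-bounded 1) (component-bounded 1)
    regroup : ∀ n → let v₀ = value (component 0) n
                        v₁ = value (component 1) n
                        v₂ = value (component 2) n
                        w = value (component 1 ⊛ component 1) n in
      (v₂ *ᵍ v₀ -ᵍ value (component 2 ⊛ component 0) n) +ᵍ ((v₁ *ᵍ v₁ -ᵍ w) +ᵍ (v₁ *ᵍ v₁ -ᵍ w)) ≡
      at (I₂ * I₀) n -ᵍ at (- (2ℂ * I₁ ^ 2)) n
    regroup n = begin
      (v₂ *ᵍ v₀ -ᵍ value (component 2 ⊛ component 0) n) +ᵍ ((v₁ *ᵍ v₁ -ᵍ w) +ᵍ (v₁ *ᵍ v₁ -ᵍ w))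
        ≡⟨ cong (λ p → (v₂ *ᵍ v₀ -ᵍ p) +ᵍ ((v₁ *ᵍ v₁ -ᵍ w) +ᵍ (v₁ *ᵍ v₁ -ᵍ w))) product-value ⟩
      (v₂ *ᵍ v₀ -ᵍ (-ᵍ (w +ᵍ w))) +ᵍ ((v₁ *ᵍ v₁ -ᵍ w) +ᵍ (v₁ *ᵍ v₁ -ᵍ w))
        ≡⟨ solve 4 (λ a b v w → (a :* b :- (:- (w :+ w))) :+ ((v :* v :- w) :+ (v :* v :- w)) :=
             a :* b :- (:- ((con 1ℤ :+ con 1ℤ) :* (v :* (v :* con 1ℤ))))) refl v₂ v₀ v₁ w ⟩
      v₂ *ᵍ v₀ -ᵍ (-ᵍ ((1ᵍ +ᵍ 1ᵍ) *ᵍ (v₁ *ᵍ (v₁ *ᵍ 1ᵍ))))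
        ≡⟨ cong₂ _-ᵍ_ (sym (at-* I₂ I₀ n)) (sym rhs) ⟩
      at (I₂ * I₀) n -ᵍ at (- (2ℂ * I₁ ^ 2)) n ∎
      where
      open ≡-Reasoning
      v₀ = value (component 0) n
      v₁ = value (component 1) n
      v₂ = value (component 2) n
      w = value (component 1 ⊛ component 1) n
      C₁C₁ : PowerSeries
      C₁C₁ = component 1 ⊛ component 1
      product-value : value (component 2 ⊛ component 0) n ≡ -ᵍ (w +ᵍ w)
      product-value = trans (eval-cong (at x n) n (λ j _ → component-product j))
        (trans (eval-⊝ (C₁C₁ ⊕ C₁C₁) (at x n) n) (cong (λ y → -ᵍ y) (eval-⊕ C₁C₁ C₁C₁ (at x n) n)))
      rhs : at (- (2ℂ * I₁ ^ 2)) n ≡ -ᵍ ((1ᵍ +ᵍ 1ᵍ) *ᵍ (v₁ *ᵍ (v₁ *ᵍ 1ᵍ)))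
      rhs = trans (at-neg (2ℂ * I₁ ^ 2) n) (cong (λ y → -ᵍ y) (trans (at-* 2ℂ (I₁ ^ 2) n)
        (cong₂ _*ᵍ_ (embed-+ 1ℤ 1ℤ) (at-^ I₁ 2 n))))

  I₁≈ : I₁ ≈ - (x * (E₉ * E₁₈))
  I₁≈ = Null⇒≈ I₁ (- (x * (E₉ * E₁₈))) (Null-≡ (2 , regroup)
    (Null-+ (Null-*-bounded (r ℚ.* r) (0≤* 0≤r 0≤r) x⊴rr (value-⊛ E[ 9 ] E[ 18 ] E₉-bounded E₁₈-bounded))
      (value-⊛ (X^ 1) EE (r ^ℚ 1 , mass-X^ 1) (Bounded-⊛ E[ 9 ] E[ 18 ] E₉-bounded E₁₈-bounded))))
    where
    E₉-bounded : Bounded E[ 9 ]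
    E₉-bounded = B₀ , E-bounded 8
    E₁₈-bounded : Bounded E[ 18 ]
    E₁₈-bounded = B₀ , E-bounded 17
    EE : PowerSeries
    EE = E[ 9 ] ⊛ E[ 18 ]
    regroup : ∀ n → 2 ℕ.≤ n →
      at x n *ᵍ (value E[ 9 ] n *ᵍ value E[ 18 ] n -ᵍ value EE n)
        +ᵍ (value (X^ 1) n *ᵍ value EE n -ᵍ value (X^ 1 ⊛ EE) n) ≡
      at I₁ n -ᵍ at (- (x * (E₉ * E₁₈))) n
    regroup n n≥ = begin
      z *ᵍ (a *ᵍ b -ᵍ value EE n) +ᵍ (value (X^ 1) n *ᵍ value EE n -ᵍ value (X^ 1 ⊛ EE) n)
        ≡⟨ cong (λ y → z *ᵍ (a *ᵍ b -ᵍ value EE n) +ᵍ (y *ᵍ value EE n -ᵍ value (X^ 1 ⊛ EE) n)) value-X ⟩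
      z *ᵍ (a *ᵍ b -ᵍ value EE n) +ᵍ (z *ᵍ value EE n -ᵍ value (X^ 1 ⊛ EE) n)
        ≡⟨ solve 5 (λ z a b e w → z :* (a :* b :- e) :+ (z :* e :- w) := (:- w) :- (:- (z :* (a :* b))))
             refl z a b (value EE n) (value (X^ 1 ⊛ EE) n) ⟩
      (-ᵍ value (X^ 1 ⊛ EE) n) -ᵍ (-ᵍ (z *ᵍ (a *ᵍ b)))
        ≡⟨ cong₂ _-ᵍ_ (sym lhs) (sym rhs) ⟩
      at I₁ n -ᵍ at (- (x * (E₉ * E₁₈))) n ∎
      where
      open ≡-Reasoning
      z = at x n
      a = value E[ 9 ] n
      b = value E[ 18 ] n
      value-X : value (X^ 1) n ≡ z
      value-X = trans (eval-X^ 1 z n n≥) (G.*-identityʳ z)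
      lhs : at I₁ n ≡ -ᵍ value (X^ 1 ⊛ EE) n
      lhs = trans (eval-cong z n (λ j _ → component₁≡ j)) (eval-⊝ (X^ 1 ⊛ EE) z n)
      rhs : at (- (x * (E₉ * E₁₈))) n ≡ -ᵍ (z *ᵍ (a *ᵍ b))
      rhs = trans (at-neg (x * (E₉ * E₁₈)) n) (cong (λ y → -ᵍ y)
        (trans (at-* x (E₉ * E₁₈) n) (cong (z *ᵍ_) (at-* E₉ E₁₈ n))))

mainTheorem9 : (x : ℂ) → ∣ x ∣< 1ℚ →
    ∃[ I₀ ] ∃[ I₁ ] ∃[ I₂ ] ∃[ E₉ ] ∃[ E₁₈ ]
    ( IsI 0 x I₀ × IsI 1 x I₁ × IsI 2 x I₂
    × IsE (x ^ 9) E₉ × IsE (x ^ 18) E₁₈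
    × I₂ * I₀ ≈ - (2ℂ * I₁ ^ 2)
    × I₁ ≈ - (x * (E₉ * E₁₈)) )
mainTheorem9 x ∣x∣<1 =
  let (r , 0≤r , r<1 , x⊴rr) = radius x ∣x∣<1
      module V = Values x r 0≤r r<1 x⊴rr
  in V.I₀ , V.I₁ , V.I₂ , V.E₉ , V.E₁₈ ,
    V.IsI-limit 0 , V.IsI-limit 1 , V.IsI-limit 2 ,
    V.IsE-limit 8 , V.IsE-limit 17 , V.I₂I₀≈ , V.I₁≈
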